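{- For every $r$-tuple of partitions $(\lambda^{(1)}|\cdots|\lambda^{(r)})$, $$\mathcal{S}_{(\lambda^{(1)}|\cdots|\lambda^{(r)})}(X_1|\cdots|X_r) = \sum_{\sigma \in \mathcal{L}(\lambda^{(1)}|\cdots|\lambda^{(r)})} x^{\sigma}.$$
   Context: Key polynomials: for $\alpha\in\mathbb{Z}_{\ge0}^n$, $\mathcal{K}_\alpha(x_1,\dots,x_n)$ is determined by $\mathcal{K}_\alpha=x^\alpha$ if $\alpha_1\ge\cdots\ge\alpha_n$, and $\mathcal{K}_{s_i(\alpha)}=\xi_i(\mathcal{K}_\alpha)$ whenever $\alpha_i>\alpha_{i+1}$, where $\xi_i f=\frac{x_i f - x_{i+1}(s_i f)}{x_i-x_{i+1}}$ is the isobaric divided difference operator. For a partition $\lambda$, $\mathrm{rev}(\lambda)$ is $\lambda$ sorted into weakly increasing order, and $*$ denotes concatenation of compositions. The multi-symmetric Schur function is $$\mathcal{S}_{(\lambda^{(1)}|\cdots|\lambda^{(r)})}(X_1|\cdots|X_r)=\lim_{n_1,\dots,n_r\to\infty}\mathcal{K}_{(0^{n_1-\ell(\lambda^{(1)})}*\mathrm{rev}(\lambda^{(1)}))*\cdots*(0^{n_r-\ell(\lambda^{(r)})}*\mathrm{rev}(\lambda^{(r)}))}(x_{1,1},\dots,x_{1,n_1},\dots,x_{r,1},\dots,x_{r,n_r}),$$ where $X_j=x_{j,1}+x_{j,2}+\cdots$. Diagrams: for a composition $\mu=(\mu_1,\dots,\mu_n)$, the column diagram is $dg'(\mu)=\{(i,j):1\le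 i\le n,\ 1\le j\le\mu_i\}$ (column $i$ has height $\mu_i$), and the augmented diagram $\widehat{dg}(\mu)$ adds a basement row $\{(i,0):1\le i\le n\}$. Two distinct boxes attack if they are in the same row, or in consecutive rows with the box in the lower row strictly to the right of the box in the upper row. For $u=(i,j)$, let $d(u)=(i,j-1)$; $\mathrm{arm}(u)$ consists of boxes $(i',j)\in dg'(\mu)$ with $i'<i$ and $\mu_{i'}\le\mu_i$, together with boxes $(i',j-1)\in\widehat{dg}(\mu)$ with $i'>i$ and $\mu_{i'}<\mu_i$. A co-inversion triple $(u,v,w)$ has $w=d(u)$ and $v\in\mathrm{arm}(u)$, and is of Type 1 ($v$ in the row of $w$ to its right; the column of $u,w$ strictly taller than that of $v$) or Type 2 ($v$ in the row of $u$ to its left; the column of $u,w$ weakly taller than that of $v$), with labels satisfying $\sigma(u)<\sigma(v)<\sigma(w)$ or $\sigma(v)<\sigma(w)<\sigma(u)$ or $\sigma(w)<\sigma(u)<\sigma(v)$. Labels: the alphabet $\mathbb{N}(r)=\{i_j: i\ge1,\ 1\le j\le r\}$, extended by symbols $\omega_j+k$ ($1\le j\le r$, $k\ge0$), totally ordered by $a_1<\omega_1+b<c_2<\omega_2+d<\cdots<e_r<\omega_r+f$ (within each alphabet $j$, the $i_j$ are ordered by $i$, and the $\omega_j+k$ by $k$). Given $\sigma: dg'(\mathrm{rev}(\lambda^{(1)})*\cdots*\mathrm{rev}(\lambda^{(r)}))\to\mathbb{N}(r)$, let $\sigma^\star$ extend $\sigma$ to the augmented diagram by putting $\omega_i+j-1$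 in the basement box of column $\ell(\lambda^{(1)})+\cdots+\ell(\lambda^{(i-1)})+j$, for $1\le j\le\ell(\lambda^{(i)})$. Then $\mathcal{L}(\lambda^{(1)}|\cdots|\lambda^{(r)})$ is the set of such $\sigma$ for which $\sigma^\star$ is non-attacking (attacking boxes have distinct labels), weakly decreasing upwards in each column, and has no co-inversion triples. The weight is $x^\sigma=\prod_{j\ge1}\prod_{i\ge1}x_{j,i}^{|\sigma^{ -1}(i_j)|}$. -}

module Defs where

open import Data.Nat as ℕ using (ℕ; zero; suc; _∸_; _≤_; _<_; _≥_)
open import Data.Integer as ℤ using (ℤ; +_; _-_)
open import Data.Fin as Fin using (Fin; toℕ)
open import Data.List as List using (List; []; _∷_; length; reverse; replicate; _++_; concat; upTo)
import Data.List.Properties as LP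
open import Data.List.Relation.Unary.All using (All)
open import Data.List.Relation.Unary.Linked using (Linked)
open import Data.List.Relation.Binary.Pointwise using (Pointwise)
open import Data.Vec as Vec using (Vec; []; _∷_; lookup; toList; zipWith)
open import Data.Maybe as Maybe using (Maybe; just; nothing; maybe; _>>=_)
open import Data.Product using (_×_; _,_; uncurry; map₁)
import Data.Product.Properties as PP
open import Data.Sum using (_⊎_)
open import Data.Bool using (if_then_else_)
open import Relation.Nullary using (¬_; does; yes; no)
open import Relation.Binary.PropositionalEquality using (_≡_; _≢_)

-- Polynomials (formal power series) with integer coefficients in the
-- variables x_0, x_1, ..., represented by their coefficient function:
-- f a = coefficient of x^a, where the exponent vector a is a list
-- (position p of the list = exponent of the p-th variable, 0-based).

Poly : Set
Poly = List ℕ → ℤ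

at : {A : Set} → List A → ℕ → Maybe A
at []       _       = nothing
at (x ∷ xs) zero    = just x
at (x ∷ xs) (suc i) = at xs i

atD : List ℕ → ℕ → ℕ
atD xs i = maybe (λ x → x) 0 (at xs i)

monomial : List ℕ → Poly
monomial α a with LP.≡-dec ℕ._≟_ α a
... | yes _ = + 1
... | no  _ = + 0

decAt : List ℕ → ℕ → Maybe (List ℕ)
decAt []            _       = nothing
decAt (zero  ∷ xs)  zero    = nothing
decAt (suc k ∷ xs)  zero    = just (k ∷ xs)
decAt (x ∷ xs)      (suc i) = Maybe.map (x ∷_) (decAt xs i)

mulVar : ℕ → Poly → Poly
mulVar i f a = maybe f (+ 0) (decAt a i)

swapAt : ℕ → List ℕ → List ℕ
swapAt zero    (x ∷ y ∷ xs) = y ∷ x ∷ xs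
swapAt zero    xs           = xs
swapAt (suc i) []           = []
swapAt (suc i) (x ∷ xs)     = x ∷ swapAt i xs

swapP : ℕ → Poly → Poly
swapP i f a = f (swapAt i a)

-- IsKey α K : "K is the key polynomial K_α".
--  * K_α = x^α if α is weakly decreasing;
--  * K_{s_i α} = ξ_i K_α if α_i > α_{i+1}, where g = ξ_i f is characterised
--    (uniquely, as Z[[x]] is an integral domain) by
--    (x_i - x_{i+1}) g = x_i f - x_{i+1} (s_i f).
data IsKey : List ℕ → Poly → Set where
  dom  : ∀ α → Linked _≥_ α → IsKey α (monomial α)
  step : ∀ {α f} (g : Poly) (i : ℕ) → suc i < length α →
         atD α (suc i) < atD α i → IsKey α f →
         (∀ a → mulVar i g a - mulVar (suc i) g a
                ≡ mulVar i f a - mulVar (suc i) (swapP i f) a) →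
         IsKey (swapAt i α) g

IsPartition : List ℕ → Set
IsPartition l = Linked _≥_ l × All (λ x → 0 < x) l

-- Labels N(r) ∪ {ω_j + k}.
--   nat k j   stands for (k+1)_j
--   omega j k stands for ω_j + k
data Label (r : ℕ) : Set where
  nat   : ℕ → Fin r → Label r
  omega : Fin r → ℕ → Label r

_<L_ : ∀ {r} → Label r → Label r → Set
nat a j   <L nat b j'    = toℕ j < toℕ j' ⊎ (j ≡ j' × a < b)
nat a j   <L omega j' k  = toℕ j ≤ toℕ j'
omega j k <L nat a j'    = toℕ j < toℕ j'
omega j k <L omega j' k' = toℕ j < toℕ j' ⊎ (j ≡ j' × k < k')

_≤L_ : ∀ {r} → Label r → Label r → Set
a ≤L b = a ≡ b ⊎ a <L b

-- (block j, position k within block j) of each column of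
-- rev(λ^(1)) * ... * rev(λ^(r)) (columns 0-based)
blockInfo : ∀ {r} → Vec (List ℕ) r → List (Fin r × ℕ)
blockInfo []       = []
blockInfo (l ∷ ls) = List.map (λ k → (Fin.zero , k)) (upTo (length l))
                     ++ List.map (map₁ Fin.suc) (blockInfo ls)

shape : ∀ {r} → Vec (List ℕ) r → List ℕ
shape lams = concat (toList (Vec.map reverse lams))

keyComp : ∀ {r} → Vec (List ℕ) r → Vec ℕ r → List ℕ
keyComp lams ns =
  concat (toList (zipWith (λ l n → replicate (n ∸ length l) 0 ++ reverse l) lams ns))

-- Given exponents m_j = (exponent of x_{j,1}, x_{j,2}, ...) (finitely
-- supported, given as a list), the exponent vector of the monomial
-- ∏ x_{j,i}^{m_{j,i}} in the variables x_{1,1..n_1}, ..., x_{r,1..n_r}.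
expo : ∀ {r} → Vec (List ℕ) r → Vec ℕ r → List ℕ
expo m ns = concat (toList (zipWith (λ e n → e ++ replicate (n ∸ length e) 0) m ns))

-- Fillings σ : dg'(μ) → N(r).  Column c (0-based) is the list of its
-- labels from row 1 upwards; an entry (k , j) is the label (k+1)_j.

Filling : ℕ → Set
Filling r = List (List (ℕ × Fin r))

-- σ^⋆ at column c (0-based), row 'row' (row 0 = basement);
-- nothing outside the augmented diagram
star : ∀ {r} → Vec (List ℕ) r → Filling r → ℕ → ℕ → Maybe (Label r)
star lams σ c zero      = Maybe.map (uncurry omega) (at (blockInfo lams) c)
star lams σ c (suc row) = at σ c >>= λ col → Maybe.map (uncurry nat) (at col row)

HasShape : ∀ {r} → Vec (List ℕ) r → Filling r → Set
HasShape lams σ = Pointwise (λ col h → length col ≡ h) σ (shape lams)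

NonAttacking : ∀ {r} → Vec (List ℕ) r → Filling r → Set
NonAttacking lams σ =
  (∀ c c' row a b → c ≢ c' → star lams σ c row ≡ just a →
     star lams σ c' row ≡ just b → a ≢ b) ×
  (∀ c c' row a b → c < c' → star lams σ c (suc row) ≡ just a →
     star lams σ c' row ≡ just b → a ≢ b)

ColumnsDecreasing : ∀ {r} → Vec (List ℕ) r → Filling r → Set
ColumnsDecreasing lams σ =
  ∀ c row a b → star lams σ c (suc row) ≡ just a → star lams σ c row ≡ just b → a ≤L b

-- labels (σ(u), σ(v), σ(w)) forming a co-inversion pattern
CoinvLabels : ∀ {r} → Label r → Label r → Label r → Set
CoinvLabels a b d = (a <L b × b <L d) ⊎ (b <L d × d <L a) ⊎ (d <L a × a <L b)

-- u = (c, row+1), w = d(u) = (c, row), v ∈ arm(u)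
NoCoinversion : ∀ {r} → Vec (List ℕ) r → Filling r → Set
NoCoinversion lams σ =
  (∀ c c' row a b d → c < c' → atD μ c' < atD μ c →
     star lams σ c (suc row) ≡ just a → star lams σ c' row ≡ just b →
     star lams σ c row ≡ just d → ¬ CoinvLabels a b d) ×
  (∀ c c' row a b d → c' < c → atD μ c' ≤ atD μ c →
     star lams σ c (suc row) ≡ just a → star lams σ c' (suc row) ≡ just b →
     star lams σ c row ≡ just d → ¬ CoinvLabels a b d)
  where μ = shape lams

InL : ∀ {r} → Vec (List ℕ) r → Filling r → Set
InL lams σ = HasShape lams σ × NonAttacking lams σ × ColumnsDecreasing lams σ
             × NoCoinversion lams σ

count : ∀ {r} → ℕ × Fin r → List (ℕ × Fin r) → ℕ
count x [] = 0
count x (y ∷ ys) =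
  if does (PP.≡-dec ℕ._≟_ Fin._≟_ x y) then suc (count x ys) else count x ys

-- x^σ = ∏_j ∏_i x_{j,i}^{m_{j,i}}  (m_{j,i} = atD (lookup m j) (i-1))
HasWeight : ∀ {r} → Filling r → Vec (List ℕ) r → Set
HasWeight {r} σ m = ∀ (j : Fin r) (k : ℕ) → count (k , j) (concat σ) ≡ atD (lookup m j) k

{-# OPTIONS --safe #-}
-- Let F(c) be the generating function of the non-attacking, weakly decreasing,
-- co-inversion free fillings of columns of given heights over a basement with
-- arbitrary distinct labels.  If i stands to the left of i+1 in the basement, on
-- columns of heights h and h', and c' arises from c by exchanging i and i+1, then
--   F(c) = ξ_i F(c')  if h ≤ h',   and   F(c') = (ξ_i - 1) F(c)  if h > h'.
-- For the induction on the number of rows, the first rows over c and c' are grouped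
-- into orbits under exchanging i and i+1 among their own labels.  Up to a common
-- factor, validity of the four rows of an orbit depends only on the at most four
-- columns that carry i or i+1, and on the order of their heights: the possible
-- patterns are found by evaluation, and for each of them the induction hypothesis
-- gives the relation (a label missing in the row is put on an empty column at the
-- far left).
-- Going back along the steps that define a key polynomial, with the columns fixed
-- and only the labels moving, one reaches a basement whose labels increase as the
-- heights decrease; it has a single filling, so F is a monomial there.  Hence K_α is
-- F for the columns of α over the basement 1, 2, ..., n.  Over an increasing basement
-- empty columns impose no condition, so for large n_j these fillings are those of L,
-- with ω_j + k read as one of the last variables of block j.
module Submission where

open import Defs
open import Data.Nat using (ℕ; zero; suc; _≤_; _<_; z≤n; s≤s; _≤ᵇ_; _<ᵇ_)
import Data.Nat as ℕ
import Data.Nat.Properties as ℕP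
open import Data.Integer using (ℤ; +_; _+_; _-_; -_)
import Data.Integer.Properties as ℤP
open import Data.Integer.Tactic.RingSolver using (solve-∀)
open import Data.Bool using (Bool; true; false; _∧_; _∨_; not; if_then_else_; _xor_; T)
open import Data.Nat.ListAction using (sum)
open import Data.List using (List; []; _∷_; length; _++_; map; filter; concatMap; upTo; applyUpTo; mapMaybe; replicate; concat; reverse; zipWith)
open import Data.List.Membership.Propositional using (_∈_)
open import Data.List.Relation.Unary.Any using (here; there)
open import Data.List.Relation.Unary.All as All using ([]; _∷_) renaming (All to Allˡ)
open import Data.List.Relation.Unary.AllPairs as AllPairs using (AllPairs; []; _∷_)
open import Data.List.Relation.Unary.Unique.Propositional using (Unique)
import Data.List.Relation.Unary.Unique.Propositional.Properties as Unique
import Data.List.Membership.Propositional.Properties as ∈P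
import Data.List.Relation.Unary.Any.Properties as AnyP
import Data.List.Relation.Unary.All.Properties as AllP
import Data.List.Relation.Unary.AllPairs.Properties as AllPairsP
open import Data.List.Relation.Binary.Pointwise using (Pointwise; []; _∷_; Pointwise-length)
open import Data.List.Properties using (∷-injective)
open import Data.Vec using (Vec; []; _∷_; lookup)
open import Data.Fin using (Fin; toℕ)
import Data.Fin as Fin
import Data.Fin.Properties as FinP
import Data.Vec.Relation.Unary.All as VAll
open import Data.Maybe using (Maybe; just; nothing; maybe; _>>=_)
import Data.Maybe as Maybe
open import Data.Product using (_×_; _,_; proj₁; proj₂; ∃-syntax; map₁; map₂)
open import Data.Sum using (_⊎_; inj₁; inj₂)
open import Data.Empty using (⊥; ⊥-elim)
open import Function using (_∘_; id)
open import Relation.Binary using (tri<; tri≈; tri>)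
open import Relation.Nullary using (¬_; Dec; yes; no)
import Data.List.Properties as LP
open import Data.List.Relation.Unary.Linked using (Linked)
open import Data.List.Relation.Unary.Linked.Properties using (Linked⇒AllPairs)
open import Relation.Binary.PropositionalEquality using (_≡_; _≢_; refl; sym; trans; cong; cong₂; subst; subst₂; module ≡-Reasoning)
open import Data.Vec.Relation.Unary.All using (All)
open import Function.Bundles using (_⇔_; mk⇔; Equivalence)
open import Data.List.Membership.Propositional.Properties.WithK using (unique∧set⇒bag)
open import Data.List.Relation.Binary.BagAndSetEquality using (∼bag⇒↭)
open import Data.List.Relation.Binary.Permutation.Propositional.Properties using (↭-length)
import Data.Product.Properties as PP
import Data.Vec as Vec
import Data.Vec.Properties as VecP
open import Data.Bool.Properties using (not-involutive; ∧-commutativeMonoid) renaming (_≟_ to _≟ᵇ_)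
open import Algebra.Bundles using (module CommutativeMonoid)
open import Algebra.Properties.CommutativeSemigroup ℤP.+-commutativeSemigroup using () renaming (interchange to +-interchange)
open import Algebra.Properties.CommutativeSemigroup (CommutativeMonoid.commutativeSemigroup ∧-commutativeMonoid) using () renaming (interchange to ∧-interchange)

-- Polynomials

-- The basement has to be arbitrary because the first row of a filling is the basement of the rows
-- above it, and its labels come in no particular order. For the same reason the two relations must
-- be proved together: the order of the heights of the columns with `i` and `i+1` in the basement
-- does not decide the order of the heights of those that carry them one row up. The operator
-- `ξ_i - 1` is the one that produces Demazure atoms from each other; here it is written as
-- `F(c) + F(c') = ξ_i F(c)`, so that both cases speak of `ξ_i` only. No division is carried out:
-- `ξ_i` enters through its equation multiplied by `x_i - x_{i+1}`, and what is used of it is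
-- linearity, uniqueness, the fact that its values are symmetric and that it fixes symmetric
-- elements, and a Leibniz rule. The check can be finite because `i` and `i+1` are consecutive:
-- every other label compares in the same way with both, and of the heights only pairwise
-- comparisons matter.

infix 4 _≈[_]_
infixl 6 _⊞_

-- Exponent vectors in `n` variables are the lists of length `n`. A `Poly` also has values on other
-- lists, and these depend on the encoding: `monomial []` and the constant 1 differ at a list of one
-- zero.
_≈[_]_ : Poly → ℕ → Poly → Set
f ≈[ n ] g = ∀ a → length a ≡ n → f a ≡ g a

0P : Poly
0P _ = + 0

_⊞_ : Poly → Poly → Poly
(f ⊞ g) a = f a + g a

decAt-suc : ∀ x xs i → decAt (x ∷ xs) (suc i) ≡ Maybe.map (x ∷_) (decAt xs i)
decAt-suc zero xs i = refl
decAt-suc (suc x) xs i = refl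

decAt-length : ∀ a i {b} → decAt a i ≡ just b → length b ≡ length a
decAt-length (suc x ∷ a) zero refl = refl
decAt-length (x ∷ a) (suc i) eq rewrite decAt-suc x a i with decAt a i in e
decAt-length (x ∷ a) (suc i) refl | just c = cong suc (decAt-length a i e)

decAt-comm : ∀ a i j → (decAt a i >>= λ b → decAt b j) ≡ (decAt a j >>= λ b → decAt b i)
decAt-comm [] i j = refl
decAt-comm (x ∷ a) zero zero = refl
decAt-comm (zero ∷ a) zero (suc j) with decAt a j
... | nothing = refl
... | just _ = refl
decAt-comm (suc x ∷ a) zero (suc j) rewrite decAt-suc x a j with decAt a j
... | nothing = refl
... | just _ = refl
decAt-comm (zero ∷ a) (suc i) zero with decAt a i
... | nothing = refl
... | just _ = refl
decAt-comm (suc x ∷ a) (suc i) zero rewrite decAt-suc x a i with decAt a i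
... | nothing = refl
... | just _ = refl
decAt-comm (x ∷ a) (suc i) (suc j)
  rewrite decAt-suc x a i | decAt-suc x a j = begin
    (Maybe.map (x ∷_) (decAt a i) >>= λ b → decAt b (suc j)) ≡⟨ shift (decAt a i) j ⟩
    Maybe.map (x ∷_) (decAt a i >>= λ b → decAt b j) ≡⟨ cong (Maybe.map (x ∷_)) (decAt-comm a i j) ⟩
    Maybe.map (x ∷_) (decAt a j >>= λ b → decAt b i) ≡⟨ shift (decAt a j) i ⟨
    (Maybe.map (x ∷_) (decAt a j) >>= λ b → decAt b (suc i)) ∎
  where
  open ≡-Reasoning
  shift : ∀ (m : Maybe (List ℕ)) k → (Maybe.map (x ∷_) m >>= λ b → decAt b (suc k))
                                   ≡ Maybe.map (x ∷_) (m >>= λ b → decAt b k)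
  shift nothing k = refl
  shift (just b) k = decAt-suc x b k

mulVar-cong : ∀ {n f g} k → f ≈[ n ] g → mulVar k f ≈[ n ] mulVar k g
mulVar-cong k f≈g a |a| with decAt a k in e
... | nothing = refl
... | just b = f≈g b (trans (decAt-length a k e) |a|)

mulVar-comm : ∀ f i j a → mulVar i (mulVar j f) a ≡ mulVar j (mulVar i f) a
mulVar-comm f i j a = begin
  mulVar i (mulVar j f) a ≡⟨ bind (decAt a i) j ⟨
  maybe f (+ 0) (decAt a i >>= λ b → decAt b j) ≡⟨ cong (maybe f (+ 0)) (decAt-comm a i j) ⟩
  maybe f (+ 0) (decAt a j >>= λ b → decAt b i) ≡⟨ bind (decAt a j) i ⟩
  mulVar j (mulVar i f) a ∎
  where
  open ≡-Reasoning
  bind : ∀ (m : Maybe (List ℕ)) k →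
    maybe f (+ 0) (m >>= λ b → decAt b k) ≡ maybe (mulVar k f) (+ 0) m
  bind nothing k = refl
  bind (just _) k = refl

mulVar-⊞ : ∀ k f g a → mulVar k (f ⊞ g) a ≡ mulVar k f a + mulVar k g a
mulVar-⊞ k f g a with decAt a k
... | nothing = refl
... | just _ = refl

mulVar-0P : ∀ k a → mulVar k 0P a ≡ + 0
mulVar-0P k a with decAt a k
... | nothing = refl
... | just _ = refl

-- The transposition of i and i+1 on labels

sw : ℕ → ℕ → ℕ
sw zero zero = 1
sw zero (suc zero) = 0
sw zero (suc (suc l)) = suc (suc l)
sw (suc i) zero = zero
sw (suc i) (suc l) = suc (sw i l)

sw-invol : ∀ i l → sw i (sw i l) ≡ l
sw-invol zero zero = refl
sw-invol zero (suc zero) = refl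
sw-invol zero (suc (suc l)) = refl
sw-invol (suc i) zero = refl
sw-invol (suc i) (suc l) = cong suc (sw-invol i l)

sw-self : ∀ i → sw i i ≡ suc i
sw-self zero = refl
sw-self (suc i) = cong suc (sw-self i)

sw-self⁺ : ∀ i → sw i (suc i) ≡ i
sw-self⁺ zero = refl
sw-self⁺ (suc i) = cong suc (sw-self⁺ i)

swapAt-length : ∀ i a → length (swapAt i a) ≡ length a
swapAt-length zero [] = refl
swapAt-length zero (x ∷ []) = refl
swapAt-length zero (x ∷ y ∷ a) = refl
swapAt-length (suc i) [] = refl
swapAt-length (suc i) (x ∷ a) = cong suc (swapAt-length i a)

swapAt-invol : ∀ i a → swapAt i (swapAt i a) ≡ a
swapAt-invol zero [] = refl
swapAt-invol zero (x ∷ []) = refl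
swapAt-invol zero (x ∷ y ∷ a) = refl
swapAt-invol (suc i) [] = refl
swapAt-invol (suc i) (x ∷ a) = cong (x ∷_) (swapAt-invol i a)

-- The bound on `i` matters: on a shorter list `swapAt` changes nothing, while `sw` still moves the
-- position.
decAt-swap : ∀ i k a → suc i < length a →
  decAt (swapAt i a) (sw i k) ≡ Maybe.map (swapAt i) (decAt a k)
decAt-swap zero zero (zero ∷ zero ∷ a) _ = refl
decAt-swap zero zero (zero ∷ suc y ∷ a) _ = refl
decAt-swap zero zero (suc x ∷ zero ∷ a) _ = refl
decAt-swap zero zero (suc x ∷ suc y ∷ a) _ = refl
decAt-swap zero (suc zero) (zero ∷ zero ∷ a) _ = refl
decAt-swap zero (suc zero) (zero ∷ suc y ∷ a) _ = refl
decAt-swap zero (suc zero) (suc x ∷ zero ∷ a) _ = refl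
decAt-swap zero (suc zero) (suc x ∷ suc y ∷ a) _ = refl
decAt-swap zero (suc (suc k)) (x ∷ y ∷ a) _
  rewrite decAt-suc y (x ∷ a) (suc k) | decAt-suc x a k
        | decAt-suc x (y ∷ a) (suc k) | decAt-suc y a k with decAt a k
... | nothing = refl
... | just _ = refl
decAt-swap zero zero (x ∷ []) (s≤s ())
decAt-swap zero (suc k) (x ∷ []) (s≤s ())
decAt-swap (suc i) zero (zero ∷ a) _ = refl
decAt-swap (suc i) zero (suc x ∷ a) _ = refl
decAt-swap (suc i) (suc k) (x ∷ a) (s≤s i<)
  rewrite decAt-suc x (swapAt i a) (sw i k) | decAt-suc x a k | decAt-swap i k a i< with decAt a k
... | nothing = refl
... | just _ = refl

swapP-mulVar : ∀ i k f a → suc i < length a →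
  swapP i (mulVar (sw i k) f) a ≡ mulVar k (swapP i f) a
swapP-mulVar i k f a i< rewrite decAt-swap i k a i< with decAt a k
... | nothing = refl
... | just _ = refl

-- g = ξ_i f as polynomials in n variables, in the form used by IsKey

Xi : ℕ → ℕ → Poly → Poly → Set
Xi n i f g = ∀ a → length a ≡ n →
  mulVar i g a - mulVar (suc i) g a ≡ mulVar i f a - mulVar (suc i) (swapP i f) a

module _ {n i : ℕ} (i< : suc i < n) where

  private
    X Y S : Poly → Poly
    X = mulVar i
    Y = mulVar (suc i)
    S = swapP i

  private
    len : ∀ (a : List ℕ) → length a ≡ n → suc i < length a
    len a |a| = subst (suc i <_) (sym |a|) i<

  S-X : ∀ f → swapP i (mulVar i f) ≈[ n ] mulVar (suc i) (swapP i f)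
  S-X f a |a| = subst (λ l → S (mulVar l f) a ≡ Y (S f) a) (sw-self⁺ i) (swapP-mulVar i (suc i) f a (len a |a|))

  S-Y : ∀ f → swapP i (mulVar (suc i) f) ≈[ n ] mulVar i (swapP i f)
  S-Y f a |a| = subst (λ l → S (mulVar l f) a ≡ X (S f) a) (sw-self i) (swapP-mulVar i i f a (len a |a|))

  private
    S-cong : ∀ {f g} → f ≈[ n ] g → S f ≈[ n ] S g
    S-cong f≈g a |a| = f≈g (swapAt i a) (trans (swapAt-length i a) |a|)

  -- Comparing coefficients at `a` with its `i`-th exponent raised shows that the coefficient of `d`
  -- at `a` equals the one with a unit moved from position `i+1` to position `i`, or 0 if there is
  -- none to move. So induction on the exponent of `x_{i+1}` works, for power series as well.
  cancel-diff : ∀ d → X d ≈[ n ] Y d → d ≈[ n ] 0P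
  cancel-diff d Xd≈Yd a |a| = go (atD a (suc i)) a |a| refl
    where
    incAt : ℕ → List ℕ → List ℕ
    incAt k [] = []
    incAt zero (x ∷ xs) = suc x ∷ xs
    incAt (suc k) (x ∷ xs) = x ∷ incAt k xs

    inc-length : ∀ k xs → length (incAt k xs) ≡ length xs
    inc-length k [] = refl
    inc-length zero (x ∷ xs) = refl
    inc-length (suc k) (x ∷ xs) = cong suc (inc-length k xs)

    dec-inc : ∀ k xs → k < length xs → decAt (incAt k xs) k ≡ just xs
    dec-inc zero (x ∷ xs) _ = refl
    dec-inc (suc k) (x ∷ xs) (s≤s k<) rewrite decAt-suc x (incAt k xs) k | dec-inc k xs k< = refl

    dec-next : ∀ k xs → suc k < length xs →
      (atD xs (suc k) ≡ 0 × decAt (incAt k xs) (suc k) ≡ nothing) ⊎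
      (∃[ b ] decAt (incAt k xs) (suc k) ≡ just b × length b ≡ length xs × suc (atD b (suc k)) ≡ atD xs (suc k))
    dec-next zero (x ∷ []) (s≤s ())
    dec-next zero (x ∷ zero ∷ xs) _ = inj₁ (refl , refl)
    dec-next zero (x ∷ suc y ∷ xs) _ = inj₂ (_ , refl , refl , refl)
    dec-next (suc k) (x ∷ xs) (s≤s k<) with dec-next k xs k<
    ... | inj₁ (p , q) = inj₁ (p , trans (decAt-suc x (incAt k xs) (suc k)) (cong (Maybe.map (x ∷_)) q))
    ... | inj₂ (b , p , q , r) =
      inj₂ (x ∷ b , trans (decAt-suc x (incAt k xs) (suc k)) (cong (Maybe.map (x ∷_)) p) , cong suc q , r)

    step-down : ∀ a → length a ≡ n → d a ≡ Y d (incAt i a)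
    step-down a |a| = trans
      (cong (maybe d (+ 0)) (sym (dec-inc i a (ℕP.<-trans (ℕP.n<1+n i) (len a |a|)))))
      (Xd≈Yd (incAt i a) (trans (inc-length i a) |a|))

    go : ∀ m a → length a ≡ n → atD a (suc i) ≡ m → d a ≡ + 0
    go m a |a| e with dec-next i a (len a |a|)
    ... | inj₁ (_ , q) = trans (step-down a |a|) (cong (maybe d (+ 0)) q)
    go zero a |a| e | inj₂ (b , p , q , r) with () ← trans r e
    go (suc m) a |a| e | inj₂ (b , p , q , r) =
      trans (step-down a |a|) (trans (cong (maybe d (+ 0)) p)
        (go m b (trans q |a|) (ℕP.suc-injective (trans r e))))

  Xi-unique : ∀ {f g h} → Xi n i f g → Xi n i f h → g ≈[ n ] h
  Xi-unique {f} {g} {h} p q a |a| = ℤP.i-j≡0⇒i≡j _ _ (cancel-diff d eq a |a|)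
    where
    d : Poly
    d a = g a - h a
    lin : ∀ k a → mulVar k d a ≡ mulVar k g a - mulVar k h a
    lin k a with decAt a k
    ... | nothing = refl
    ... | just _ = refl
    shuffle : ∀ u v w z → u - v ≡ w - z → u - w ≡ v - z
    shuffle u v w z e = begin
      u - w ≡⟨ l₁ u v w ⟩
      (u - v) + (v - w) ≡⟨ cong (_+ (v - w)) e ⟩
      (w - z) + (v - w) ≡⟨ l₂ v w z ⟩
      v - z ∎
      where
      open ≡-Reasoning
      l₁ : ∀ u v w → u - w ≡ (u - v) + (v - w)
      l₁ = solve-∀
      l₂ : ∀ v w z → (w - z) + (v - w) ≡ v - z
      l₂ = solve-∀
    eq : X d ≈[ n ] Y d
    eq a |a| = trans (lin i a) (trans (shuffle (X g a) (Y g a) (X h a) (Y h a) (trans (p a |a|) (sym (q a |a|)))) (sym (lin (suc i) a)))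

  Xi-cong : ∀ {f f' g g'} → f ≈[ n ] f' → g ≈[ n ] g' → Xi n i f g → Xi n i f' g'
  Xi-cong p q e a |a| = begin
    _ ≡⟨ cong₂ _-_ (mulVar-cong i q a |a|) (mulVar-cong (suc i) q a |a|) ⟨
    _ ≡⟨ e a |a| ⟩
    _ ≡⟨ cong₂ _-_ (mulVar-cong i p a |a|) (mulVar-cong (suc i) (S-cong p) a |a|) ⟩
    _ ∎
    where open ≡-Reasoning

  Xi-sym⇒self : ∀ {f} → swapP i f ≈[ n ] f → Xi n i f f
  Xi-sym⇒self s a |a| = cong (λ z → X _ a - z) (sym (mulVar-cong (suc i) s a |a|))

  -- Exchanging the two variables changes the sign of both sides of the defining equation, so the
  -- exchanged `g` solves it too, and the solution is unique.
  Xi⇒sym : ∀ {f g} → Xi n i f g → swapP i g ≈[ n ] g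
  Xi⇒sym {f} {g} e = Xi-unique {f} {S g} {g} e' e
    where
    open ≡-Reasoning
    neg : ∀ u v w z → u - v ≡ w - z → v - u ≡ z - w
    neg u v w z h = trans (n₁ u v) (trans (cong -_ h) (n₂ w z))
      where
      n₁ : ∀ u v → v - u ≡ - (u - v)
      n₁ = solve-∀
      n₂ : ∀ w z → - (w - z) ≡ z - w
      n₂ = solve-∀
    SS : ∀ f → S (S f) ≈[ n ] f
    SS f a |a| = cong f (swapAt-invol i a)
    e' : Xi n i f (S g)
    e' a |a| = begin
      X (S g) a - Y (S g) a ≡⟨ cong₂ _-_ (S-Y g a |a|) (S-X g a |a|) ⟨
      S (Y g) a - S (X g) a ≡⟨ neg (X g (swapAt i a)) (Y g (swapAt i a)) (X f (swapAt i a)) (Y (S f) (swapAt i a)) (e (swapAt i a) (trans (swapAt-length i a) |a|)) ⟩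
      S (Y (S f)) a - S (X f) a ≡⟨ cong₂ _-_ (trans (S-Y (S f) a |a|) (mulVar-cong i (SS f) a |a|)) (S-X f a |a|) ⟩
      X f a - Y (S f) a ∎

  Xi-⊞ : ∀ {f f' g g'} → Xi n i f g → Xi n i f' g' → Xi n i (f ⊞ f') (g ⊞ g')
  Xi-⊞ {f} {f'} {g} {g'} p q a |a|
    rewrite mulVar-⊞ i g g' a | mulVar-⊞ (suc i) g g' a | mulVar-⊞ i f f' a | mulVar-⊞ (suc i) (S f) (S f') a
    = trans (i₁ (X g a) (X g' a) (Y g a) (Y g' a)) (trans (cong₂ _+_ (p a |a|) (q a |a|)) (sym (i₁ (X f a) (X f' a) (Y (S f) a) (Y (S f') a))))
    where
    i₁ : ∀ u v w z → (u + v) - (w + z) ≡ (u - w) + (v - z)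
    i₁ = solve-∀

  Xi-0 : Xi n i 0P 0P
  Xi-0 a _ = cong₂ _-_ {x = mulVar i 0P a} refl refl

  -- Idempotence of `ξ_i` in the form `ξ_i (ξ_i - 1) = 0`: here `g` is `ξ_i f - f`, and the symmetry
  -- of `f ⊞ g` is all that has to be added to the equation of `f`.
  Xi-annihilates : ∀ {f g} → Xi n i f (f ⊞ g) → Xi n i g 0P
  Xi-annihilates {f} {g} p a |a| = begin
    X 0P a - Y 0P a ≡⟨ cong₂ _-_ (mulVar-0P i a) (mulVar-0P (suc i) a) ⟩
    + 0 ≡⟨ fin (X f a) (X g a) (Y f a) (Y g a) (Y (S f) a) (Y (S g) a) eq₁ symm ⟩
    X g a - Y (S g) a ∎
    where
    open ≡-Reasoning
    eq₁ : (X f a + X g a) - (Y f a + Y g a) ≡ X f a - Y (S f) a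
    eq₁ rewrite sym (mulVar-⊞ i f g a) | sym (mulVar-⊞ (suc i) f g a) = p a |a|
    symm : Y (S f) a + Y (S g) a ≡ Y f a + Y g a
    symm = begin
      Y (S f) a + Y (S g) a ≡⟨ mulVar-⊞ (suc i) (S f) (S g) a ⟨
      Y (S (f ⊞ g)) a ≡⟨ mulVar-cong (suc i) (Xi⇒sym p) a |a| ⟩
      Y (f ⊞ g) a ≡⟨ mulVar-⊞ (suc i) f g a ⟩
      Y f a + Y g a ∎
    fin : ∀ xf xg yf yg ysf ysg → (xf + xg) - (yf + yg) ≡ xf - ysf → ysf + ysg ≡ yf + yg →
          + 0 ≡ xg - ysg
    fin xf xg yf yg ysf ysg h₁ h₂ = begin
      + 0 ≡⟨ ℤP.+-inverseʳ (xf - ysf) ⟨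
      (xf - ysf) - (xf - ysf) ≡⟨ cong (_- (xf - ysf)) h₁ ⟨
      ((xf + xg) - (yf + yg)) - (xf - ysf) ≡⟨ cong (λ z → ((xf + xg) - z) - (xf - ysf)) h₂ ⟨
      ((xf + xg) - (ysf + ysg)) - (xf - ysf) ≡⟨ r xf xg ysf ysg ⟩
      xg - ysg ∎
      where
      r : ∀ xf xg ysf ysg → ((xf + xg) - (ysf + ysg)) - (xf - ysf) ≡ xg - ysg
      r = solve-∀

  -- A twisted Leibniz rule, from the equation of `f` multiplied by `x_{i+1}`. It serves rows that
  -- contain only one of `i` and `i+1`: they contribute a factor `x_i` on one side and `x_{i+1}` on
  -- the other.
  Xi-raise : ∀ {f g} → Xi n i f g → Xi n i (X f) (X f ⊞ Y g)
  Xi-raise {f} {g} p a |a|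
    rewrite mulVar-⊞ i (X f) (Y g) a | mulVar-⊞ (suc i) (X f) (Y g) a
          | mulVar-cong (suc i) (S-X f) a |a| | mulVar-comm f (suc i) i a
          | mulVar-comm g i (suc i) a
    = fin (X (X f) a) (Y (X g) a) (X (Y f) a) (Y (Y g) a) (Y (Y (S f)) a) (trans (push p a |a|) (cong (_- Y (Y (S f)) a) (mulVar-comm f (suc i) i a)))
    where
    lin : ∀ u v a → mulVar (suc i) (λ b → u b - v b) a ≡ Y u a - Y v a
    lin u v a with decAt a (suc i)
    ... | nothing = refl
    ... | just _ = refl
    push : Xi n i f g → ∀ a → length a ≡ n → Y (X g) a - Y (Y g) a ≡ Y (X f) a - Y (Y (S f)) a
    push p a |a| = trans (sym (lin (X g) (Y g) a)) (trans (mulVar-cong (suc i) p a |a|) (lin (X f) (Y (S f)) a))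
    fin : ∀ xxf yxg xyf yyg yysf → yxg - yyg ≡ xyf - yysf →
      (xxf + yxg) - (xyf + yyg) ≡ xxf - yysf
    fin xxf yxg xyf yyg yysf h = trans (r₁ xxf yxg xyf yyg) (trans (cong (λ z → xxf - xyf + z) h) (r₂ xxf xyf yysf))
      where
      r₁ : ∀ xxf yxg xyf yyg → (xxf + yxg) - (xyf + yyg) ≡ xxf - xyf + (yxg - yyg)
      r₁ = solve-∀
      r₂ : ∀ xxf xyf yysf → xxf - xyf + (xyf - yysf) ≡ xxf - yysf
      r₂ = solve-∀

  private
    mulVar-⊟ : ∀ k u v a → mulVar k (λ b → u b - v b) a ≡ mulVar k u a - mulVar k v a
    mulVar-⊟ k u v a with decAt a k
    ... | nothing = refl
    ... | just _ = refl

    -- Multiplication by a factor symmetric in `x_i` and `x_{i+1}`, which commutes with `ξ_i`. The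
    -- instances are a variable fixed by `sw i` and the product `x_i x_{i+1}`.
    record Multiplier (M : Poly → Poly) : Set where
      field
        M-cong : ∀ {f g} → f ≈[ n ] g → M f ≈[ n ] M g
        M-⊟ : ∀ u v a → M (λ b → u b - v b) a ≡ M u a - M v a
        M-comm : ∀ k f → mulVar k (M f) ≈[ n ] M (mulVar k f)
        M-S : ∀ f → S (M f) ≈[ n ] M (S f)

    Xi-multiplier : ∀ {M f g} → Multiplier M → Xi n i f g → Xi n i (M f) (M g)
    Xi-multiplier {M} {f} {g} mult p a |a| = begin
      X (M g) a - Y (M g) a ≡⟨ cong₂ _-_ (M-comm i g a |a|) (M-comm (suc i) g a |a|) ⟩
      M (X g) a - M (Y g) a ≡⟨ M-⊟ (X g) (Y g) a ⟨
      M (λ b → X g b - Y g b) a ≡⟨ M-cong p a |a| ⟩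
      M (λ b → X f b - Y (S f) b) a ≡⟨ M-⊟ (X f) (Y (S f)) a ⟩
      M (X f) a - M (Y (S f)) a ≡⟨ cong₂ _-_ (M-comm i f a |a|) (M-comm (suc i) (S f) a |a|) ⟨
      X (M f) a - Y (M (S f)) a ≡⟨ cong (λ z → X (M f) a - z) (mulVar-cong (suc i) (M-S f) a |a|) ⟨
      X (M f) a - Y (S (M f)) a ∎
      where
      open ≡-Reasoning
      open Multiplier mult

  Xi-mulVar : ∀ {f g} k → sw i k ≡ k → Xi n i f g → Xi n i (mulVar k f) (mulVar k g)
  Xi-mulVar k fix = Xi-multiplier record
    { M-cong = mulVar-cong k
    ; M-⊟ = mulVar-⊟ k
    ; M-comm = λ l f a _ → mulVar-comm f l k a
    ; M-S = λ f a |a| → subst (λ l → S (mulVar l f) a ≡ mulVar k (S f) a) fix (swapP-mulVar i k f a (len a |a|))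
    }

  Xi-XY : ∀ {f g} → Xi n i f g → Xi n i (mulVar i (mulVar (suc i) f)) (mulVar i (mulVar (suc i) g))
  Xi-XY = Xi-multiplier record
    { M-cong = λ p → mulVar-cong i (mulVar-cong (suc i) p)
    ; M-⊟ = λ u v a → trans (ext i (mulVar-⊟ (suc i) u v) a) (mulVar-⊟ i (Y u) (Y v) a)
    ; M-comm = λ l f a _ → trans (mulVar-comm (Y f) l i a) (ext i (mulVar-comm f l (suc i)) a)
    ; M-S = λ f a |a| → trans (S-X (Y f) a |a|)
                 (trans (mulVar-cong (suc i) (S-Y f) a |a|) (mulVar-comm (S f) (suc i) i a))
    }
    where
    ext : ∀ {f g} k → (∀ a → f a ≡ g a) → ∀ a → mulVar k f a ≡ mulVar k g a
    ext k f≗g a = mulVar-cong k (λ b _ → f≗g b) a refl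

  -- The integers have no 2-torsion. Summing a row together with its variant over all rows counts
  -- every row twice, and this removes the factor.
  Xi-halve : ∀ {f g} → Xi n i (f ⊞ f) (g ⊞ g) → Xi n i f g
  Xi-halve {f} {g} p a |a| = half _ _ (trans (sym (d (X g a) (Y g a))) (trans q (d (X f a) (Y (S f) a))))
    where
    q : (X g a + X g a) - (Y g a + Y g a) ≡ (X f a + X f a) - (Y (S f) a + Y (S f) a)
    q rewrite sym (mulVar-⊞ i g g a) | sym (mulVar-⊞ (suc i) g g a)
            | sym (mulVar-⊞ i f f a) | sym (mulVar-⊞ (suc i) (S f) (S f) a) = p a |a|
    d : ∀ u v → (u + u) - (v + v) ≡ (u - v) + (u - v)
    d = solve-∀
    half : ∀ u v → u + u ≡ v + v → u ≡ v
    half u v e = ℤP.*-cancelˡ-≡ (+ 2) u v (trans (t u) (trans e (sym (t v))))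
      where
      t : ∀ u → + 2 Data.Integer.* u ≡ u + u
      t = solve-∀

-- Rows of a filling

allᵇ : {A : Set} → (A → Bool) → List A → Bool
allᵇ p [] = true
allᵇ p (x ∷ xs) = p x ∧ allᵇ p xs

pairsᵇ : {A : Set} → (A → A → Bool) → List A → Bool
pairsᵇ p [] = true
pairsᵇ p (x ∷ xs) = allᵇ (p x) xs ∧ pairsᵇ p xs

-- One column at a row: a label t, and above it either nothing, or a label u
-- with h more boxes on top.
data Cell (L : Set) : Set where
  dead : (t : L) → Cell L
  live : (h : ℕ) (t u : L) → Cell L

module Rows {L : Set} (lt : L → L → Bool) where

  le neq : L → L → Bool
  le a b = not (lt b a)
  neq a b = lt a b ∨ lt b a

  descends : Cell L → Bool
  descends (dead _) = true
  descends (live _ t u) = le u t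

  -- The first cell is the left one. In descending columns the only co-inversion patterns are
  -- `u < t' < t`, if the left column is strictly taller, and `u' < u < t'`, if it is weakly
  -- shorter; the weak inequalities add the equalities, which are attacks. An empty left column has
  -- no box in the upper row and so meets no condition.
  compatible : Cell L → Cell L → Bool
  compatible (dead _) _ = true
  compatible (live h t u) (dead t') = not (le u t' ∧ le t' t)
  compatible (live h t u) (live h' t' u') = neq u u' ∧
    (if h ≤ᵇ h' then not (lt u' u ∧ le u t') else not (le u t' ∧ le t' t))

  valid : List (Cell L) → Bool
  valid r = allᵇ descends r ∧ pairsᵇ compatible r

-- Labels as seen from i: smaller than i, i (sp false), i+1 (sp true), larger.
data Lab : Set where
  lo : ℕ → Lab
  sp : Bool → Lab
  hi : ℕ → Lab

_<ˡ_ : Lab → Lab → Bool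
lo a <ˡ lo b = a <ᵇ b
lo a <ˡ sp y = true
lo a <ˡ hi b = true
sp x <ˡ lo b = false
sp x <ˡ sp y = not x ∧ y
sp x <ˡ hi b = true
hi a <ˡ lo b = false
hi a <ˡ sp y = false
hi a <ˡ hi b = a <ᵇ b

module RowLab = Rows _<ˡ_

-- The special cells of a row, those with a label i or i+1.
data Kind : Set where
  Z A C : Bool → Kind
  B : Bool → Bool → Kind

-- No further kinds arise in descending columns: an ordinary label above `i` or `i+1` must be
-- smaller, and one below `i` or `i+1` must be larger.
cell : Kind → ℕ → ℕ → Cell Lab
cell (Z x) h p = dead (sp x)
cell (A x) h p = live h (sp x) (lo p)
cell (B x y) h p = live h (sp x) (sp y)
cell (C y) h p = live h (hi p) (sp y)

descendsK : Kind → Bool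
descendsK k = RowLab.descends (cell k 0 0)

-- Compatibility of special cells apart from the comparisons that do not involve i or i+1;
-- the boolean tells whether the left column is weakly shorter.
compatibleK : Bool → Kind → Kind → Bool
compatibleK b k k' = RowLab.compatible (cell k (if b then 0 else 1) 0) (cell k' 0 1)

compatibleAll : Kind → List Bool → List Kind → Bool
compatibleAll k (b ∷ bs) (k' ∷ ks) = compatibleK b k k' ∧ compatibleAll k bs ks
compatibleAll k _ _ = true

validK : List Kind → List (List Bool) → Bool
validK (k ∷ ks) (bs ∷ bss) = descendsK k ∧ (compatibleAll k bs ks ∧ validK ks bss)
validK _ _ = true

isT isU : Kind → Bool
isT (C _) = false
isT _ = true
isU (B _ _) = true
isU (C _) = true
isU _ = false

flipT flipU : Kind → Kind
flipT (Z x) = Z (not x)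
flipT (A x) = A (not x)
flipT (B x y) = B (not x) y
flipT (C y) = C y
flipU (Z x) = Z x
flipU (A x) = A x
flipU (B x y) = B x (not y)
flipU (C y) = C (not y)

pick : (Kind → Bool) → List Kind → List Bool → Bool
pick p (k ∷ ks) (b ∷ bs) = if p k then b else pick p ks bs
pick p _ _ = false

firstTwo : (Kind → Bool) → List Kind → List (List Bool) → Bool
firstTwo p (k ∷ ks) (bs ∷ bss) = if p k then pick p ks bs else firstTwo p ks bss
firstTwo p _ _ = false

-- The finite check

Quad : Set
Quad = Bool × Bool × Bool × Bool

-- The order is: the row itself, top labels exchanged, bottom labels exchanged, both exchanged. So
-- the first two rows lie over one basement and the last two over the other.
quad : List Kind → List (List Bool) → Quad
quad ks bss = validK ks bss , validK (map flipU ks) bss , validK (map flipT ks) bss , validK (map flipT (map flipU ks)) bss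

-- The possible values of quad for given orders of the heights of the columns with bottom labels i, i+1, and
-- of those with top labels i, i+1 (false also standing for a single top label).
allowed : Bool → Bool → List Quad
allowed true true = (false , false , false , false) ∷ (true , false , false , true) ∷ (true , false , true , false) ∷ []
allowed false true = (false , false , false , false) ∷ (true , false , false , false) ∷ []
allowed true false = (false , false , false , false) ∷ (true , true , true , false) ∷ (true , true , true , true) ∷ (false , false , false , true) ∷ []
allowed false false = (false , false , false , false) ∷ (true , false , false , true) ∷ (true , true , false , false) ∷ []

allowed₀ : Bool → List Quad
allowed₀ true = (false , false , false , false) ∷ (true , true , true , true) ∷ []
allowed₀ false = (false , false , false , false) ∷ (true , true , false , false) ∷ []

eqᵇ : Bool → Bool → Bool
eqᵇ true b = b
eqᵇ false b = not b

eqQ : Quad → Quad → Bool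
eqQ (a , b , c , d) (a' , b' , c' , d') = eqᵇ a a' ∧ (eqᵇ b b' ∧ (eqᵇ c c' ∧ eqᵇ d d'))

elem : Quad → List Quad → Bool
elem q [] = false
elem q (x ∷ xs) = eqQ q x ∨ elem q xs

-- The two lists are the special labels of the bottom and of the top, read from left to right; each
-- case chooses the kind of the leftmost special column that remains.
allWords : List Bool → List Bool → (List Kind → Bool) → Bool
allWords [] [] f = f []
allWords (x ∷ ts) [] f = allWords ts [] (f ∘ (Z x ∷_)) ∧ allWords ts [] (f ∘ (A x ∷_))
allWords [] (y ∷ us) f = allWords [] us (f ∘ (C y ∷_))
allWords (x ∷ ts) (y ∷ us) f = allWords ts (y ∷ us) (f ∘ (Z x ∷_)) ∧ (allWords ts (y ∷ us) (f ∘ (A x ∷_))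
  ∧ (allWords ts us (f ∘ (B x y ∷_)) ∧ allWords (x ∷ ts) us (f ∘ (C y ∷_))))

-- An empty column is weakly shorter than every other and never weakly taller than a nonempty one,
-- so only two nonempty columns leave a choice.
orders : Kind → Kind → List Bool
orders (Z _) _ = true ∷ []
orders _ (Z _) = false ∷ []
orders _ _ = true ∷ false ∷ []

allOrders₁ : Kind → List Kind → (List Bool → Bool) → Bool
allOrders₁ k [] f = f []
allOrders₁ k (k' ∷ ks) f = allᵇ (λ b → allOrders₁ k ks (f ∘ (b ∷_))) (orders k k')

allOrders : List Kind → (List (List Bool) → Bool) → Bool
allOrders [] f = f []
allOrders (k ∷ ks) f = allOrders₁ k ks (λ bs → allOrders ks (f ∘ (bs ∷_)))

-- The bits `false`, `true` put `i` to the left of `i+1` in the basement. Every table of pairwise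
-- comparisons is tried, even intransitive ones that no heights realise, so that soundness can treat
-- one comparison at a time.
check : List Bool → (Bool → Bool → List Quad) → Bool
check us al = allWords (false ∷ true ∷ []) us λ ks → allOrders ks λ bss →
  elem (quad ks bss) (al (firstTwo isT ks bss) (firstTwo isU ks bss))

check₀ : check [] (λ b _ → allowed₀ b) ≡ true
check₀ = refl

check₁ : check (false ∷ []) (λ b _ → allowed b false) ≡ true
check₁ = refl

check₂ : check (false ∷ true ∷ []) allowed ≡ true
check₂ = refl

-- Soundness of the finite check

∧-true : ∀ {a b} → a ∧ b ≡ true → a ≡ true × b ≡ true
∧-true {true} e = refl , e

∧-intro : ∀ {a b} → a ≡ true → b ≡ true → a ∧ b ≡ true
∧-intro refl e = e

eqQ-sound : ∀ q q' → eqQ q q' ≡ true → q ≡ q'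
eqQ-sound (a , b , c , d) (a' , b' , c' , d') e
  with ea , e ← ∧-true {eqᵇ a a'} e with eb , e ← ∧-true {eqᵇ b b'} e with ec , ed ← ∧-true {eqᵇ c c'} e
  = cong₂ _,_ (f a a' ea) (cong₂ _,_ (f b b' eb) (cong₂ _,_ (f c c' ec) (f d d' ed)))
  where
  f : ∀ a b → eqᵇ a b ≡ true → a ≡ b
  f true true _ = refl
  f false false _ = refl

elem-sound : ∀ q qs → elem q qs ≡ true → q ∈ qs
elem-sound q (x ∷ qs) e with eqQ q x in eq
... | true = here (eqQ-sound q x eq)
... | false = there (elem-sound q qs e)

bitT bitU : Kind → Maybe Bool
bitT (Z x) = just x
bitT (A x) = just x
bitT (B x _) = just x
bitT (C _) = nothing
bitU (Z _) = nothing
bitU (A _) = nothing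
bitU (B _ y) = just y
bitU (C y) = just y

allWords-sound : ∀ ks f → allWords (mapMaybe bitT ks) (mapMaybe bitU ks) f ≡ true → f ks ≡ true
allWords-sound [] f e = e
allWords-sound (Z x ∷ ks) f e with mapMaybe bitU ks | allWords-sound ks
... | [] | ih = ih (f ∘ (Z x ∷_)) (proj₁ (∧-true e))
... | _ ∷ _ | ih = ih (f ∘ (Z x ∷_)) (proj₁ (∧-true e))
allWords-sound (A x ∷ ks) f e with mapMaybe bitU ks | allWords-sound ks
... | [] | ih = ih (f ∘ (A x ∷_)) (proj₂ (∧-true {allWords (mapMaybe bitT ks) [] (f ∘ (Z x ∷_))} e))
... | y ∷ us | ih
  with _ , e ← ∧-true {allWords (mapMaybe bitT ks) (y ∷ us) (f ∘ (Z x ∷_))} e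
  = ih (f ∘ (A x ∷_)) (proj₁ (∧-true e))
allWords-sound (B x y ∷ ks) f e
  with _ , e ← ∧-true {allWords (mapMaybe bitT ks) (y ∷ mapMaybe bitU ks) (f ∘ (Z x ∷_))} e
  with _ , e ← ∧-true {allWords (mapMaybe bitT ks) (y ∷ mapMaybe bitU ks) (f ∘ (A x ∷_))} e
  = allWords-sound ks (f ∘ (B x y ∷_)) (proj₁ (∧-true e))
allWords-sound (C y ∷ ks) f e with mapMaybe bitT ks | allWords-sound ks
... | [] | ih = ih (f ∘ (C y ∷_)) e
... | x ∷ ts | ih
  with _ , e ← ∧-true {allWords ts (y ∷ mapMaybe bitU ks) (f ∘ (Z x ∷_))} e
  with _ , e ← ∧-true {allWords ts (y ∷ mapMaybe bitU ks) (f ∘ (A x ∷_))} e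
  with _ , e ← ∧-true {allWords ts (mapMaybe bitU ks) (f ∘ (B x y ∷_))} e
  = ih (f ∘ (C y ∷_)) e

-- A special cell: kind, height above the top label, and label other than i and i+1.
Item : Set
Item = Kind × ℕ × ℕ

cellOf : Item → Cell Lab
cellOf (k , h , p) = cell k h p

-- The height recorded with `Z` is a dummy; the first two clauses give the empty column its place
-- below all nonempty ones, in agreement with `orders`.
order : Item → Item → Bool
order (Z _ , _ , _) _ = true
order _ (Z _ , _ , _) = false
order (_ , h , _) (_ , h' , _) = h ≤ᵇ h'

orderTable : List Item → List (List Bool)
orderTable [] = []
orderTable (x ∷ xs) = map (order x) xs ∷ orderTable xs

kinds : List Item → List Kind
kinds = map proj₁

allOrders-sound : ∀ xs f → allOrders (kinds xs) f ≡ true → f (orderTable xs) ≡ true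
allOrders-sound [] f e = e
allOrders-sound (x ∷ xs) f e = allOrders-sound xs _ (row xs _ e)
  where
  both : ∀ b f → (f true ∧ (f false ∧ true)) ≡ true → f b ≡ true
  both true f e = proj₁ (∧-true e)
  both false f e = proj₁ (∧-true (proj₂ (∧-true {f true} e)))
  one : ∀ x y f → allᵇ f (orders (proj₁ x) (proj₁ y)) ≡ true → f (order x y) ≡ true
  one (Z _ , _) y f e = proj₁ (∧-true e)
  one (A _ , h , _) (Z _ , _) f e = proj₁ (∧-true e)
  one (B _ _ , h , _) (Z _ , _) f e = proj₁ (∧-true e)
  one (C _ , h , _) (Z _ , _) f e = proj₁ (∧-true e)
  one (A _ , h , _) (A _ , h' , _) f e = both (h ≤ᵇ h') f e
  one (A _ , h , _) (B _ _ , h' , _) f e = both (h ≤ᵇ h') f e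
  one (A _ , h , _) (C _ , h' , _) f e = both (h ≤ᵇ h') f e
  one (B _ _ , h , _) (A _ , h' , _) f e = both (h ≤ᵇ h') f e
  one (B _ _ , h , _) (B _ _ , h' , _) f e = both (h ≤ᵇ h') f e
  one (B _ _ , h , _) (C _ , h' , _) f e = both (h ≤ᵇ h') f e
  one (C _ , h , _) (A _ , h' , _) f e = both (h ≤ᵇ h') f e
  one (C _ , h , _) (B _ _ , h' , _) f e = both (h ≤ᵇ h') f e
  one (C _ , h , _) (C _ , h' , _) f e = both (h ≤ᵇ h') f e
  row : ∀ ys f → allOrders₁ (proj₁ x) (kinds ys) f ≡ true → f (map (order x) ys) ≡ true
  row [] f e = e
  row (y ∷ ys) f e = row ys (f ∘ (order x y ∷_)) (one x y (λ b → allOrders₁ (proj₁ x) (kinds ys) (f ∘ (b ∷_))) e)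

check-sound : ∀ us al → check us al ≡ true → ∀ xs →
  mapMaybe bitT (kinds xs) ≡ false ∷ true ∷ [] → mapMaybe bitU (kinds xs) ≡ us →
  quad (kinds xs) (orderTable xs) ∈ al (firstTwo isT (kinds xs) (orderTable xs)) (firstTwo isU (kinds xs) (orderTable xs))
check-sound us al e xs ts refl = elem-sound _ _ (allOrders-sound xs (verdict (kinds xs)) (allWords-sound (kinds xs)
  (λ ks → allOrders ks (verdict ks)) (subst (λ ts → allWords ts us (λ ks → allOrders ks (verdict ks)) ≡ true) (sym ts) e)))
  where
  verdict : List Kind → List (List Bool) → Bool
  verdict ks bss = elem (quad ks bss) (al (firstTwo isT ks bss) (firstTwo isU ks bss))

-- The special cells decide between the variants of a row

-- The default clause also drops the ascending columns that contain `i` or `i+1`. This does no harm,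
-- since no variant of such a row is valid.
special : Cell Lab → Maybe Item
special (dead (sp x)) = just (Z x , 0 , 0)
special (live h (sp x) (lo p)) = just (A x , h , p)
special (live h (sp x) (sp y)) = just (B x y , h , 0)
special (live h (hi p) (sp y)) = just (C y , h , p)
special _ = nothing

specials : List (Cell Lab) → List Item
specials = mapMaybe special

infix 4 _≃_ _≃ᶜ_
-- All `sp` labels are related: no label lies between `i` and `i+1`, so related labels compare alike
-- with every ordinary label.
data _≃_ : Lab → Lab → Set where
  lo : ∀ {a} → lo a ≃ lo a
  hi : ∀ {a} → hi a ≃ hi a
  sp : ∀ {x y} → sp x ≃ sp y

data _≃ᶜ_ : Cell Lab → Cell Lab → Set where
  dead : ∀ {t t'} → t ≃ t' → dead t ≃ᶜ dead t'
  live : ∀ {h t t' u u'} → t ≃ t' → u ≃ u' → live h t u ≃ᶜ live h t' u'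

≃-refl : ∀ a → a ≃ a
≃-refl (lo _) = lo
≃-refl (sp _) = sp
≃-refl (hi _) = hi

≃ᶜ-refl : ∀ c → c ≃ᶜ c
≃ᶜ-refl (dead t) = dead (≃-refl t)
≃ᶜ-refl (live h t u) = live (≃-refl t) (≃-refl u)

≃-sym : ∀ {a b} → a ≃ b → b ≃ a
≃-sym lo = lo
≃-sym hi = hi
≃-sym sp = sp

≃-trans : ∀ {a b c} → a ≃ b → b ≃ c → a ≃ c
≃-trans lo q = q
≃-trans hi q = q
≃-trans sp sp = sp

≃ᶜ-sym : ∀ {c d} → c ≃ᶜ d → d ≃ᶜ c
≃ᶜ-sym (dead p) = dead (≃-sym p)
≃ᶜ-sym (live p q) = live (≃-sym p) (≃-sym q)

≃ᶜ-trans : ∀ {c d e} → c ≃ᶜ d → d ≃ᶜ e → c ≃ᶜ e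
≃ᶜ-trans (dead p) (dead p') = dead (≃-trans p p')
≃ᶜ-trans (live p q) (live p' q') = live (≃-trans p p') (≃-trans q q')

data Ordinary : Lab → Set where
  lo : ∀ {a} → Ordinary (lo a)
  hi : ∀ {a} → Ordinary (hi a)

data Ordinaryᶜ : Cell Lab → Set where
  dead : ∀ {t} → Ordinary t → Ordinaryᶜ (dead t)
  live : ∀ {h t u} → Ordinary t → Ordinary u → Ordinaryᶜ (live h t u)

<ˡ-ordˡ : ∀ {a b b'} → Ordinary a → b ≃ b' → (a <ˡ b) ≡ (a <ˡ b')
<ˡ-ordˡ o lo = refl
<ˡ-ordˡ o hi = refl
<ˡ-ordˡ lo sp = refl
<ˡ-ordˡ hi sp = refl

<ˡ-ordʳ : ∀ {a b b'} → Ordinary a → b ≃ b' → (b <ˡ a) ≡ (b' <ˡ a)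
<ˡ-ordʳ o lo = refl
<ˡ-ordʳ o hi = refl
<ˡ-ordʳ lo sp = refl
<ˡ-ordʳ hi sp = refl

open RowLab

compatible-ordˡ : ∀ {c d d'} → Ordinaryᶜ c → d ≃ᶜ d' → compatible c d ≡ compatible c d'
compatible-ordˡ (dead _) _ = refl
compatible-ordˡ (live ot ou) (dead t)
  rewrite <ˡ-ordʳ ou t | <ˡ-ordˡ ot t = refl
compatible-ordˡ (live ot ou) (live t u)
  rewrite <ˡ-ordʳ ou t | <ˡ-ordˡ ot t | <ˡ-ordʳ ou u | <ˡ-ordˡ ou u = refl

compatible-ordʳ : ∀ {c d d'} → Ordinaryᶜ c → d ≃ᶜ d' → compatible d c ≡ compatible d' c
compatible-ordʳ (dead ot) (dead _) = refl
compatible-ordʳ (live _ _) (dead _) = refl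
compatible-ordʳ (dead ot) (live t u)
  rewrite <ˡ-ordˡ ot u | <ˡ-ordʳ ot t = refl
compatible-ordʳ (live ot ou) (live t u)
  rewrite <ˡ-ordˡ ot u | <ˡ-ordʳ ot t | <ˡ-ordʳ ou u | <ˡ-ordˡ ou u = refl

data SameShape : Kind → Kind → Set where
  Z : ∀ {x x'} → SameShape (Z x) (Z x')
  A : ∀ {x x'} → SameShape (A x) (A x')
  B : ∀ {x y x' y'} → SameShape (B x y) (B x' y')
  C : ∀ {y y'} → SameShape (C y) (C y')

-- The comparisons between special cells that do not involve i and i+1
rest : Item → Item → Bool
rest (A _ , h , a) (A _ , h' , a') = neq (lo a) (lo a') ∧ (not (h ≤ᵇ h') ∨ not (a' <ᵇ a))
rest (C _ , h , b) (C _ , h' , b') = (h ≤ᵇ h') ∨ not (le (hi b') (hi b))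
rest _ _ = true

rest-shape : ∀ {k₁ k₂ l₁ l₂ h p g q} → SameShape k₁ k₂ → SameShape l₁ l₂ →
  rest (k₁ , h , p) (l₁ , g , q) ≡ rest (k₂ , h , p) (l₂ , g , q)
rest-shape Z _ = refl
rest-shape B _ = refl
rest-shape A Z = refl
rest-shape A A = refl
rest-shape A B = refl
rest-shape A C = refl
rest-shape C Z = refl
rest-shape C A = refl
rest-shape C B = refl
rest-shape C C = refl

order-shape : ∀ {k₁ k₂ l₁ l₂ h p g q} → SameShape k₁ k₂ → SameShape l₁ l₂ →
  order (k₁ , h , p) (l₁ , g , q) ≡ order (k₂ , h , p) (l₂ , g , q)
order-shape Z _ = refl
order-shape A Z = refl
order-shape A A = refl
order-shape A B = refl
order-shape A C = refl
order-shape B Z = refl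
order-shape B A = refl
order-shape B B = refl
order-shape B C = refl
order-shape C Z = refl
order-shape C A = refl
order-shape C B = refl
order-shape C C = refl

-- The test cells in `compatibleK` carry 0 on the left and 1 on the right as ordinary labels. In
-- this order a comparison between two ordinary labels never obstructs, so exactly the factor `rest`
-- is split off.
compatible-special : ∀ x y →
  compatible (cellOf x) (cellOf y) ≡ rest x y ∧ compatibleK (order x y) (proj₁ x) (proj₁ y)
compatible-special (Z _ , h , p) y = refl
compatible-special (A _ , h , p) (Z _ , _) = refl
compatible-special (B _ _ , h , p) (Z _ , _) = refl
compatible-special (C _ , h , p) (Z _ , _) = refl
compatible-special (A x , h , a) (A x' , g , a') with h ≤ᵇ g | a' <ᵇ a | a <ᵇ a'
... | true | true | true = refl
... | true | true | false = refl
... | true | false | true = refl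
... | true | false | false = refl
... | false | true | true = refl
... | false | true | false = refl
... | false | false | true = refl
... | false | false | false = refl
compatible-special (A x , h , a) (B x' y' , g , _) with h ≤ᵇ g
... | true = refl
... | false = refl
compatible-special (A x , h , a) (C y' , g , _) with h ≤ᵇ g
... | true = refl
... | false = refl
compatible-special (B x y , h , _) (A x' , g , _) with h ≤ᵇ g
... | true = refl
... | false = refl
compatible-special (B x y , h , _) (B x' y' , g , _) with h ≤ᵇ g
... | true = refl
... | false = refl
compatible-special (B x y , h , _) (C y' , g , _) with h ≤ᵇ g
... | true = refl
... | false = refl
compatible-special (C y , h , _) (A x' , g , _) with h ≤ᵇ g
... | true = refl
... | false = refl
compatible-special (C y , h , _) (B x' y' , g , _) with h ≤ᵇ g
... | true = refl
... | false = refl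
compatible-special (C y , h , b) (C y' , g , b') with h ≤ᵇ g | b <ᵇ b' | neq (sp y) (sp y')
... | true | _ | _ = refl
... | false | true | true = refl
... | false | true | false = refl
... | false | false | true = refl
... | false | false | false = refl

data Variant : Cell Lab → Cell Lab → Set where
  ordinary : ∀ {c} → Ordinaryᶜ c → special c ≡ nothing → Variant c c
  twisted : ∀ {k k'} h p → SameShape k k' → special (cell k h p) ≡ just (k , h , p) →
             special (cell k' h p) ≡ just (k' , h , p) → Variant (cell k h p) (cell k' h p)

-- Descent excludes the two mixed columns that are neither ordinary nor of one of the kinds: a
-- larger label above `i` or `i+1`, and a smaller one below.
variant : ∀ {c d} → c ≃ᶜ d → descends c ≡ true → Variant c d
variant (dead lo) _ = ordinary (dead lo) refl
variant (dead hi) _ = ordinary (dead hi) refl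
variant (dead sp) _ = twisted 0 0 Z refl refl
variant (live lo lo) _ = ordinary (live lo lo) refl
variant (live lo hi) _ = ordinary (live lo hi) refl
variant (live hi lo) _ = ordinary (live hi lo) refl
variant (live hi hi) _ = ordinary (live hi hi) refl
variant (live {h} sp (lo {p})) _ = twisted h p A refl refl
variant (live {h} sp sp) _ = twisted h 0 B refl refl
variant (live {h} (hi {p}) sp) _ = twisted h p C refl refl
variant (live sp hi) ()
variant (live lo sp) ()

data Single : Cell Lab → Set where
  ordinary : ∀ {c} → special c ≡ nothing → Single c
  twisted : ∀ k h p → special (cell k h p) ≡ just (k , h , p) → Single (cell k h p)

single : ∀ c → descends c ≡ true → Single c
single c d with variant (≃ᶜ-refl c) d
... | v = go v
  where
  go : ∀ {c d} → Variant c d → Single c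
  go (ordinary _ eq) = ordinary eq
  go (twisted h p _ eq _) = twisted _ h p eq

ValidSpecials : List (Cell Lab) → Bool
ValidSpecials r = validK (kinds (specials r)) (orderTable (specials r))

allᵇ-intro : ∀ {A : Set} (p : A → Bool) {xs} → Allˡ (λ x → p x ≡ true) xs → allᵇ p xs ≡ true
allᵇ-intro p [] = refl
allᵇ-intro p (e ∷ es) = ∧-intro e (allᵇ-intro p es)

allᵇ-elim : ∀ {A : Set} (p : A → Bool) xs → allᵇ p xs ≡ true → Allˡ (λ x → p x ≡ true) xs
allᵇ-elim p [] _ = []
allᵇ-elim p (x ∷ xs) e = proj₁ (∧-true e) ∷ allᵇ-elim p xs (proj₂ (∧-true {p x} e))

descends-special : ∀ k h p → descends (cell k h p) ≡ true → descendsK k ≡ true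
descends-special (Z _) h p e = refl
descends-special (A _) h p e = refl
descends-special (B _ _) h p e = e
descends-special (C _) h p e = refl

descendsK-sound : ∀ k h p → descendsK k ≡ true → descends (cell k h p) ≡ true
descendsK-sound (Z _) h p e = refl
descendsK-sound (A _) h p e = refl
descendsK-sound (B _ _) h p e = e
descendsK-sound (C _) h p e = refl

valid-∷ : ∀ {c r} → valid (c ∷ r) ≡ true → descends c ≡ true × allᵇ (compatible c) r ≡ true × valid r ≡ true
valid-∷ {c} {r} e with d , e ← ∧-true {allᵇ descends (c ∷ r)} e with dc , dr ← ∧-true {descends c} d
  with pc , pr ← ∧-true {allᵇ (compatible c) r} e = dc , pc , ∧-intro dr pr

valid-∷⁺ : ∀ {c r} → descends c ≡ true → allᵇ (compatible c) r ≡ true → valid r ≡ true → valid (c ∷ r) ≡ true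
valid-∷⁺ {c} {r} dc pc v with dr , pr ← ∧-true {allᵇ descends r} v = ∧-intro (∧-intro dc dr) (∧-intro pc pr)

valid⇒specials : ∀ r → valid r ≡ true → ValidSpecials r ≡ true
valid⇒specials [] _ = refl
valid⇒specials (c ∷ r) e with d , p , v ← valid-∷ {c} {r} e with single c d
... | ordinary eq rewrite eq = valid⇒specials r v
... | twisted k h q eq rewrite eq =
  ∧-intro (descends-special k h q d) (∧-intro (go r p v) (valid⇒specials r v))
  where
  go : ∀ r → allᵇ (compatible (cell k h q)) r ≡ true → valid r ≡ true →
       compatibleAll k (map (order (k , h , q)) (specials r)) (kinds (specials r)) ≡ true
  go [] _ _ = refl
  go (c ∷ r) p v with d , _ , v' ← valid-∷ {c} {r} v with pc , p' ← ∧-true {compatible (cell k h q) c} p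
    with single c d
  ... | ordinary eq rewrite eq = go r p' v'
  ... | twisted k' h' q' eq rewrite eq = ∧-intro
    (proj₂ (∧-true {rest (k , h , q) (k' , h' , q')} (trans (sym (compatible-special (k , h , q) (k' , h' , q'))) pc)))
    (go r p' v')

-- A comparison with an ordinary cell sees only the class of the other cell, and `rest` depends only
-- on the shapes. Both are therefore inherited from the valid row `r`, and what remains for `s` is
-- the condition on its special cells.
specials⇒valid : ∀ {r s} → Pointwise _≃ᶜ_ r s → valid r ≡ true → ValidSpecials s ≡ true → valid s ≡ true
specials⇒valid [] _ _ = refl
specials⇒valid {c ∷ r} {d ∷ s} (c≃d ∷ r≃s) e m with dc , p , v ← valid-∷ {c} {r} e with variant c≃d dc
... | ordinary o eq rewrite eq =
  valid-∷⁺ {d} {s} dc (go r≃s p v) (specials⇒valid r≃s v m)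
  where
  go : ∀ {r s} → Pointwise _≃ᶜ_ r s → allᵇ (compatible c) r ≡ true → valid r ≡ true → allᵇ (compatible c) s ≡ true
  go [] _ _ = refl
  go {c' ∷ r} {d' ∷ s} (q ∷ qs) p v with p₁ , p ← ∧-true {compatible c c'} p with _ , _ , v ← valid-∷ {c'} {r} v
    = ∧-intro (trans (sym (compatible-ordˡ o q)) p₁) (go qs p v)
... | twisted {k} {k'} h q sh eq eq' rewrite eq' with m₁ , m₀ ← ∧-true {descendsK k'} m
  with m₂ , m₃ ← ∧-true {compatibleAll k' (map (order (k' , h , q)) (specials s)) (kinds (specials s))} m₀
  = valid-∷⁺ {d} {s} (descendsK-sound k' h q m₁) (go r≃s p v m₂) (specials⇒valid r≃s v m₃)
  where
  go : ∀ {r s} → Pointwise _≃ᶜ_ r s → allᵇ (compatible (cell k h q)) r ≡ true → valid r ≡ true →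
    compatibleAll k' (map (order (k' , h , q)) (specials s)) (kinds (specials s)) ≡ true →
    allᵇ (compatible (cell k' h q)) s ≡ true
  go [] _ _ _ = refl
  go {c' ∷ r} {d' ∷ s} (c'≃d' ∷ qs) p v m with p₁ , p' ← ∧-true {compatible (cell k h q) c'} p
    with dc' , _ , v' ← valid-∷ {c'} {r} v with variant c'≃d' dc'
  ... | ordinary o eq rewrite eq = ∧-intro (trans (sym (compatible-ordʳ o c≃d)) p₁) (go qs p' v' m)
  ... | twisted {l} {l'} g q' sh' _ eq rewrite eq
    with m₁ , m' ← ∧-true {compatibleK (order (k' , h , q) (l' , g , q')) k' l'} m
    = ∧-intro (trans (compatible-special (k' , h , q) (l' , g , q')) (∧-intro
        (trans (sym (rest-shape sh sh')) (proj₁ (∧-true (trans (sym (compatible-special (k , h , q) (l , g , q'))) p₁)))) m₁))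
      (go qs p' v' m')

-- Exchanging i and i+1 among the bottom or the top labels of a row

module _ {L : Set} where

  mapT mapU : (L → L) → Cell L → Cell L
  mapT f (dead t) = dead (f t)
  mapT f (live h t u) = live h (f t) u
  mapU f (dead t) = dead t
  mapU f (live h t u) = live h t (f u)

  bottom : Cell L → ℕ × L
  bottom (dead t) = 0 , t
  bottom (live h t u) = suc h , t

  top : Cell L → Maybe (ℕ × L)
  top (dead _) = nothing
  top (live h t u) = just (h , u)

flipˡ : Lab → Lab
flipˡ (sp x) = sp (not x)
flipˡ l = l

mark : ℕ × Lab → Maybe (ℕ × Bool)
mark (h , sp x) = just (h , x)
mark _ = nothing

marked : List (ℕ × Lab) → List (ℕ × Bool)
marked = mapMaybe mark

itemT itemU : Item → Maybe (ℕ × Bool)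
itemT (Z x , h , p) = just (0 , x)
itemT (A x , h , p) = just (suc h , x)
itemT (B x _ , h , p) = just (suc h , x)
itemT (C _ , h , p) = nothing
itemU (Z x , h , p) = nothing
itemU (A x , h , p) = nothing
itemU (B _ y , h , p) = just (h , y)
itemU (C y , h , p) = just (h , y)

-- A related row has to descend here, because `special` drops ascending columns whose labels
-- `marked` still counts.
specials-marked : ∀ {r s} → Pointwise _≃ᶜ_ s r → allᵇ descends s ≡ true →
  mapMaybe itemT (specials r) ≡ marked (map bottom r) × mapMaybe itemU (specials r) ≡ marked (mapMaybe top r)
specials-marked [] _ = refl , refl
specials-marked {d ∷ r} {c ∷ s} (p ∷ ps) e with ∧-true {descends c} e
... | dc , ds with specials-marked ps ds | variant p dc
... | eT , eU | ordinary (dead lo) _ = eT , eU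
... | eT , eU | ordinary (dead hi) _ = eT , eU
... | eT , eU | ordinary (live lo lo) _ = eT , eU
... | eT , eU | ordinary (live lo hi) _ = eT , eU
... | eT , eU | ordinary (live hi lo) _ = eT , eU
... | eT , eU | ordinary (live hi hi) _ = eT , eU
... | eT , eU | twisted h p Z _ _ = cong (_ ∷_) eT , eU
... | eT , eU | twisted h p A _ _ = cong (_ ∷_) eT , eU
... | eT , eU | twisted h p B _ _ = cong (_ ∷_) eT , cong (_ ∷_) eU
... | eT , eU | twisted h p C _ _ = eT , cong (_ ∷_) eU

bitT-marked : ∀ xs → mapMaybe bitT (kinds xs) ≡ map proj₂ (mapMaybe itemT xs)
bitT-marked [] = refl
bitT-marked ((Z x , _) ∷ xs) = cong (x ∷_) (bitT-marked xs)
bitT-marked ((A x , _) ∷ xs) = cong (x ∷_) (bitT-marked xs)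
bitT-marked ((B x _ , _) ∷ xs) = cong (x ∷_) (bitT-marked xs)
bitT-marked ((C _ , _) ∷ xs) = bitT-marked xs

bitU-marked : ∀ xs → mapMaybe bitU (kinds xs) ≡ map proj₂ (mapMaybe itemU xs)
bitU-marked [] = refl
bitU-marked ((Z _ , _) ∷ xs) = bitU-marked xs
bitU-marked ((A _ , _) ∷ xs) = bitU-marked xs
bitU-marked ((B _ y , _) ∷ xs) = cong (y ∷_) (bitU-marked xs)
bitU-marked ((C y , _) ∷ xs) = cong (y ∷_) (bitU-marked xs)

module _ (is : Kind → Bool) (item : Item → Maybe (ℕ × Bool))
  (some : ∀ x {h} → item x ≡ just h → is (proj₁ x) ≡ true)
  (none : ∀ x → item x ≡ nothing → is (proj₁ x) ≡ false)
  (cmp : ∀ x y {h h' b b'} → item x ≡ just (h , b) → item y ≡ just (h' , b') → order x y ≡ (h ≤ᵇ h')) where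

  firstTwo-order : ∀ xs {h h' b b'} → mapMaybe item xs ≡ (h , b) ∷ (h' , b') ∷ [] →
    firstTwo is (kinds xs) (orderTable xs) ≡ (h ≤ᵇ h')
  firstTwo-order (x ∷ xs) e with item x in ex
  firstTwo-order (x ∷ xs) e | nothing rewrite none x ex = firstTwo-order xs e
  firstTwo-order (x ∷ xs) {h} e | just _ with refl , e' ← ∷-injective e rewrite some x ex = go xs e'
    where
    go : ∀ ys {hb} → mapMaybe item ys ≡ hb ∷ [] → pick is (kinds ys) (map (order x) ys) ≡ (h ≤ᵇ proj₁ hb)
    go (y ∷ ys) e with item y in ey
    go (y ∷ ys) e | nothing rewrite none y ey = go ys e
    go (y ∷ ys) e | just _ with refl , _ ← ∷-injective e rewrite some y ey = cmp x y ex ey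

≤ᵇ-suc : ∀ h h' → (suc h ≤ᵇ suc h') ≡ (h ≤ᵇ h')
≤ᵇ-suc zero h' = refl
≤ᵇ-suc (suc h) h' = refl

firstTwo-T : ∀ xs {h h' b b'} → mapMaybe itemT xs ≡ (h , b) ∷ (h' , b') ∷ [] →
  firstTwo isT (kinds xs) (orderTable xs) ≡ (h ≤ᵇ h')
firstTwo-T = firstTwo-order isT itemT some none cmp
  where
  some : ∀ x {h} → itemT x ≡ just h → isT (proj₁ x) ≡ true
  some (Z _ , _) _ = refl
  some (A _ , _) _ = refl
  some (B _ _ , _) _ = refl
  none : ∀ x → itemT x ≡ nothing → isT (proj₁ x) ≡ false
  none (C _ , _) _ = refl
  cmp : ∀ x y {h h' b b'} → itemT x ≡ just (h , b) → itemT y ≡ just (h' , b') → order x y ≡ (h ≤ᵇ h')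
  cmp (Z _ , _) y refl _ = refl
  cmp (A _ , _) (Z _ , _) refl refl = refl
  cmp (B _ _ , _) (Z _ , _) refl refl = refl
  cmp (A _ , h , _) (A _ , h' , _) refl refl = sym (≤ᵇ-suc h h')
  cmp (A _ , h , _) (B _ _ , h' , _) refl refl = sym (≤ᵇ-suc h h')
  cmp (B _ _ , h , _) (A _ , h' , _) refl refl = sym (≤ᵇ-suc h h')
  cmp (B _ _ , h , _) (B _ _ , h' , _) refl refl = sym (≤ᵇ-suc h h')

firstTwo-U : ∀ xs {h h' b b'} → mapMaybe itemU xs ≡ (h , b) ∷ (h' , b') ∷ [] →
  firstTwo isU (kinds xs) (orderTable xs) ≡ (h ≤ᵇ h')
firstTwo-U = firstTwo-order isU itemU some none cmp
  where
  some : ∀ x {h} → itemU x ≡ just h → isU (proj₁ x) ≡ true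
  some (B _ _ , _) _ = refl
  some (C _ , _) _ = refl
  none : ∀ x → itemU x ≡ nothing → isU (proj₁ x) ≡ false
  none (Z _ , _) _ = refl
  none (A _ , _) _ = refl
  cmp : ∀ x y {h h' b b'} → itemU x ≡ just (h , b) → itemU y ≡ just (h' , b') → order x y ≡ (h ≤ᵇ h')
  cmp (B _ _ , _) (B _ _ , _) refl refl = refl
  cmp (B _ _ , _) (C _ , _) refl refl = refl
  cmp (C _ , _) (B _ _ , _) refl refl = refl
  cmp (C _ , _) (C _ , _) refl refl = refl

flips-cell : ∀ {f : Kind → Kind} {g : Cell Lab → Cell Lab} → (∀ c → special (g c) ≡ Maybe.map (map₁ f) (special c)) →
  ∀ r → specials (map g r) ≡ map (map₁ f) (specials r)
flips-cell e [] = refl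
flips-cell e (c ∷ r) rewrite e c with special c
... | nothing = flips-cell e r
... | just x = cong (_ ∷_) (flips-cell e r)

kinds-map : ∀ f xs → kinds (map (map₁ f) xs) ≡ map f (kinds xs)
kinds-map f [] = refl
kinds-map f (x ∷ xs) = cong (f (proj₁ x) ∷_) (kinds-map f xs)

orderTable-map : ∀ {f} → (∀ k → SameShape k (f k)) → ∀ xs → orderTable (map (map₁ f) xs) ≡ orderTable xs
orderTable-map sh [] = refl
orderTable-map {f} sh (x ∷ xs) = cong₂ _∷_ (row xs) (orderTable-map sh xs)
  where
  row : ∀ ys → map (order (map₁ f x)) (map (map₁ f) ys) ≡ map (order x) ys
  row [] = refl
  row (y ∷ ys) = cong₂ _∷_ (sym (order-shape (sh (proj₁ x)) (sh (proj₁ y)))) (row ys)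

special-flipT : ∀ c → special (mapT flipˡ c) ≡ Maybe.map (map₁ flipT) (special c)
special-flipT (dead (lo _)) = refl
special-flipT (dead (sp _)) = refl
special-flipT (dead (hi _)) = refl
special-flipT (live h (lo _) (lo _)) = refl
special-flipT (live h (lo _) (sp _)) = refl
special-flipT (live h (lo _) (hi _)) = refl
special-flipT (live h (sp _) (lo _)) = refl
special-flipT (live h (sp _) (sp _)) = refl
special-flipT (live h (sp _) (hi _)) = refl
special-flipT (live h (hi _) (lo _)) = refl
special-flipT (live h (hi _) (sp _)) = refl
special-flipT (live h (hi _) (hi _)) = refl

special-flipU : ∀ c → special (mapU flipˡ c) ≡ Maybe.map (map₁ flipU) (special c)
special-flipU (dead (lo _)) = refl
special-flipU (dead (sp _)) = refl
special-flipU (dead (hi _)) = refl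
special-flipU (live h (lo _) (lo _)) = refl
special-flipU (live h (lo _) (sp _)) = refl
special-flipU (live h (lo _) (hi _)) = refl
special-flipU (live h (sp _) (lo _)) = refl
special-flipU (live h (sp _) (sp _)) = refl
special-flipU (live h (sp _) (hi _)) = refl
special-flipU (live h (hi _) (lo _)) = refl
special-flipU (live h (hi _) (sp _)) = refl
special-flipU (live h (hi _) (hi _)) = refl

shape-flipT : ∀ k → SameShape k (flipT k)
shape-flipT (Z _) = Z
shape-flipT (A _) = A
shape-flipT (B _ _) = B
shape-flipT (C _) = C

shape-flipU : ∀ k → SameShape k (flipU k)
shape-flipU (Z _) = Z
shape-flipU (A _) = A
shape-flipU (B _ _) = B
shape-flipU (C _) = C

rowT rowU : List (Cell Lab) → List (Cell Lab)
rowT = map (mapT flipˡ)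
rowU = map (mapU flipˡ)

ValidSpecials-T : ∀ r → ValidSpecials (rowT r) ≡ validK (map flipT (kinds (specials r))) (orderTable (specials r))
ValidSpecials-T r rewrite flips-cell {flipT} special-flipT r | kinds-map flipT (specials r)
  | orderTable-map shape-flipT (specials r) = refl

ValidSpecials-U : ∀ r → ValidSpecials (rowU r) ≡ validK (map flipU (kinds (specials r))) (orderTable (specials r))
ValidSpecials-U r rewrite flips-cell {flipU} special-flipU r | kinds-map flipU (specials r)
  | orderTable-map shape-flipU (specials r) = refl

ValidSpecials-TU : ∀ r → ValidSpecials (rowT (rowU r)) ≡ validK (map flipT (map flipU (kinds (specials r)))) (orderTable (specials r))
ValidSpecials-TU r rewrite ValidSpecials-T (rowU r) | flips-cell {flipU} special-flipU r | kinds-map flipU (specials r)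
  | orderTable-map shape-flipU (specials r) = refl

≃-flip : ∀ a → a ≃ flipˡ a
≃-flip (lo _) = lo
≃-flip (sp _) = sp
≃-flip (hi _) = hi

≃-T : ∀ c → c ≃ᶜ mapT flipˡ c
≃-T (dead t) = dead (≃-flip t)
≃-T (live h t u) = live (≃-flip t) (≃-refl u)

≃-U : ∀ c → c ≃ᶜ mapU flipˡ c
≃-U (dead t) = dead (≃-refl t)
≃-U (live h t u) = live (≃-refl t) (≃-flip u)

validities : List (Cell Lab) → Quad
validities r = valid r , valid (rowU r) , valid (rowT r) , valid (rowT (rowU r))

Row≃ : List (Cell Lab) → List (Cell Lab) → Set
Row≃ = Pointwise _≃ᶜ_

Row≃-map : ∀ {g : Cell Lab → Cell Lab} → (∀ c → c ≃ᶜ g c) → ∀ r → Row≃ r (map g r)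
Row≃-map e [] = []
Row≃-map e (c ∷ r) = e c ∷ Row≃-map e r

Row≃-refl : ∀ r → Row≃ r r
Row≃-refl [] = []
Row≃-refl (c ∷ r) = ≃ᶜ-refl c ∷ Row≃-refl r

Row≃-trans : ∀ {r s t} → Row≃ r s → Row≃ s t → Row≃ r t
Row≃-trans [] [] = []
Row≃-trans (p ∷ ps) (q ∷ qs) = ≃ᶜ-trans p q ∷ Row≃-trans ps qs

Row≃-sym : ∀ {r s} → Row≃ r s → Row≃ s r
Row≃-sym [] = []
Row≃-sym (p ∷ ps) = ≃ᶜ-sym p ∷ Row≃-sym ps

valid≡specials : ∀ {r s} → Row≃ r s → valid r ≡ true → valid s ≡ ValidSpecials s
valid≡specials {r} {s} p v with valid s in es | ValidSpecials s in em
... | true | true = refl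
... | false | false = refl
... | true | false with () ← trans (sym em) (valid⇒specials s es)
... | false | true with () ← trans (sym es) (specials⇒valid p v em)

-- If one of the four variants is valid, it vouches for all comparisons that the four have in
-- common, and each of them is then valid exactly if its special cells are.
validities-quad : ∀ r → validities r ≡ (false , false , false , false) ⊎
  (∃[ s ] Row≃ s r × valid s ≡ true × validities r ≡ quad (kinds (specials r)) (orderTable (specials r)))
validities-quad r = go (valid r) (valid (rowU r)) (valid (rowT r)) (valid (rowT (rowU r))) refl refl refl refl
  where
  rU : Row≃ r (rowU r)
  rU = Row≃-map ≃-U r
  rT : Row≃ r (rowT r)
  rT = Row≃-map ≃-T r
  rTU : Row≃ r (rowT (rowU r))
  rTU = Row≃-trans rU (Row≃-map ≃-T (rowU r))
  found : ∀ {s} → Row≃ s r → valid s ≡ true →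
    ∃[ s ] Row≃ s r × valid s ≡ true × validities r ≡ quad (kinds (specials r)) (orderTable (specials r))
  found {s} p v = s , p , v , cong₂ _,_ (valid≡specials p v)
    (cong₂ _,_ (trans (valid≡specials (Row≃-trans p rU) v) (ValidSpecials-U r))
    (cong₂ _,_ (trans (valid≡specials (Row≃-trans p rT) v) (ValidSpecials-T r))
               (trans (valid≡specials (Row≃-trans p rTU) v) (ValidSpecials-TU r))))
  go : ∀ a b c d → valid r ≡ a → valid (rowU r) ≡ b → valid (rowT r) ≡ c → valid (rowT (rowU r)) ≡ d →
    validities r ≡ (false , false , false , false) ⊎
    (∃[ s ] Row≃ s r × valid s ≡ true × validities r ≡ quad (kinds (specials r)) (orderTable (specials r)))
  go true b c d ea eb ec ed = inj₂ (found (Row≃-refl r) ea)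
  go false true c d ea eb ec ed = inj₂ (found (Row≃-sym rU) eb)
  go false false true d ea eb ec ed = inj₂ (found (Row≃-sym rT) ec)
  go false false false true ea eb ec ed = inj₂ (found (Row≃-sym rTU) ed)
  go false false false false ea eb ec ed = inj₁ (cong₂ _,_ ea (cong₂ _,_ eb (cong₂ _,_ ec ed)))

-- The validity pattern of one orbit

module _ (r : List (Cell Lab)) {hp hq} (bots : marked (map bottom r) ≡ (hp , false) ∷ (hq , true) ∷ []) where

  private
    ks = kinds (specials r)
    bss = orderTable (specials r)

    conclude : ∀ us al → check us al ≡ true → map proj₂ (marked (mapMaybe top r)) ≡ us →
      validities r ≡ (false , false , false , false) ⊎
      (mapMaybe itemU (specials r) ≡ marked (mapMaybe top r) × validities r ∈ al (hp ≤ᵇ hq) (firstTwo isU ks bss))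
    conclude us al ok tops with validities-quad r
    ... | inj₁ e = inj₁ e
    ... | inj₂ (s , p , v , e) with eT , eU ← specials-marked p (proj₁ (∧-true {allᵇ descends s} v))
      = inj₂ (eU , subst (_∈ al (hp ≤ᵇ hq) (firstTwo isU ks bss)) (sym e)
          (subst (λ b → quad ks bss ∈ al b (firstTwo isU ks bss)) (firstTwo-T (specials r) (trans eT bots))
          (check-sound us al ok (specials r)
            (trans (bitT-marked (specials r)) (trans (cong (map proj₂) eT) (cong (map proj₂) bots)))
            (trans (bitU-marked (specials r)) (trans (cong (map proj₂) eU) tops)))))

  orbit₀ : marked (mapMaybe top r) ≡ [] → validities r ∈ allowed₀ (hp ≤ᵇ hq)
  orbit₀ tops with conclude [] (λ b _ → allowed₀ b) check₀ (cong (map proj₂) tops)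
  ... | inj₂ (_ , q) = q
  ... | inj₁ e rewrite e with hp ≤ᵇ hq
  ... | true = here refl
  ... | false = here refl

  private
    0∈ : ∀ b b' → (false , false , false , false) ∈ allowed b b'
    0∈ true true = here refl
    0∈ true false = here refl
    0∈ false true = here refl
    0∈ false false = here refl

  orbit₁ : ∀ {h} → marked (mapMaybe top r) ≡ (h , false) ∷ [] → validities r ∈ allowed (hp ≤ᵇ hq) false
  orbit₁ tops with conclude (false ∷ []) (λ b _ → allowed b false) check₁ (cong (map proj₂) tops)
  ... | inj₂ (_ , q) = q
  ... | inj₁ e rewrite e = 0∈ (hp ≤ᵇ hq) false

  orbit₂ : ∀ {h h'} → marked (mapMaybe top r) ≡ (h , false) ∷ (h' , true) ∷ [] →
    validities r ∈ allowed (hp ≤ᵇ hq) (h ≤ᵇ h')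
  orbit₂ {h} {h'} tops with conclude (false ∷ true ∷ []) allowed check₂ (cong (map proj₂) tops)
  ... | inj₂ (eU , q) = subst (λ b → validities r ∈ allowed (hp ≤ᵇ hq) b) (firstTwo-U (specials r) (trans eU tops)) q
  ... | inj₁ e rewrite e = 0∈ (hp ≤ᵇ hq) (h ≤ᵇ h')

-- Finite sums

∑ : {A : Set} → List A → (A → ℤ) → ℤ
∑ [] φ = + 0
∑ (x ∷ xs) φ = φ x + ∑ xs φ

module _ {A : Set} where

  ∑-cong : ∀ {φ ψ : A → ℤ} {xs} → Allˡ (λ x → φ x ≡ ψ x) xs → ∑ xs φ ≡ ∑ xs ψ
  ∑-cong [] = refl
  ∑-cong (e ∷ es) = cong₂ _+_ e (∑-cong es)

  ∑-ext : ∀ {φ ψ : A → ℤ} → (∀ x → φ x ≡ ψ x) → ∀ xs → ∑ xs φ ≡ ∑ xs ψ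
  ∑-ext e [] = refl
  ∑-ext e (x ∷ xs) = cong₂ _+_ (e x) (∑-ext e xs)

  ∑-++ : ∀ (φ : A → ℤ) xs ys → ∑ (xs ++ ys) φ ≡ ∑ xs φ + ∑ ys φ
  ∑-++ φ [] ys = sym (ℤP.+-identityˡ _)
  ∑-++ φ (x ∷ xs) ys = trans (cong (λ z → φ x + z) (∑-++ φ xs ys)) (sym (ℤP.+-assoc (φ x) _ _))

  ∑-+ : ∀ (φ ψ : A → ℤ) xs → ∑ xs (λ x → φ x + ψ x) ≡ ∑ xs φ + ∑ xs ψ
  ∑-+ φ ψ [] = refl
  ∑-+ φ ψ (x ∷ xs) = trans (cong (λ z → φ x + ψ x + z) (∑-+ φ ψ xs)) (+-interchange (φ x) (ψ x) (∑ xs φ) (∑ xs ψ))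

module _ {A B : Set} where

  ∑-map : ∀ (φ : B → ℤ) (g : A → B) xs → ∑ (map g xs) φ ≡ ∑ xs (φ ∘ g)
  ∑-map φ g [] = refl
  ∑-map φ g (x ∷ xs) = cong (λ z → φ (g x) + z) (∑-map φ g xs)

  ∑-concatMap : ∀ (φ : B → ℤ) (g : A → List B) xs → ∑ (concatMap g xs) φ ≡ ∑ xs (λ x → ∑ (g x) φ)
  ∑-concatMap φ g [] = refl
  ∑-concatMap φ g (x ∷ xs) = trans (∑-++ φ (g x) (concatMap g xs)) (cong (λ z → ∑ (g x) φ + z) (∑-concatMap φ g xs))

∑-applyUpTo : ∀ (f : ℕ → ℕ) n φ → ∑ (applyUpTo f n) φ ≡ ∑ (upTo n) (φ ∘ f)
∑-applyUpTo f zero φ = refl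
∑-applyUpTo f (suc n) φ = cong (λ z → φ (f 0) + z)
  (trans (∑-applyUpTo (f ∘ suc) n φ) (sym (∑-applyUpTo suc n (φ ∘ f))))

∑-sw : ∀ i n φ → suc i < n → ∑ (upTo n) (φ ∘ sw i) ≡ ∑ (upTo n) φ
∑-sw zero (suc (suc n)) φ _ = begin
  φ 1 + (φ 0 + ∑ (applyUpTo (suc ∘ suc) n) (φ ∘ sw zero)) ≡⟨ cong (λ z → φ 1 + (φ 0 + z)) (trans (∑-applyUpTo _ n _) (sym (∑-applyUpTo _ n _))) ⟩
  φ 1 + (φ 0 + ∑ (applyUpTo (suc ∘ suc) n) φ) ≡⟨ lemma (φ 1) (φ 0) _ ⟩
  φ 0 + (φ 1 + ∑ (applyUpTo (suc ∘ suc) n) φ) ∎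
  where
  open ≡-Reasoning
  lemma : ∀ a b c → a + (b + c) ≡ b + (a + c)
  lemma = solve-∀
∑-sw zero (suc zero) φ (s≤s ())
∑-sw (suc i) (suc n) φ (s≤s i<) = cong (λ z → φ 0 + z)
  (trans (∑-applyUpTo suc n _) (trans (∑-sw i n (φ ∘ suc) i<) (sym (∑-applyUpTo suc n φ))))

-- Generating functions of fillings

holds? : {A : Set} (p : A → Bool) (x : A) → Dec (p x ≡ true)
holds? p x = p x ≟ᵇ true

Config : Set
Config = List (ℕ × ℕ)

module RowNat = Rows _<ᵇ_

rows : ℕ → Config → List (List (Cell ℕ))
rows n [] = [] ∷ []
rows n ((zero , t) ∷ c) = map (dead t ∷_) (rows n c)
rows n ((suc h , t) ∷ c) = concatMap (λ u → map (live h t u ∷_) (rows n c)) (upTo n)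

next : {L : Set} → List (Cell L) → List (ℕ × L)
next = mapMaybe top

weigh : Bool → Poly → Poly
weigh b f a = if b then f a else + 0

mulVars : List ℕ → Poly → Poly
mulVars [] f = f
mulVars (l ∷ ls) f = mulVar l (mulVars ls f)

𝟙 : Poly
𝟙 a = if allᵇ (_≤ᵇ 0) a then + 1 else + 0

-- The generating function in n variables of the first k rows of the fillings of columns with
-- given heights and basement labels.
fillings : ℕ → ℕ → Config → Poly
fillings n zero c = 𝟙
fillings n (suc k) c a =
  ∑ (rows n c) λ r → weigh (RowNat.valid r) (mulVars (map proj₂ (next r)) (fillings n k (next r))) a

crown : ℕ → ℕ → Config → Poly
crown n k c = mulVars (map proj₂ c) (fillings n k c)

-- The top label of each column runs through all labels below `n` independently of the others, and
-- `sw i` permutes this range.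
∑-rows-U : ∀ i n φ c → suc i < n → ∑ (rows n c) (φ ∘ map (mapU (sw i))) ≡ ∑ (rows n c) φ
∑-rows-U i n φ [] i< = refl
∑-rows-U i n φ ((zero , t) ∷ c) i< = trans (∑-map _ _ (rows n c)) (trans (∑-rows-U i n (φ ∘ (dead t ∷_)) c i<) (sym (∑-map _ _ (rows n c))))
∑-rows-U i n φ ((suc h , t) ∷ c) i< = begin
  ∑ (concatMap g (upTo n)) (φ ∘ map (mapU (sw i)))
    ≡⟨ ∑-concatMap _ g (upTo n) ⟩
  ∑ (upTo n) (λ u → ∑ (g u) (φ ∘ map (mapU (sw i))))
    ≡⟨ ∑-ext (λ u → trans (∑-map _ _ (rows n c)) (trans (∑-rows-U i n (φ ∘ (live h t (sw i u) ∷_)) c i<) (sym (∑-map _ _ (rows n c))))) (upTo n) ⟩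
  ∑ (upTo n) (λ u → ∑ (g (sw i u)) φ)
    ≡⟨ ∑-sw i n (λ u → ∑ (g u) φ) i< ⟩
  ∑ (upTo n) (λ u → ∑ (g u) φ)
    ≡⟨ ∑-concatMap _ g (upTo n) ⟨
  ∑ (concatMap g (upTo n)) φ ∎
  where
  open ≡-Reasoning
  g : ℕ → List (List (Cell ℕ))
  g u = map (live h t u ∷_) (rows n c)

∑-rows-T : ∀ i n φ c → ∑ (rows n (map (map₂ (sw i)) c)) φ ≡ ∑ (rows n c) (φ ∘ map (mapT (sw i)))
∑-rows-T i n φ [] = refl
∑-rows-T i n φ ((zero , t) ∷ c) = trans (∑-map _ _ (rows n (map (map₂ (sw i)) c))) (trans (∑-rows-T i n (φ ∘ (dead (sw i t) ∷_)) c) (sym (∑-map _ _ (rows n c))))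
∑-rows-T i n φ ((suc h , t) ∷ c) =
  trans (∑-concatMap _ _ (upTo n))
  (trans (∑-ext (λ u → trans (∑-map _ _ (rows n (map (map₂ (sw i)) c)))
      (trans (∑-rows-T i n (φ ∘ (live h (sw i t) u ∷_)) c) (sym (∑-map _ _ (rows n c))))) (upTo n))
  (sym (∑-concatMap _ _ (upTo n))))

rows-bottom : ∀ n c → Allˡ (λ r → map bottom r ≡ c) (rows n c)
rows-bottom n [] = refl ∷ []
rows-bottom n ((zero , t) ∷ c) = AllP.map⁺ (All.map (cong ((0 , t) ∷_)) (rows-bottom n c))
rows-bottom n ((suc h , t) ∷ c) = go (upTo n)
  where
  go : ∀ us → Allˡ (λ r → map bottom r ≡ (suc h , t) ∷ c) (concatMap (λ u → map (live h t u ∷_) (rows n c)) us)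
  go [] = []
  go (u ∷ us) = AllP.++⁺ (AllP.map⁺ (All.map (cong ((suc h , t) ∷_)) (rows-bottom n c))) (go us)

dead-compatible : ∀ t r → allᵇ (RowNat.compatible (dead t)) r ≡ true
dead-compatible t [] = refl
dead-compatible t (x ∷ r) = dead-compatible t r

-- So a label that is missing in a configuration can be added to it.
fillings-0 : ∀ n k t c a → fillings n k ((0 , t) ∷ c) a ≡ fillings n k c a
fillings-0 n zero t c a = refl
fillings-0 n (suc k) t c a = trans (∑-map _ _ (rows n c))
  (∑-ext (λ r → cong (λ b → weigh (allᵇ RowNat.descends r ∧ (b ∧ pairsᵇ RowNat.compatible r)) (crown n k (next r)) a) (dead-compatible t r)) (rows n c))

-- Labels as seen from i

raise : Lab → Lab
raise (lo a) = lo (suc a)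
raise l = l

-- The numbers under `lo` count from 0 and those under `hi` from `i+2`, which makes this an order
-- embedding.
view : ℕ → ℕ → Lab
view zero zero = sp false
view zero (suc zero) = sp true
view zero (suc (suc l)) = hi l
view (suc i) zero = lo zero
view (suc i) (suc l) = raise (view i l)

raise-< : ∀ a b → (raise a <ˡ raise b) ≡ (a <ˡ b)
raise-< (lo a) (lo b) = refl
raise-< (lo a) (sp b) = refl
raise-< (lo a) (hi b) = refl
raise-< (sp a) (lo b) = refl
raise-< (sp a) (sp b) = refl
raise-< (sp a) (hi b) = refl
raise-< (hi a) (lo b) = refl
raise-< (hi a) (sp b) = refl
raise-< (hi a) (hi b) = refl

view-< : ∀ i a b → (view i a <ˡ view i b) ≡ (a <ᵇ b)
view-< zero zero zero = refl
view-< zero zero (suc zero) = refl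
view-< zero zero (suc (suc b)) = refl
view-< zero (suc zero) zero = refl
view-< zero (suc zero) (suc zero) = refl
view-< zero (suc zero) (suc (suc b)) = refl
view-< zero (suc (suc a)) zero = refl
view-< zero (suc (suc a)) (suc zero) = refl
view-< zero (suc (suc a)) (suc (suc b)) = refl
view-< (suc i) zero zero = refl
view-< (suc i) zero (suc b) with view i b
... | lo _ = refl
... | sp _ = refl
... | hi _ = refl
view-< (suc i) (suc a) zero with view i a
... | lo _ = refl
... | sp _ = refl
... | hi _ = refl
view-< (suc i) (suc a) (suc b) = trans (raise-< (view i a) (view i b)) (view-< i a b)

view-sw : ∀ i l → view i (sw i l) ≡ flipˡ (view i l)
view-sw zero zero = refl
view-sw zero (suc zero) = refl
view-sw zero (suc (suc l)) = refl
view-sw (suc i) zero = refl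
view-sw (suc i) (suc l) rewrite view-sw i l with view i l
... | lo _ = refl
... | sp _ = refl
... | hi _ = refl

labelOf : ℕ → Bool → ℕ
labelOf i x = if x then suc i else i

view-labelOf : ∀ i x → view i (labelOf i x) ≡ sp x
view-labelOf zero false = refl
view-labelOf zero true = refl
view-labelOf (suc i) false rewrite view-labelOf i false = refl
view-labelOf (suc i) true rewrite view-labelOf i true = refl

view-sp : ∀ i l {x} → view i l ≡ sp x → l ≡ labelOf i x
view-sp zero zero refl = refl
view-sp zero (suc zero) refl = refl
view-sp (suc i) (suc l) e with view i l in v
view-sp (suc i) (suc l) {false} refl | sp _ = cong suc (view-sp i l v)
view-sp (suc i) (suc l) {true} refl | sp _ = cong suc (view-sp i l v)

view-ordinary : ∀ i l → Ordinary (view i l) → sw i l ≡ l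
view-ordinary zero (suc (suc l)) _ = refl
view-ordinary (suc i) zero _ = refl
view-ordinary (suc i) (suc l) o = cong suc (view-ordinary i l (lower (view i l) o))
  where
  lower : ∀ v → Ordinary (raise v) → Ordinary v
  lower (lo _) _ = lo
  lower (hi _) _ = hi

mapCell : ∀ {L M : Set} → (L → M) → Cell L → Cell M
mapCell f (dead t) = dead (f t)
mapCell f (live h t u) = live h (f t) (f u)

module _ {L M : Set} (ltL : L → L → Bool) (ltM : M → M → Bool) (f : L → M) (mono : ∀ a b → ltM (f a) (f b) ≡ ltL a b) where

  private
    module RL = Rows ltL
    module RM = Rows ltM

  descends-map : ∀ c → RM.descends (mapCell f c) ≡ RL.descends c
  descends-map (dead t) = refl
  descends-map (live h t u) = cong not (mono t u)

  compatible-map : ∀ c d → RM.compatible (mapCell f c) (mapCell f d) ≡ RL.compatible c d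
  compatible-map (dead _) d = refl
  compatible-map (live h t u) (dead t') rewrite mono t' u | mono t t' = refl
  compatible-map (live h t u) (live h' t' u') rewrite mono u u' | mono u' u | mono t' u | mono t t' = refl

  valid-map : ∀ r → RM.valid (map (mapCell f) r) ≡ RL.valid r
  valid-map r = cong₂ _∧_ (ds r) (ps r)
    where
    ds : ∀ r → allᵇ RM.descends (map (mapCell f) r) ≡ allᵇ RL.descends r
    ds [] = refl
    ds (c ∷ r) = cong₂ _∧_ (descends-map c) (ds r)
    cs : ∀ c r → allᵇ (RM.compatible (mapCell f c)) (map (mapCell f) r) ≡ allᵇ (RL.compatible c) r
    cs c [] = refl
    cs c (d ∷ r) = cong₂ _∧_ (compatible-map c d) (cs c r)
    ps : ∀ r → pairsᵇ RM.compatible (map (mapCell f) r) ≡ pairsᵇ RL.compatible r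
    ps [] = refl
    ps (c ∷ r) = cong₂ _∧_ (cs c r) (ps r)

-- How fillings change when the basement labels i and i+1 are exchanged

mulVars-cong : ∀ {n f g} ls → f ≈[ n ] g → mulVars ls f ≈[ n ] mulVars ls g
mulVars-cong [] e = e
mulVars-cong (l ∷ ls) e = mulVar-cong l (mulVars-cong ls e)

mulVar-mulVars : ∀ l ls f a → mulVar l (mulVars ls f) a ≡ mulVars ls (mulVar l f) a
mulVar-mulVars l [] f a = refl
mulVar-mulVars l (l' ∷ ls) f a = trans (mulVar-comm (mulVars ls f) l l' a)
  (mulVar-cong l' (λ b _ → mulVar-mulVars l ls f b) a refl)

mulVars-⊞ : ∀ ls f g a → mulVars ls (f ⊞ g) a ≡ mulVars ls f a + mulVars ls g a
mulVars-⊞ [] f g a = refl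
mulVars-⊞ (l ∷ ls) f g a = trans (mulVar-cong l (λ b _ → mulVars-⊞ ls f g b) a refl)
  (mulVar-⊞ l (mulVars ls f) (mulVars ls g) a)

mulVars-++ : ∀ xs ys f a → mulVars (xs ++ ys) f a ≡ mulVars xs (mulVars ys f) a
mulVars-++ [] ys f a = refl
mulVars-++ (x ∷ xs) ys f a = mulVar-cong x (λ b _ → mulVars-++ xs ys f b) a refl

-- Under this bound `fillings n k` sees the fillings completely; a taller column would be cut off
-- after `k` rows.
Bounded : ℕ → Config → Set
Bounded k = Allˡ (λ x → proj₁ x ≤ k)

Bounded-next : ∀ {k} r → Bounded (suc k) (map bottom r) → Bounded k (next r)
Bounded-next [] [] = []
Bounded-next (dead t ∷ r) (_ ∷ ps) = Bounded-next r ps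
Bounded-next (live h t u ∷ r) (s≤s p ∷ ps) = p ∷ Bounded-next r ps

module _ {L M : Set} (f : L → M) where

  bottom-map : ∀ r → map bottom (map (mapCell f) r) ≡ map (map₂ f) (map bottom r)
  bottom-map [] = refl
  bottom-map (dead t ∷ r) = cong (_ ∷_) (bottom-map r)
  bottom-map (live h t u ∷ r) = cong (_ ∷_) (bottom-map r)

  next-map : ∀ r → next (map (mapCell f) r) ≡ map (map₂ f) (next r)
  next-map [] = refl
  next-map (dead t ∷ r) = next-map r
  next-map (live h t u ∷ r) = cong (_ ∷_) (next-map r)

module _ {L : Set} (f : L → L) where

  next-mapU : ∀ r → next (map (mapU f) r) ≡ map (map₂ f) (next r)
  next-mapU [] = refl
  next-mapU (dead t ∷ r) = next-mapU r
  next-mapU (live h t u ∷ r) = cong (_ ∷_) (next-mapU r)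

  next-mapT : ∀ r → next (map (mapT f) r) ≡ next r
  next-mapT [] = refl
  next-mapT (dead t ∷ r) = next-mapT r
  next-mapT (live h t u ∷ r) = cong (_ ∷_) (next-mapT r)

  bottom-mapU : ∀ r → map bottom (map (mapU f) r) ≡ map bottom r
  bottom-mapU [] = refl
  bottom-mapU (dead t ∷ r) = cong (_ ∷_) (bottom-mapU r)
  bottom-mapU (live h t u ∷ r) = cong (_ ∷_) (bottom-mapU r)

distinctBits : List (ℕ × Bool) → Bool
distinctBits = pairsᵇ (λ x y → proj₂ x xor proj₂ y)

-- Equal labels in one row attack each other. This disposes of the orbits in which `i` or `i+1` is
-- repeated among the top labels, where all four variants vanish.
valid⇒distinct : ∀ r → valid r ≡ true → distinctBits (marked (next r)) ≡ true
valid⇒distinct [] _ = refl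
valid⇒distinct (c ∷ r) e with _ , p , v ← valid-∷ {c} {r} e with c
... | dead t = valid⇒distinct r v
... | live h t (lo u) = valid⇒distinct r v
... | live h t (hi u) = valid⇒distinct r v
... | live h t (sp x) = ∧-intro (go r p) (valid⇒distinct r v)
  where
  differ : ∀ x y → not x ∧ y ∨ not y ∧ x ≡ true → (x xor y) ≡ true
  differ true true ()
  differ true false _ = refl
  differ false true _ = refl
  differ false false ()
  go : ∀ r → allᵇ (compatible (live h t (sp x))) r ≡ true → allᵇ (λ y → x xor proj₂ y) (marked (next r)) ≡ true
  go [] _ = refl
  go (dead t' ∷ r) p = go r (proj₂ (∧-true {compatible (live h t (sp x)) (dead t')} p))
  go (live h' t' (lo u') ∷ r) p = go r (proj₂ (∧-true {compatible (live h t (sp x)) (live h' t' (lo u'))} p))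
  go (live h' t' (hi u') ∷ r) p = go r (proj₂ (∧-true {compatible (live h t (sp x)) (live h' t' (hi u'))} p))
  go (live h' t' (sp y) ∷ r) p with q , p ← ∧-true {compatible (live h t (sp x)) (live h' t' (sp y))} p =
    ∧-intro (differ x y (proj₁ (∧-true {neq (sp x) (sp y)} q))) (go r p)

marked-flip : ∀ c → marked (map (map₂ flipˡ) c) ≡ map (map₂ not) (marked c)
marked-flip [] = refl
marked-flip ((h , lo _) ∷ c) = marked-flip c
marked-flip ((h , sp x) ∷ c) = cong (_ ∷_) (marked-flip c)
marked-flip ((h , hi _) ∷ c) = marked-flip c

distinctBits-flip : ∀ m → distinctBits (map (map₂ not) m) ≡ distinctBits m
distinctBits-flip [] = refl
distinctBits-flip ((h , x) ∷ m) = cong₂ _∧_ (row m) (distinctBits-flip m)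
  where
  xor-not : ∀ x y → (not x xor not y) ≡ (x xor y)
  xor-not true y = refl
  xor-not false y = not-involutive y
  row : ∀ m → allᵇ (λ y → not x xor proj₂ y) (map (map₂ not) m) ≡ allᵇ (λ y → x xor proj₂ y) m
  row [] = refl
  row ((_ , y) ∷ m) = cong₂ _∧_ (xor-not x y) (row m)

distinctBits-long : ∀ x y z (m : List (ℕ × Bool)) → distinctBits (x ∷ y ∷ z ∷ m) ≡ false
distinctBits-long (_ , true) (_ , true) z m = refl
distinctBits-long (_ , false) (_ , false) z m = refl
distinctBits-long (_ , true) (_ , false) (_ , true) m = refl
distinctBits-long (_ , false) (_ , true) (_ , false) m = refl
distinctBits-long (_ , true) (_ , false) (_ , false) m with allᵇ (λ y → true xor proj₂ y) m
... | true = refl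
... | false = refl
distinctBits-long (_ , false) (_ , true) (_ , true) m with allᵇ (λ y → false xor proj₂ y) m
... | true = refl
... | false = refl

module _ {n i : ℕ} (i< : suc i < n) where

  -- g = ξ_i f, respectively f = (ξ_i - 1) g
  Rel : Bool → Poly → Poly → Set
  Rel true g f = Xi n i f g
  Rel false g f = Xi n i g (g ⊞ f)

  Rel-cong : ∀ b {f f' g g'} → g ≈[ n ] g' → f ≈[ n ] f' → Rel b g f → Rel b g' f'
  Rel-cong true p q r = Xi-cong i< q p r
  Rel-cong false p q r = Xi-cong i< p (λ a |a| → cong₂ _+_ (p a |a|) (q a |a|)) r

  Rel-0 : ∀ b → Rel b 0P 0P
  Rel-0 true = Xi-0 i<
  Rel-0 false = Xi-cong i< (λ _ _ → refl) (λ _ _ → refl) (Xi-0 i<)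

  Rel-⊞ : ∀ b {f f' g g'} → Rel b g f → Rel b g' f' → Rel b (g ⊞ g') (f ⊞ f')
  Rel-⊞ true p q = Xi-⊞ i< p q
  Rel-⊞ false {f} {f'} {g} {g'} p q =
    Xi-cong i< (λ _ _ → refl) (λ a _ → +-interchange (g a) (f a) (g' a) (f' a)) (Xi-⊞ i< p q)

  Rel-halve : ∀ b {f g} → Rel b (g ⊞ g) (f ⊞ f) → Rel b g f
  Rel-halve true p = Xi-halve i< p
  Rel-halve false {f} {g} p =
    Xi-halve i< (Xi-cong i< (λ _ _ → refl) (λ a _ → +-interchange (g a) (g a) (f a) (f a)) p)

  Rel-∑ : ∀ {A : Set} b (g f : A → Poly) {xs} → Allˡ (λ x → Rel b (g x) (f x)) xs →
    Rel b (λ a → ∑ xs (λ x → g x a)) (λ a → ∑ xs (λ x → f x a))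
  Rel-∑ b g f [] = Rel-cong b (λ _ _ → refl) (λ _ _ → refl) (Rel-0 b)
  Rel-∑ b g f {x ∷ xs} (r ∷ rs) = Rel-⊞ b r (Rel-∑ b g f rs)

  -- Here `p` stands for what lies above the row with its top labels as they are, and `q` for the
  -- same after exchanging `i` and `i+1` among the top labels; an exchange among the bottom labels
  -- affects neither.
  Combination : Bool → Quad → Poly → Poly → Set
  Combination b (a₁ , a₂ , a₃ , a₄) p q = Rel b (weigh a₁ p ⊞ weigh a₂ q) (weigh a₃ p ⊞ weigh a₄ q)

  module _ {p q : Poly} where

    private
      p+0 : p ≈[ n ] (p ⊞ 0P)
      p+0 a _ = sym (ℤP.+-identityʳ (p a))
      0+q : q ≈[ n ] (0P ⊞ q)
      0+q a _ = sym (ℤP.+-identityˡ (q a))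
      f+00 : ∀ {f} → f ≈[ n ] (f ⊞ (0P ⊞ 0P))
      f+00 {f} a _ = sym (ℤP.+-identityʳ (f a))
      0+0 : 0P ≈[ n ] (0P ⊞ 0P)
      0+0 a _ = refl
      p+q : (p ⊞ q) ≈[ n ] ((p ⊞ 0P) ⊞ (0P ⊞ q))
      p+q a |a| = cong₂ _+_ (p+0 a |a|) (0+q a |a|)
      idem : ∀ {f g} → Xi n i f g → Xi n i g g
      idem e = Xi-sym⇒self i< (Xi⇒sym i< e)

    -- The patterns `(true , false , false , true)` and `(true , true , true , false)` restate the
    -- hypothesis. In the others with first entry `true`, the symmetric element is `p` if `b'` is
    -- `true` and `p ⊞ q` if it is `false`, a value of `ξ_i` and hence fixed by it. The pattern with
    -- last entry `true` only says that `ξ_i` kills `q`, the image of `p` under `ξ_i - 1`.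
    allowed-sound : ∀ b b' {v} → v ∈ allowed b b' → Rel b' p q → Combination b v p q
    allowed-sound true true (here refl) r = Rel-cong true 0+0 0+0 (Rel-0 true)
    allowed-sound true true (there (here refl)) r = Rel-cong true p+0 0+q r
    allowed-sound true true (there (there (here refl))) r = Rel-cong true p+0 p+0 (idem r)
    allowed-sound false true (here refl) r = Rel-cong false 0+0 0+0 (Rel-0 false)
    allowed-sound false true (there (here refl)) r =
      Xi-cong i< p+0 (λ a |a| → trans (p+0 a |a|) (f+00 {p ⊞ 0P} a |a|)) (idem r)
    allowed-sound true false (here refl) r = Rel-cong true 0+0 0+0 (Rel-0 true)
    allowed-sound true false (there (here refl)) r = Rel-cong true {g = p ⊞ q} (λ _ _ → refl) p+0 r
    allowed-sound true false (there (there (here refl))) r = idem r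
    allowed-sound true false (there (there (there (here refl)))) r = Rel-cong true 0+0 0+q (Xi-annihilates i< r)
    allowed-sound false false (here refl) r = Rel-cong false 0+0 0+0 (Rel-0 false)
    allowed-sound false false (there (here refl)) r = Xi-cong i< p+0 p+q r
    allowed-sound false false (there (there (here refl))) r = Xi-cong i< (λ _ _ → refl) (f+00 {p ⊞ q}) (idem r)

  allowed₀-sound : ∀ {p} b {v} → v ∈ allowed₀ b → Xi n i p p → Combination b v p p
  allowed₀-sound true (here refl) r = Xi-cong i< (λ _ _ → refl) (λ _ _ → refl) (Xi-0 i<)
  allowed₀-sound true (there (here refl)) r = Xi-⊞ i< r r
  allowed₀-sound false (here refl) r = Xi-cong i< (λ _ _ → refl) (λ _ _ → refl) (Xi-0 i<)
  allowed₀-sound {p} false (there (here refl)) r =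
    Xi-cong i< (λ _ _ → refl) (λ a _ → sym (ℤP.+-identityʳ (p a + p a))) (Xi-⊞ i< r r)

  swC : Config → Config
  swC = map (map₂ (sw i))

  markedC : Config → List (ℕ × Bool)
  markedC c = marked (map (map₂ (view i)) c)

  markedC-swC : ∀ c → markedC (swC c) ≡ map (map₂ not) (markedC c)
  markedC-swC c = trans (cong marked (go c)) (marked-flip (map (map₂ (view i)) c))
    where
    go : ∀ c → map (map₂ (view i)) (swC c) ≡ map (map₂ flipˡ) (map (map₂ (view i)) c)
    go [] = refl
    go ((h , t) ∷ c) = cong₂ _∷_ (cong (h ,_) (view-sw i t)) (go c)

  swC-invol : ∀ c → swC (swC c) ≡ c
  swC-invol [] = refl
  swC-invol ((h , t) ∷ c) = cong₂ _∷_ (cong (h ,_) (sw-invol i t)) (swC-invol c)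

  ordinaries : Config → List ℕ
  ordinaries [] = []
  ordinaries ((h , t) ∷ c) with view i t
  ... | sp _ = ordinaries c
  ... | _ = t ∷ ordinaries c

  swC-unmarked : ∀ c → markedC c ≡ [] → swC c ≡ c
  swC-unmarked [] _ = refl
  swC-unmarked ((h , t) ∷ c) e with view i t in v
  ... | lo _ = cong₂ _∷_ (cong (h ,_) (view-ordinary i t (subst Ordinary (sym v) lo))) (swC-unmarked c e)
  ... | hi _ = cong₂ _∷_ (cong (h ,_) (view-ordinary i t (subst Ordinary (sym v) hi))) (swC-unmarked c e)

  ordinaries-swC : ∀ c → ordinaries (swC c) ≡ ordinaries c
  ordinaries-swC [] = refl
  ordinaries-swC ((h , t) ∷ c) with view i t in v | view i (sw i t) | view-sw i t
  ... | lo _ | _ | refl = cong₂ _∷_ (view-ordinary i t (subst Ordinary (sym v) lo)) (ordinaries-swC c)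
  ... | hi _ | _ | refl = cong₂ _∷_ (view-ordinary i t (subst Ordinary (sym v) hi)) (ordinaries-swC c)
  ... | sp _ | _ | refl = ordinaries-swC c

  -- Only `x_i` and `x_{i+1}` interact with `ξ_i`; the other variables are collected in front as a
  -- factor that commutes with it.
  mulVars-split : ∀ c f a → mulVars (map proj₂ c) f a ≡ mulVars (ordinaries c) (mulVars (map (labelOf i ∘ proj₂) (markedC c)) f) a
  mulVars-split [] f a = refl
  mulVars-split ((h , t) ∷ c) f a with view i t in v
  ... | lo _ = mulVar-cong t (λ b _ → mulVars-split c f b) a refl
  ... | hi _ = mulVar-cong t (λ b _ → mulVars-split c f b) a refl
  ... | sp x with refl ← view-sp i t v =
    trans (mulVar-cong t (λ b _ → mulVars-split c f b) a refl) (mulVar-mulVars t (ordinaries c) _ a)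

  Rel-mulVar : ∀ b k {f g} → sw i k ≡ k → Rel b g f → Rel b (mulVar k g) (mulVar k f)
  Rel-mulVar true k e r = Xi-mulVar i< k e r
  Rel-mulVar false k {f} {g} e r = Xi-cong i< (λ _ _ → refl) (λ a _ → mulVar-⊞ k g f a) (Xi-mulVar i< k e r)

  Rel-ordinaries : ∀ b c {f g} → Rel b g f → Rel b (mulVars (ordinaries c) g) (mulVars (ordinaries c) f)
  Rel-ordinaries b [] r = r
  Rel-ordinaries b ((h , t) ∷ c) r with view i t in v
  ... | sp _ = Rel-ordinaries b c r
  ... | lo _ = Rel-mulVar b t (view-ordinary i t (subst Ordinary (sym v) lo)) (Rel-ordinaries b c r)
  ... | hi _ = Rel-mulVar b t (view-ordinary i t (subst Ordinary (sym v) hi)) (Rel-ordinaries b c r)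

  Rel-XY : ∀ b {f g} → Rel b g f → Rel b (mulVar i (mulVar (suc i) g)) (mulVar i (mulVar (suc i) f))
  Rel-XY true r = Xi-XY i< r
  Rel-XY false {f} {g} r = Xi-cong i< (λ _ _ → refl)
    (λ a _ → trans (mulVar-cong i (λ b _ → mulVar-⊞ (suc i) g f b) a refl) (mulVar-⊞ i _ _ a)) (Xi-XY i< r)

  Bounded-swC : ∀ {k c} → Bounded k c → Bounded k (swC c)
  Bounded-swC [] = []
  Bounded-swC (p ∷ ps) = p ∷ Bounded-swC ps

  Exchange : ℕ → Set
  Exchange k = ∀ c {hp hq} → Bounded k c → markedC c ≡ (hp , false) ∷ (hq , true) ∷ [] →
    Rel (hp ≤ᵇ hq) (fillings n k c) (fillings n k (swC c))

  module _ {k} (IH : Exchange k) where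

    -- With both missing labels on empty columns, the case `0 ≤ 0` of the induction hypothesis
    -- relates the generating function to itself.
    crown₀ : ∀ c → Bounded k c → markedC c ≡ [] → Xi n i (crown n k c) (crown n k c)
    crown₀ c bd e = Rel-cong true (λ a _ → sym (split a)) (λ a _ → sym (split a)) (Rel-ordinaries true c self)
      where
      split : ∀ a → crown n k c a ≡ mulVars (ordinaries c) (fillings n k c) a
      split a = trans (mulVars-split c (fillings n k c) a)
        (cong (λ m → mulVars (ordinaries c) (mulVars (map (labelOf i ∘ proj₂) m) (fillings n k c)) a) e)
      c' : Config
      c' = (0 , i) ∷ (0 , suc i) ∷ c
      marked' : markedC c' ≡ (0 , false) ∷ (0 , true) ∷ []
      marked' rewrite view-labelOf i false | view-labelOf i true = cong (λ m → _ ∷ _ ∷ m) e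
      self : Xi n i (fillings n k c) (fillings n k c)
      self = Rel-cong true {f = fillings n k (swC c')} {g = fillings n k c'}
        (λ a _ → trans (fillings-0 n k _ _ a) (fillings-0 n k _ c a))
        (λ a _ → trans (fillings-0 n k _ _ a) (trans (fillings-0 n k _ (swC c) a) (cong (λ c → fillings n k c a) (swC-unmarked c e))))
        (IH c' (z≤n ∷ z≤n ∷ bd) marked')

    -- The missing label is added to `swC c`, where it is `i`: on an empty column at the far left,
    -- it stands before `i+1` and `0 ≤ h`, so the induction hypothesis gives `ξ_i` itself. The
    -- Leibniz rule then turns the factor `x_i` into the relation of the other kind.
    crown₁ : ∀ c {h} → Bounded k c → markedC c ≡ (h , false) ∷ [] → Rel false (crown n k c) (crown n k (swC c))
    crown₁ c {h} bd e = Rel-cong false (λ a _ → sym (split a)) (λ a _ → sym (split' a))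
      (Rel-ordinaries false c (Xi-raise i< raised))
      where
      split : ∀ a → crown n k c a ≡ mulVars (ordinaries c) (mulVar i (fillings n k c)) a
      split a = trans (mulVars-split c (fillings n k c) a)
        (cong (λ m → mulVars (ordinaries c) (mulVars (map (labelOf i ∘ proj₂) m) (fillings n k c)) a) e)
      marked-swC : markedC (swC c) ≡ (h , true) ∷ []
      marked-swC = trans (markedC-swC c) (cong (map (map₂ not)) e)
      split' : ∀ a → crown n k (swC c) a ≡ mulVars (ordinaries c) (mulVar (suc i) (fillings n k (swC c))) a
      split' a = trans (mulVars-split (swC c) (fillings n k (swC c)) a)
        (cong₂ (λ o m → mulVars o (mulVars (map (labelOf i ∘ proj₂) m) (fillings n k (swC c))) a) (ordinaries-swC c) marked-swC)
      c' : Config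
      c' = (0 , i) ∷ swC c
      marked' : markedC c' ≡ (0 , false) ∷ (h , true) ∷ []
      marked' rewrite view-labelOf i false = cong (_ ∷_) marked-swC
      raised : Xi n i (fillings n k c) (fillings n k (swC c))
      raised = Rel-cong true {f = fillings n k (swC c')} {g = fillings n k c'}
        (λ a _ → fillings-0 n k _ (swC c) a)
        (λ a _ → trans (fillings-0 n k _ (swC (swC c)) a) (cong (λ c → fillings n k c a) (swC-invol c)))
        (IH c' (z≤n ∷ Bounded-swC bd) marked')

    crown₂ : ∀ c {h h'} → Bounded k c → markedC c ≡ (h , false) ∷ (h' , true) ∷ [] →
      Rel (h ≤ᵇ h') (crown n k c) (crown n k (swC c))
    crown₂ c {h} {h'} bd e = Rel-cong (h ≤ᵇ h') (λ a _ → sym (split a)) (λ a _ → sym (split' a))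
      (Rel-ordinaries (h ≤ᵇ h') c (Rel-XY (h ≤ᵇ h') (IH c bd e)))
      where
      split : ∀ a → crown n k c a ≡ mulVars (ordinaries c) (mulVar i (mulVar (suc i) (fillings n k c))) a
      split a = trans (mulVars-split c (fillings n k c) a)
        (cong (λ m → mulVars (ordinaries c) (mulVars (map (labelOf i ∘ proj₂) m) (fillings n k c)) a) e)
      split' : ∀ a → crown n k (swC c) a ≡ mulVars (ordinaries c) (mulVar i (mulVar (suc i) (fillings n k (swC c)))) a
      split' a = trans (mulVars-split (swC c) (fillings n k (swC c)) a)
        (trans (cong₂ (λ o m → mulVars o (mulVars (map (labelOf i ∘ proj₂) m) (fillings n k (swC c))) a) (ordinaries-swC c)
                (trans (markedC-swC c) (cong (map (map₂ not)) e)))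
          (mulVars-cong (ordinaries c) (λ b _ → mulVar-comm (fillings n k (swC c)) (suc i) i b) a refl))

    -- Orbits of first rows

    rU rT : List (Cell ℕ) → List (Cell ℕ)
    rU = map (mapU (sw i))
    rT = map (mapT (sw i))

    viewRow : List (Cell ℕ) → List (Cell Lab)
    viewRow = map (mapCell (view i))

    viewRow-U : ∀ r → viewRow (rU r) ≡ rowU (viewRow r)
    viewRow-U [] = refl
    viewRow-U (dead t ∷ r) = cong (_ ∷_) (viewRow-U r)
    viewRow-U (live h t u ∷ r) = cong₂ _∷_ (cong (live h (view i t)) (view-sw i u)) (viewRow-U r)

    viewRow-T : ∀ r → viewRow (rT r) ≡ rowT (viewRow r)
    viewRow-T [] = refl
    viewRow-T (dead t ∷ r) = cong₂ _∷_ (cong dead (view-sw i t)) (viewRow-T r)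
    viewRow-T (live h t u ∷ r) = cong₂ _∷_ (cong (λ l → live h l (view i u)) (view-sw i t)) (viewRow-T r)

    rU-invol : ∀ r → rU (rU r) ≡ r
    rU-invol [] = refl
    rU-invol (dead t ∷ r) = cong (_ ∷_) (rU-invol r)
    rU-invol (live h t u ∷ r) = cong₂ _∷_ (cong (live h t) (sw-invol i u)) (rU-invol r)

    valid-view : ∀ r → valid (viewRow r) ≡ RowNat.valid r
    valid-view = valid-map _<ᵇ_ _<ˡ_ (view i) (view-< i)

    variants : List (Cell ℕ) → Quad
    variants r = RowNat.valid r , RowNat.valid (rU r) , RowNat.valid (rT r) , RowNat.valid (rT (rU r))

    variants-view : ∀ r → validities (viewRow r) ≡ variants r
    variants-view r = cong₂ _,_ (valid-view r)
      (cong₂ _,_ (trans (cong valid (sym (viewRow-U r))) (valid-view (rU r)))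
      (cong₂ _,_ (trans (cong valid (sym (viewRow-T r))) (valid-view (rT r)))
                 (trans (cong valid (sym (trans (viewRow-T (rU r)) (cong rowT (viewRow-U r))))) (valid-view (rT (rU r))))))

    term : List (Cell ℕ) → Poly
    term r = weigh (RowNat.valid r) (crown n k (next r))

    OrbitRel : Bool → List (Cell ℕ) → Set
    OrbitRel b r = Rel b (term r ⊞ term (rU r)) (term (rT r) ⊞ term (rT (rU r)))

    combine : ∀ b r → Combination b (variants r) (crown n k (next r)) (crown n k (swC (next r))) → OrbitRel b r
    combine b r c rewrite next-mapT (sw i) r | next-mapT (sw i) (rU r) | next-mapU (sw i) r = c

    -- The relation is symmetric in a row and its variant with top labels exchanged. So `i` may be
    -- assumed to precede `i+1` at the top, or to be the one that occurs, which is the situation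
    -- that the finite check covers.
    OrbitRel-U : ∀ b r → OrbitRel b (rU r) → OrbitRel b r
    OrbitRel-U b r o rewrite rU-invol r = Rel-cong b
      (λ a _ → ℤP.+-comm (term (rU r) a) (term r a))
      (λ a _ → ℤP.+-comm (term (rT (rU r)) a) (term (rT r) a)) o

    Bottoms : ℕ → ℕ → List (Cell ℕ) → Set
    Bottoms hp hq r = markedC (map bottom r) ≡ (hp , false) ∷ (hq , true) ∷ []

    bottoms-view : ∀ {hp hq} r → Bottoms hp hq r → marked (map bottom (viewRow r)) ≡ (hp , false) ∷ (hq , true) ∷ []
    bottoms-view r e = trans (cong marked (bottom-map (view i) r)) e

    tops-view : ∀ r {m} → markedC (next r) ≡ m → marked (mapMaybe top (viewRow r)) ≡ m
    tops-view r e = trans (cong marked (next-map (view i) r)) e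

    module _ {hp hq : ℕ} where

      orbit-none : ∀ r → Bounded k (next r) → Bottoms hp hq r → markedC (next r) ≡ [] → OrbitRel (hp ≤ᵇ hq) r
      orbit-none r bd bots e = combine (hp ≤ᵇ hq) r (subst
        (λ c → Combination (hp ≤ᵇ hq) (variants r) (crown n k (next r)) (crown n k c)) (sym (swC-unmarked (next r) e))
        (allowed₀-sound (hp ≤ᵇ hq)
          (subst (_∈ allowed₀ (hp ≤ᵇ hq)) (variants-view r) (orbit₀ (viewRow r) (bottoms-view r bots) (tops-view r e)))
          (crown₀ (next r) bd e)))

      orbit-one : ∀ r {h} → Bounded k (next r) → Bottoms hp hq r → markedC (next r) ≡ (h , false) ∷ [] → OrbitRel (hp ≤ᵇ hq) r
      orbit-one r bd bots e = combine (hp ≤ᵇ hq) r (allowed-sound (hp ≤ᵇ hq) false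
        (subst (_∈ allowed (hp ≤ᵇ hq) false) (variants-view r) (orbit₁ (viewRow r) (bottoms-view r bots) (tops-view r e)))
        (crown₁ (next r) bd e))

      orbit-two : ∀ r {h h'} → Bounded k (next r) → Bottoms hp hq r → markedC (next r) ≡ (h , false) ∷ (h' , true) ∷ [] →
        OrbitRel (hp ≤ᵇ hq) r
      orbit-two r {h} {h'} bd bots e = combine (hp ≤ᵇ hq) r (allowed-sound (hp ≤ᵇ hq) (h ≤ᵇ h')
        (subst (_∈ allowed (hp ≤ᵇ hq) (h ≤ᵇ h')) (variants-view r) (orbit₂ (viewRow r) (bottoms-view r bots) (tops-view r e)))
        (crown₂ (next r) bd e))

      repeated⇒invalid : ∀ r → distinctBits (markedC (next r)) ≡ false → RowNat.valid r ≡ false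
      repeated⇒invalid r e with RowNat.valid r in v
      ... | false = refl
      ... | true with () ← trans (sym e) (trans (cong distinctBits (sym (tops-view r refl)))
        (valid⇒distinct (viewRow r) (trans (valid-view r) v)))

      repeated-U : ∀ r → distinctBits (markedC (next r)) ≡ false → distinctBits (markedC (next (rU r))) ≡ false
      repeated-U r e = trans (cong (distinctBits ∘ markedC) (next-mapU (sw i) r))
        (trans (cong distinctBits (markedC-swC (next r))) (trans (distinctBits-flip (markedC (next r))) e))

      repeated-T : ∀ r → distinctBits (markedC (next r)) ≡ false → distinctBits (markedC (next (rT r))) ≡ false
      repeated-T r e = trans (cong (distinctBits ∘ markedC) (next-mapT (sw i) r)) e

      orbit-repeated : ∀ r → distinctBits (markedC (next r)) ≡ false → OrbitRel (hp ≤ᵇ hq) r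
      orbit-repeated r e
        rewrite repeated⇒invalid r e
              | repeated⇒invalid (rU r) (repeated-U r e)
              | repeated⇒invalid (rT r) (repeated-T r e)
              | repeated⇒invalid (rT (rU r)) (repeated-T (rU r) (repeated-U r e))
        = Rel-cong (hp ≤ᵇ hq) (λ _ _ → refl) (λ _ _ → refl) (Rel-0 (hp ≤ᵇ hq))

      orbit : ∀ r → Bounded k (next r) → Bottoms hp hq r → OrbitRel (hp ≤ᵇ hq) r
      orbit r bd bots = go (markedC (next r)) refl
        where
        bdU : Bounded k (next (rU r))
        bdU = subst (Bounded k) (sym (next-mapU (sw i) r)) (Bounded-swC bd)
        botsU : Bottoms hp hq (rU r)
        botsU = trans (cong markedC (bottom-mapU (sw i) r)) bots
        topsU : ∀ {m} → markedC (next r) ≡ m → markedC (next (rU r)) ≡ map (map₂ not) m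
        topsU e = trans (cong markedC (next-mapU (sw i) r)) (trans (markedC-swC (next r)) (cong (map (map₂ not)) e))
        go : ∀ m → markedC (next r) ≡ m → OrbitRel (hp ≤ᵇ hq) r
        go [] e = orbit-none r bd bots e
        go ((_ , false) ∷ []) e = orbit-one r bd bots e
        go ((_ , true) ∷ []) e = OrbitRel-U (hp ≤ᵇ hq) r (orbit-one (rU r) bdU botsU (topsU e))
        go ((_ , false) ∷ (_ , true) ∷ []) e = orbit-two r bd bots e
        go ((_ , true) ∷ (_ , false) ∷ []) e = OrbitRel-U (hp ≤ᵇ hq) r (orbit-two (rU r) bdU botsU (topsU e))
        go ((_ , false) ∷ (_ , false) ∷ []) e = orbit-repeated r (cong distinctBits e)
        go ((_ , true) ∷ (_ , true) ∷ []) e = orbit-repeated r (cong distinctBits e)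
        go (x ∷ y ∷ z ∷ m) e = orbit-repeated r (trans (cong distinctBits e) (distinctBits-long x y z m))

    -- Exchanging top labels permutes the rows over `c`, so the orbit relations add up to twice the
    -- relation wanted, on both sides.
    exchange-suc : Exchange (suc k)
    exchange-suc c {hp} {hq} bd e = Rel-halve (hp ≤ᵇ hq) (Rel-cong (hp ≤ᵇ hq)
      (λ a _ → trans (∑-+ (λ r → term r a) (λ r → term (rU r) a) (rows n c))
        (cong (λ z → fillings n (suc k) c a + z) (∑-rows-U i n (λ r → term r a) c i<)))
      (λ a _ → trans (∑-+ (λ r → term (rT r) a) (λ r → term (rT (rU r)) a) (rows n c))
        (trans (cong (λ z → ∑ (rows n c) (λ r → term (rT r) a) + z) (∑-rows-U i n (λ r → term (rT r) a) c i<))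
          (cong (λ z → z + z) (sym (∑-rows-T i n (λ r → term r a) c)))))
      (Rel-∑ (hp ≤ᵇ hq) (λ r → term r ⊞ term (rU r)) (λ r → term (rT r) ⊞ term (rT (rU r)))
        (All.map (λ {r} b → orbit r (Bounded-next r (subst (Bounded (suc k)) (sym b) bd)) (trans (cong markedC b) e)) (rows-bottom n c))))

  exchange : ∀ k → Exchange k
  -- Heights bounded by 0 leave only the case `hp ≤ hq`, and the constant 1 is symmetric.
  exchange zero c bd e = subst (λ b → Rel b 𝟙 𝟙) (sym (below e (markedC-bounded c bd))) (Xi-sym⇒self i< (λ a _ → 𝟙-sym i a))
    where
    markedC-bounded : ∀ c → Bounded 0 c → Allˡ (λ x → proj₁ x ≤ 0) (markedC c)
    markedC-bounded [] [] = []
    markedC-bounded ((h , t) ∷ c) (p ∷ ps) with view i t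
    ... | lo _ = markedC-bounded c ps
    ... | hi _ = markedC-bounded c ps
    ... | sp _ = p ∷ markedC-bounded c ps
    below : ∀ {m hp hq} → m ≡ (hp , false) ∷ (hq , true) ∷ [] → Allˡ (λ x → proj₁ x ≤ 0) m → (hp ≤ᵇ hq) ≡ true
    below refl (z≤n ∷ _) = refl
    𝟙-sym : ∀ i a → 𝟙 (swapAt i a) ≡ 𝟙 a
    𝟙-sym i a = cong (λ b → if b then + 1 else + 0) (go i a)
      where
      go : ∀ i a → allᵇ (_≤ᵇ 0) (swapAt i a) ≡ allᵇ (_≤ᵇ 0) a
      go zero [] = refl
      go zero (x ∷ []) = refl
      go zero (x ∷ y ∷ a) with x ≤ᵇ 0 | y ≤ᵇ 0
      ... | true | true = refl
      ... | true | false = refl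
      ... | false | true = refl
      ... | false | false = refl
      go (suc i) [] = refl
      go (suc i) (x ∷ a) = cong ((x ≤ᵇ 0) ∧_) (go i a)
  exchange (suc k) = exchange-suc (exchange k)

-- Contents

cnt : ℕ → List ℕ → ℕ
cnt k [] = 0
cnt k (l ∷ ls) = (if k ℕ.≡ᵇ l then 1 else 0) ℕ.+ cnt k ls

hasContent : List ℕ → List ℕ → Bool
hasContent [] a = allᵇ (_≤ᵇ 0) a
hasContent (l ∷ ls) a = maybe (hasContent ls) false (decAt a l)

mulVars-𝟙 : ∀ ls a → mulVars ls 𝟙 a ≡ (if hasContent ls a then + 1 else + 0)
mulVars-𝟙 [] a = refl
mulVars-𝟙 (l ∷ ls) a with decAt a l
... | nothing = refl
... | just b = mulVars-𝟙 ls b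

≡ᵇ-refl : ∀ k → (k ℕ.≡ᵇ k) ≡ true
≡ᵇ-refl zero = refl
≡ᵇ-refl (suc k) = ≡ᵇ-refl k

≢⇒≡ᵇ : ∀ {k l} → k ≢ l → (k ℕ.≡ᵇ l) ≡ false
≢⇒≡ᵇ {zero} {zero} ne = ⊥-elim (ne refl)
≢⇒≡ᵇ {zero} {suc l} ne = refl
≢⇒≡ᵇ {suc k} {zero} ne = refl
≢⇒≡ᵇ {suc k} {suc l} ne = ≢⇒≡ᵇ (ne ∘ cong suc)

decAt-nothing : ∀ a l → decAt a l ≡ nothing → atD a l ≡ 0
decAt-nothing [] l _ = refl
decAt-nothing (zero ∷ a) zero _ = refl
decAt-nothing (x ∷ a) (suc l) e rewrite decAt-suc x a l with decAt a l in d
... | nothing = decAt-nothing a l d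

decAt-just : ∀ a l {b} → decAt a l ≡ just b → ∀ k → atD a k ≡ (if k ℕ.≡ᵇ l then 1 else 0) ℕ.+ atD b k
decAt-just (suc x ∷ a) zero refl zero = refl
decAt-just (suc x ∷ a) zero refl (suc k) = refl
decAt-just (x ∷ a) (suc l) e k rewrite decAt-suc x a l with decAt a l in d
decAt-just (x ∷ a) (suc l) refl zero | just b = refl
decAt-just (x ∷ a) (suc l) refl (suc k) | just b = decAt-just a l d k

hasContent-sound : ∀ ls a → hasContent ls a ≡ true → ∀ k → cnt k ls ≡ atD a k
hasContent-sound [] a e k = go a e k
  where
  go : ∀ a → allᵇ (_≤ᵇ 0) a ≡ true → ∀ k → 0 ≡ atD a k
  go [] e k = refl
  go (zero ∷ a) e zero = refl
  go (zero ∷ a) e (suc k) = go a e k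
hasContent-sound (l ∷ ls) a e k with decAt a l in d
... | just b = trans (cong (_ ℕ.+_) (hasContent-sound ls b e k)) (sym (decAt-just a l d k))

hasContent-complete : ∀ ls a → (∀ k → cnt k ls ≡ atD a k) → hasContent ls a ≡ true
hasContent-complete [] a e = go a e
  where
  go : ∀ a → (∀ k → 0 ≡ atD a k) → allᵇ (_≤ᵇ 0) a ≡ true
  go [] e = refl
  go (zero ∷ a) e = go a (e ∘ suc)
  go (suc x ∷ a) e with () ← e 0
hasContent-complete (l ∷ ls) a e with decAt a l in d
... | just b = hasContent-complete ls b (λ k → ℕP.+-cancelˡ-≡ _ _ _ (trans (e k) (decAt-just a l d k)))
... | nothing with () ← trans (cong (λ b → (if b then 1 else 0) ℕ.+ cnt l ls) (sym (≡ᵇ-refl l))) (trans (e l) (decAt-nothing a l d))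

mulVars-content : ∀ ls ls' → (∀ k → cnt k ls ≡ cnt k ls') → ∀ a → mulVars ls 𝟙 a ≡ mulVars ls' 𝟙 a
mulVars-content ls ls' e a = trans (mulVars-𝟙 ls a)
  (trans (cong (λ b → if b then + 1 else + 0) same) (sym (mulVars-𝟙 ls' a)))
  where
  same : hasContent ls a ≡ hasContent ls' a
  same with hasContent ls a in h | hasContent ls' a in h'
  ... | true | true = refl
  ... | false | false = refl
  ... | true | false with () ← trans (sym h') (hasContent-complete ls' a (λ k → trans (sym (e k)) (hasContent-sound ls a h k)))
  ... | false | true with () ← trans (sym h) (hasContent-complete ls a (λ k → trans (e k) (hasContent-sound ls' a h' k)))

cnt-++ : ∀ k xs ys → cnt k (xs ++ ys) ≡ cnt k xs ℕ.+ cnt k ys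
cnt-++ k [] ys = refl
cnt-++ k (x ∷ xs) ys = trans (cong (_ ℕ.+_) (cnt-++ k xs ys)) (sym (ℕP.+-assoc _ (cnt k xs) (cnt k ys)))

-- Dominant configurations have a single filling

rows-unique : ∀ n c → Unique (rows n c)
rows-unique n [] = [] ∷ []
rows-unique n ((zero , t) ∷ c) = Unique.map⁺ (λ { refl → refl }) (rows-unique n c)
rows-unique n ((suc h , t) ∷ c) = Unique.concat⁺
  (AllP.map⁺ (All.universal (λ u → Unique.map⁺ (λ { refl → refl }) (rows-unique n c)) (upTo n)))
  (disjoint (Unique.upTo⁺ n))
  where
  open import Data.List.Relation.Binary.Disjoint.Propositional using (Disjoint)
  apart : ∀ {u v} → u ≢ v → Disjoint (map (live h t u ∷_) (rows n c)) (map (live h t v ∷_) (rows n c))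
  apart u≢v (p , q) with _ , _ , refl ← ∈P.∈-map⁻ _ p | _ , _ , refl ← ∈P.∈-map⁻ _ q = u≢v refl
  disjoint : ∀ {us} → Unique us → AllPairs Disjoint (map (λ u → map (live h t u ∷_) (rows n c)) us)
  disjoint [] = []
  disjoint (p ∷ ps) = AllP.map⁺ (All.map apart p) ∷ disjoint ps

∑-single : ∀ {A : Set} {φ : A → ℤ} {xs x₀} → Unique xs → x₀ ∈ xs → (∀ {x} → x ∈ xs → x ≢ x₀ → φ x ≡ + 0) → ∑ xs φ ≡ φ x₀
∑-single {φ = φ} {x ∷ xs} (u ∷ us) (here refl) z = trans (cong (λ s → φ x + s) (zero-sum xs u (λ p → z (there p)))) (ℤP.+-identityʳ (φ x))
  where
  zero-sum : ∀ ys → Allˡ (x ≢_) ys → (∀ {y} → y ∈ ys → y ≢ x → φ y ≡ + 0) → ∑ ys φ ≡ + 0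
  zero-sum [] _ z = refl
  zero-sum (y ∷ ys) (p ∷ ps) z = cong₂ _+_ (z (here refl) (p ∘ sym)) (zero-sum ys ps (z ∘ there))
∑-single {φ = φ} {x ∷ xs} (u ∷ us) (there p) z =
  trans (cong₂ _+_ (z (here refl) (λ { refl → All.lookup u p refl })) (∑-single us p (z ∘ there))) (ℤP.+-identityˡ _)

constantRow : Config → List (Cell ℕ)
constantRow [] = []
constantRow ((zero , t) ∷ c) = dead t ∷ constantRow c
constantRow ((suc h , t) ∷ c) = live h t t ∷ constantRow c

content : Config → List ℕ
content [] = []
content ((h , t) ∷ c) = replicate h t ++ content c

-- Counting row by row and counting column by column list the same labels in different orders.
cnt-crown : ∀ k c → cnt k (map proj₂ (next (constantRow c)) ++ content (next (constantRow c))) ≡ cnt k (content c)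
cnt-crown k [] = refl
cnt-crown k ((zero , t) ∷ c) = cnt-crown k c
cnt-crown k ((suc h , t) ∷ c) = cong (_ ℕ.+_) (begin
  cnt k (ls ++ replicate h t ++ m) ≡⟨ cnt-++ k ls _ ⟩
  cnt k ls ℕ.+ cnt k (replicate h t ++ m) ≡⟨ cong (cnt k ls ℕ.+_) (cnt-++ k (replicate h t) m) ⟩
  cnt k ls ℕ.+ (cnt k (replicate h t) ℕ.+ cnt k m) ≡⟨ ℕP.+-assoc (cnt k ls) _ _ ⟨
  cnt k ls ℕ.+ cnt k (replicate h t) ℕ.+ cnt k m ≡⟨ cong (ℕ._+ cnt k m) (ℕP.+-comm (cnt k ls) _) ⟩
  cnt k (replicate h t) ℕ.+ cnt k ls ℕ.+ cnt k m ≡⟨ ℕP.+-assoc (cnt k (replicate h t)) _ _ ⟩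
  cnt k (replicate h t) ℕ.+ (cnt k ls ℕ.+ cnt k m) ≡⟨ cong (cnt k (replicate h t) ℕ.+_) (trans (sym (cnt-++ k ls m)) (cnt-crown k c)) ⟩
  cnt k (replicate h t) ℕ.+ cnt k (content c) ≡⟨ cnt-++ k (replicate h t) (content c) ⟨
  cnt k (replicate h t ++ content c) ∎)
  where
  open ≡-Reasoning
  ls m : List ℕ
  ls = map proj₂ (next (constantRow c))
  m = content (next (constantRow c))

constantRow-∈ : ∀ n c → Allˡ (λ x → proj₂ x < n) c → constantRow c ∈ rows n c
constantRow-∈ n [] [] = here refl
constantRow-∈ n ((zero , t) ∷ c) (_ ∷ ps) = ∈P.∈-map⁺ _ (constantRow-∈ n c ps)
constantRow-∈ n ((suc h , t) ∷ c) (p ∷ ps) =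
  ∈P.∈-concat⁺′ (∈P.∈-map⁺ _ (constantRow-∈ n c ps)) (∈P.∈-map⁺ (λ u → map (live h t u ∷_) (rows n c)) (∈P.∈-upTo⁺ p))

<ᵇ-irrefl : ∀ t → (t <ᵇ t) ≡ false
<ᵇ-irrefl zero = refl
<ᵇ-irrefl (suc t) = <ᵇ-irrefl t

<ᵇ-connex : ∀ {t t'} → t ≢ t' → ((t <ᵇ t') ≡ true × (t' <ᵇ t) ≡ false) ⊎ ((t <ᵇ t') ≡ false × (t' <ᵇ t) ≡ true)
<ᵇ-connex {zero} {zero} ne = ⊥-elim (ne refl)
<ᵇ-connex {zero} {suc t'} ne = inj₁ (refl , refl)
<ᵇ-connex {suc t} {zero} ne = inj₂ (refl , refl)
<ᵇ-connex {suc t} {suc t'} ne = <ᵇ-connex {t} {t'} (ne ∘ cong suc)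

<ᵇ-true : ∀ {t t'} → t < t' → (t <ᵇ t') ≡ true
<ᵇ-true {zero} (s≤s p) = refl
<ᵇ-true {suc t} (s≤s p) = <ᵇ-true p

<ᵇ-sound : ∀ {t t'} → (t <ᵇ t') ≡ true → t < t'
<ᵇ-sound {zero} {suc t'} _ = s≤s z≤n
<ᵇ-sound {suc t} {suc t'} e = s≤s (<ᵇ-sound e)

-- If every label is repeated upwards, one forbidden pattern would force two basement labels to be
-- equal, and the other contradicts itself.
valid-constantRow : ∀ c → Unique (map proj₂ c) → RowNat.valid (constantRow c) ≡ true
valid-constantRow c u = ∧-intro (ds c) (ps c u)
  where
  ds : ∀ c → allᵇ RowNat.descends (constantRow c) ≡ true
  ds [] = refl
  ds ((zero , t) ∷ c) = ds c
  ds ((suc h , t) ∷ c) rewrite <ᵇ-irrefl t = ds c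
  pd : ∀ h {t t'} → t ≢ t' → RowNat.compatible (live h t t) (dead t') ≡ true
  pd h ne with <ᵇ-connex ne
  ... | inj₁ (e , e') rewrite e | e' = refl
  ... | inj₂ (e , e') rewrite e | e' = refl
  pl : ∀ h h' {t t'} → t ≢ t' → RowNat.compatible (live h t t) (live h' t' t') ≡ true
  pl h h' ne with <ᵇ-connex ne | h ≤ᵇ h'
  ... | inj₁ (e , e') | true rewrite e | e' = refl
  ... | inj₂ (e , e') | true rewrite e | e' = refl
  ... | inj₁ (e , e') | false rewrite e | e' = refl
  ... | inj₂ (e , e') | false rewrite e | e' = refl
  row : ∀ h t c → Allˡ (t ≢_) (map proj₂ c) → allᵇ (RowNat.compatible (live h t t)) (constantRow c) ≡ true
  row h t [] _ = refl
  row h t ((zero , t') ∷ c) (q ∷ qs) = ∧-intro (pd h q) (row h t c qs)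
  row h t ((suc h' , t') ∷ c) (q ∷ qs) = ∧-intro (pl h h' q) (row h t c qs)
  ps : ∀ c → Unique (map proj₂ c) → pairsᵇ RowNat.compatible (constantRow c) ≡ true
  ps [] [] = refl
  ps ((zero , t) ∷ c) (q ∷ u) = ∧-intro (dead-compatible t (constantRow c)) (ps c u)
  ps ((suc h , t) ∷ c) (q ∷ u) = ∧-intro (row h t c q) (ps c u)

-- The inequality of heights is what lets the property pass to the next row: the column of `l` must
-- not end before that of `t`.
Dominant : Config → Set
Dominant c = ∀ {h t l} → (suc h , t) ∈ c → l < t → ∃[ h' ] (suc h' , l) ∈ c × h ≤ h'

pairsᵇ-∈ : ∀ {A : Set} (p : A → A → Bool) {xs x y} → pairsᵇ p xs ≡ true → x ∈ xs → y ∈ xs → x ≢ y →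
  p x y ≡ true ⊎ p y x ≡ true
pairsᵇ-∈ p {z ∷ xs} e (here refl) (here refl) ne = ⊥-elim (ne refl)
pairsᵇ-∈ p {z ∷ xs} e (here refl) (there j) ne = inj₁ (All.lookup (allᵇ-elim (p z) xs (proj₁ (∧-true e))) j)
pairsᵇ-∈ p {z ∷ xs} e (there i) (here refl) ne = inj₂ (All.lookup (allᵇ-elim (p z) xs (proj₁ (∧-true e))) i)
pairsᵇ-∈ p {z ∷ xs} e (there i) (there j) ne = pairsᵇ-∈ p (proj₂ (∧-true {allᵇ (p z) xs} e)) i j ne

live-∈ : ∀ (r : List (Cell ℕ)) {h t} → (suc h , t) ∈ map bottom r → ∃[ u ] live h t u ∈ r
live-∈ (dead t ∷ r) (there p) = map₂ there (live-∈ r p)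
live-∈ (live h t u ∷ r) (here refl) = u , here refl
live-∈ (live h t u ∷ r) (there p) = map₂ there (live-∈ r p)

-- By induction on the basement label `t`: a smaller label `u` above it is itself in the basement of
-- a nonempty column, which by induction carries `u` on top, so that two equal labels would stand in
-- one row.
dominant-row : ∀ {c} → Dominant c → ∀ r → map bottom r ≡ c → RowNat.valid r ≡ true → r ≡ constantRow c
dominant-row dm r refl v = rebuild r (λ p → fixed _ ℕP.≤-refl p)
  where
  ds : Allˡ (λ x → RowNat.descends x ≡ true) r
  ds = allᵇ-elim _ r (proj₁ (∧-true v))
  ps : pairsᵇ RowNat.compatible r ≡ true
  ps = proj₂ (∧-true {allᵇ RowNat.descends r} v)
  same-top : ∀ h t h' t' u → RowNat.compatible (live h t u) (live h' t' u) ≡ true → ⊥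
  same-top h t h' t' u e rewrite <ᵇ-irrefl u with () ← e
  fixed : ∀ m {h t u} → t ≤ m → live h t u ∈ r → u ≡ t
  fixed m {h} {t} {u} t≤m p with ℕP.<-cmp u t
  ... | tri≈ _ e _ = e
  ... | tri> _ _ t<u with () ← trans (sym (All.lookup ds p)) (cong not (<ᵇ-true t<u))
  fixed zero z≤n p | tri< () _ _
  fixed (suc m) {h} {t} {u} t≤m p | tri< u<t u≢t _
    with h' , q , _ ← dm (∈P.∈-map⁺ bottom p) u<t
    with u' , q' ← live-∈ r q
    with refl ← fixed m (ℕP.≤-pred (ℕP.≤-trans u<t t≤m)) q'
    with pairsᵇ-∈ RowNat.compatible ps p q' (λ { refl → u≢t refl })
  ... | inj₁ e = ⊥-elim (same-top h t h' u u e)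
  ... | inj₂ e = ⊥-elim (same-top h' u h t u e)
  rebuild : ∀ r → (∀ {h t u} → live h t u ∈ r → u ≡ t) → r ≡ constantRow (map bottom r)
  rebuild [] _ = refl
  rebuild (dead t ∷ r) f = cong (_ ∷_) (rebuild r (f ∘ there))
  rebuild (live h t u ∷ r) f with refl ← f (here refl) = cong (_ ∷_) (rebuild r (f ∘ there))

next-constantRow : ∀ c {h t} → (h , t) ∈ next (constantRow c) → (suc h , t) ∈ c
next-constantRow ((zero , t) ∷ c) p = there (next-constantRow c p)
next-constantRow ((suc h , t) ∷ c) (here refl) = here refl
next-constantRow ((suc h , t) ∷ c) (there p) = there (next-constantRow c p)

next-constantRow⁺ : ∀ c {h t} → (suc h , t) ∈ c → (h , t) ∈ next (constantRow c)
next-constantRow⁺ ((zero , t) ∷ c) (there p) = next-constantRow⁺ c p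
next-constantRow⁺ ((suc h , t) ∷ c) (here refl) = here refl
next-constantRow⁺ ((suc h , t) ∷ c) (there p) = there (next-constantRow⁺ c p)

next-unique : ∀ c → Unique (map proj₂ c) → Unique (map proj₂ (next (constantRow c)))
next-unique [] [] = []
next-unique ((zero , t) ∷ c) (_ ∷ u) = next-unique c u
next-unique ((suc h , t) ∷ c) (p ∷ u) = sub c p ∷ next-unique c u
  where
  sub : ∀ c → Allˡ (t ≢_) (map proj₂ c) → Allˡ (t ≢_) (map proj₂ (next (constantRow c)))
  sub [] [] = []
  sub ((zero , _) ∷ c) (_ ∷ ps) = sub c ps
  sub ((suc _ , _) ∷ c) (p ∷ ps) = p ∷ sub c ps

fillings-dominant : ∀ n k c → Bounded k c → Allˡ (λ x → proj₂ x < n) c → Unique (map proj₂ c) → Dominant c →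
  ∀ a → fillings n k c a ≡ mulVars (content c) 𝟙 a
fillings-dominant n zero c bd _ _ _ a = sym (cong (λ ls → mulVars ls 𝟙 a) (empty c bd))
  where
  empty : ∀ c → Bounded 0 c → content c ≡ []
  empty [] [] = refl
  empty ((_ , t) ∷ c) (z≤n ∷ ps) = empty c ps
fillings-dominant n (suc k) c bd lt u dm a = begin
  fillings n (suc k) c a
    ≡⟨ ∑-single (rows-unique n c) (constantRow-∈ n c lt) other ⟩
  weigh (RowNat.valid r₀) (crown n k (next r₀)) a
    ≡⟨ cong (λ b → weigh b (crown n k (next r₀)) a) (valid-constantRow c u) ⟩
  crown n k (next r₀) a
    ≡⟨ mulVars-cong (map proj₂ (next r₀)) (λ b _ → fillings-dominant n k (next r₀)
         (All.tabulate (λ p → ℕP.≤-pred (All.lookup bd (next-constantRow c p))))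
         (All.tabulate (λ p → All.lookup lt (next-constantRow c p))) (next-unique c u) dm' b) a refl ⟩
  mulVars (map proj₂ (next r₀)) (mulVars (content (next r₀)) 𝟙) a
    ≡⟨ mulVars-++ (map proj₂ (next r₀)) (content (next r₀)) 𝟙 a ⟨
  mulVars (map proj₂ (next r₀) ++ content (next r₀)) 𝟙 a
    ≡⟨ mulVars-content (map proj₂ (next r₀) ++ content (next r₀)) (content c) (λ k → cnt-crown k c) a ⟩
  mulVars (content c) 𝟙 a ∎
  where
  open ≡-Reasoning
  r₀ = constantRow c
  other : ∀ {r} → r ∈ rows n c → r ≢ r₀ → weigh (RowNat.valid r) (crown n k (next r)) a ≡ + 0
  other {r} r∈ ne with RowNat.valid r in v
  ... | false = refl
  ... | true = ⊥-elim (ne (dominant-row dm r (All.lookup (rows-bottom n c) r∈) v))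
  dm' : Dominant (next r₀)
  dm' p l<t with dm (next-constantRow c p) l<t
  ... | suc h' , q , s≤s h≤h' = h' , next-constantRow⁺ c q , h≤h'

-- Key polynomials as generating functions of fillings

-- The field `ordered` lets a larger label stand to the left of a smaller one only on a strictly
-- shorter column. This is the invariant of undoing the steps of a key polynomial: it forces `i` to
-- stand to the left of `i+1` whenever `β` increases there.
record Labelled (β : List ℕ) (c : Config) : Set where
  field
    heights : Allˡ (λ x → proj₁ x ≡ atD β (proj₂ x)) c
    below : Allˡ (λ x → proj₂ x < length β) c
    unique : Unique (map proj₂ c)
    full : ∀ {t} → t < length β → (atD β t , t) ∈ c
    ordered : AllPairs (λ x y → proj₂ y < proj₂ x → proj₁ x < proj₁ y) c

cnt-replicate : ∀ h l → cnt l (replicate h l) ≡ h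
cnt-replicate zero l = refl
cnt-replicate (suc h) l rewrite ≡ᵇ-refl l = cong suc (cnt-replicate h l)

cnt-replicate-≢ : ∀ h {l t} → l ≢ t → cnt l (replicate h t) ≡ 0
cnt-replicate-≢ zero ne = refl
cnt-replicate-≢ (suc h) ne rewrite ≢⇒≡ᵇ ne = cnt-replicate-≢ h ne

cnt-content-∉ : ∀ {l} c → Allˡ (l ≢_) (map proj₂ c) → cnt l (content c) ≡ 0
cnt-content-∉ [] [] = refl
cnt-content-∉ ((h , t) ∷ c) (p ∷ ps) =
  trans (cnt-++ _ (replicate h t) (content c)) (cong₂ ℕ._+_ (cnt-replicate-≢ h p) (cnt-content-∉ c ps))

cnt-content-∈ : ∀ {h l} c → Unique (map proj₂ c) → (h , l) ∈ c → cnt l (content c) ≡ h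
cnt-content-∈ ((h , l) ∷ c) (p ∷ u) (here refl) = trans (cnt-++ l (replicate h l) (content c))
  (trans (cong₂ ℕ._+_ (cnt-replicate h l) (cnt-content-∉ c p)) (ℕP.+-identityʳ h))
cnt-content-∈ {l = l} ((h' , t) ∷ c) (p ∷ u) (there q) = trans (cnt-++ l (replicate h' t) (content c))
  (cong₂ ℕ._+_ (cnt-replicate-≢ h' (λ e → All.lookup p (∈P.∈-map⁺ proj₂ q) (sym e))) (cnt-content-∈ c u q))

atD-≥ : ∀ xs {l} → length xs ≤ l → atD xs l ≡ 0
atD-≥ [] _ = refl
atD-≥ (x ∷ xs) (s≤s p) = atD-≥ xs p

atD-ext : ∀ xs ys → length xs ≡ length ys → (∀ k → atD xs k ≡ atD ys k) → xs ≡ ys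
atD-ext [] [] _ _ = refl
atD-ext (x ∷ xs) (y ∷ ys) l e = cong₂ _∷_ (e 0) (atD-ext xs ys (ℕP.suc-injective l) (e ∘ suc))

atD-antitone : ∀ {α} → Linked ℕ._≥_ α → ∀ {l t} → l ≤ t → atD α t ≤ atD α l
atD-antitone {α} lk = go α (Linked⇒AllPairs (λ p q → ℕP.≤-trans q p) lk)
  where
  below-head : ∀ {x xs} → Allˡ (ℕ._≥_ x) xs → ∀ t → atD xs t ≤ x
  below-head [] t = z≤n
  below-head (p ∷ ps) zero = p
  below-head (p ∷ ps) (suc t) = below-head ps t
  go : ∀ α → AllPairs ℕ._≥_ α → ∀ {l t} → l ≤ t → atD α t ≤ atD α l
  go [] _ _ = z≤n
  go (x ∷ α) (p ∷ ps) {zero} {zero} _ = ℕP.≤-refl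
  go (x ∷ α) (p ∷ ps) {zero} {suc t} _ = below-head p t
  go (x ∷ α) (p ∷ ps) {suc l} {suc t} (s≤s q) = go α ps q

key-dominant : ∀ {α} → Linked ℕ._≥_ α → ∀ k c → Bounded k c → Labelled α c →
  monomial α ≈[ length α ] fillings (length α) k c
key-dominant {α} lk k c bd lab a |a| =
  trans mono (trans (sym (mulVars-𝟙 (content c) a)) (sym (fillings-dominant (length α) k c bd below unique dominant a)))
  where
  open Labelled lab
  dominant : Dominant c
  dominant {h} {t} {l} p l<t with full {l} (ℕP.<-trans l<t (All.lookup below p))
     | subst (_≤ atD α l) (sym (All.lookup heights p)) (atD-antitone lk (ℕP.<⇒≤ l<t))
  ... | q | h<α with atD α l
  dominant p l<t | q | s≤s h≤h' | suc h' = h' , q , h≤h'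
  counts : ∀ l → cnt l (content c) ≡ atD α l
  counts l with l ℕ.<? length α
  ... | yes l< = cnt-content-∈ c unique (full l<)
  ... | no l≮ = trans
    (cnt-content-∉ c (AllP.map⁺ (All.map (λ t< e → l≮ (subst (_< length α) (sym e) t<)) below)))
    (sym (atD-≥ α (ℕP.≮⇒≥ l≮)))
  mono : monomial α a ≡ (if hasContent (content c) a then + 1 else + 0)
  mono with LP.≡-dec ℕ._≟_ α a
  ... | yes refl rewrite hasContent-complete (content c) a counts = refl
  ... | no ne with hasContent (content c) a in e
  ... | false = refl
  ... | true = ⊥-elim (ne (atD-ext α a (sym |a|) (λ k → trans (sym (counts k)) (hasContent-sound (content c) a e k))))

atD-swap : ∀ i t α → suc i < length α → atD (swapAt i α) (sw i t) ≡ atD α t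
atD-swap zero t (x ∷ []) (s≤s ())
atD-swap zero zero (x ∷ y ∷ α) _ = refl
atD-swap zero (suc zero) (x ∷ y ∷ α) _ = refl
atD-swap zero (suc (suc t)) (x ∷ y ∷ α) _ = refl
atD-swap (suc i) zero (x ∷ α) _ = refl
atD-swap (suc i) (suc t) (x ∷ α) (s≤s p) = atD-swap i t α p

sw-< : ∀ i {n t} → suc i < n → t < n → sw i t < n
sw-< zero {t = zero} p _ = p
sw-< zero {t = suc zero} p _ = ℕP.<-trans (ℕP.n<1+n 0) p
sw-< zero {t = suc (suc t)} _ q = q
sw-< (suc i) {t = zero} p q = q
sw-< (suc i) {t = suc t} (s≤s p) (s≤s q) = s≤s (sw-< i p q)

sw-inversion : ∀ i {s t} → s < t → sw i t < sw i s → s ≡ i × t ≡ suc i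
sw-inversion zero {zero} {suc zero} _ _ = refl , refl
sw-inversion zero {zero} {suc (suc t)} _ (s≤s ())
sw-inversion zero {suc zero} {suc (suc t)} _ ()
sw-inversion zero {suc (suc s)} {suc (suc t)} p q = ⊥-elim (ℕP.<-asym p q)
sw-inversion zero {suc (suc s)} {suc zero} (s≤s ()) _
sw-inversion zero {suc zero} {suc zero} (s≤s ()) _
sw-inversion (suc i) {zero} {suc t} _ ()
sw-inversion (suc i) {suc s} {suc t} (s≤s p) (s≤s q) with refl , refl ← sw-inversion i p q = refl , refl

module _ {α : List ℕ} {i : ℕ} (i< : suc i < length α) (desc : atD α (suc i) < atD α i) where

  private
    β : List ℕ
    β = swapAt i α
    |β| : length β ≡ length α
    |β| = swapAt-length i α
    β-i : atD β i ≡ atD α (suc i)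
    β-i = trans (cong (atD β) (sym (sw-self⁺ i))) (atD-swap i (suc i) α i<)
    β-i⁺ : atD β (suc i) ≡ atD α i
    β-i⁺ = trans (cong (atD β) (sym (sw-self i))) (atD-swap i i α i<)
    asc : atD β i < atD β (suc i)
    asc = subst₂ _<_ (sym β-i) (sym β-i⁺) desc

  -- The exchange can create only one inversion, that of `i` and `i+1`, and its left column has
  -- height `β_i < β_{i+1}`, as `ordered` demands.
  Labelled-swC : ∀ {c} → Labelled β c → Labelled α (swC i< c)
  Labelled-swC {c} lab = record
    { heights = AllP.map⁺ (All.map (λ {x} e → trans e (trans (cong (atD β) (sym (sw-invol i (proj₂ x)))) (atD-swap i (sw i (proj₂ x)) α i<))) heights)
    ; below = AllP.map⁺ (All.map (λ t< → sw-< i i< (subst (_ <_) |β| t<)) below)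
    ; unique = subst Unique (labels c) (Unique.map⁺ (λ {x} {y} e → trans (sym (sw-invol i x)) (trans (cong (sw i) e) (sw-invol i y))) unique)
    ; full = λ {t} t< → subst (λ s → (atD α t , s) ∈ swC i< c) (sw-invol i t)
                  (subst (λ h → (h , sw i (sw i t)) ∈ swC i< c) (atD-swap i t α i<)
                    (∈P.∈-map⁺ _ (full (subst (sw i t <_) (sym |β|) (sw-< i i< t<)))))
    ; ordered = pairs c heights ordered
    }
    where
    open Labelled lab
    labels : ∀ c → map (sw i) (map proj₂ c) ≡ map proj₂ (swC i< c)
    labels [] = refl
    labels (x ∷ c) = cong (_ ∷_) (labels c)
    P : ℕ × ℕ → ℕ × ℕ → Set
    P x y = proj₂ y < proj₂ x → proj₁ x < proj₁ y
    one : ∀ x y → proj₁ x ≡ atD β (proj₂ x) → proj₁ y ≡ atD β (proj₂ y) → P x y → P (map₂ (sw i) x) (map₂ (sw i) y)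
    one (h , s) (g , t) refl refl p q with ℕP.<-cmp s t
    ... | tri> _ _ t<s = p t<s
    ... | tri≈ _ refl _ = ⊥-elim (ℕP.<-irrefl refl q)
    ... | tri< s<t _ _ with refl , refl ← sw-inversion i s<t q = asc
    row : ∀ x c → proj₁ x ≡ atD β (proj₂ x) → Allˡ (λ x → proj₁ x ≡ atD β (proj₂ x)) c → Allˡ (P x) c → Allˡ (P (map₂ (sw i) x)) (swC i< c)
    row x [] e _ _ = []
    row x (y ∷ c) e (f ∷ fs) (p ∷ ps) = one x y e f p ∷ row x c e fs ps
    pairs : ∀ c → Allˡ (λ x → proj₁ x ≡ atD β (proj₂ x)) c → AllPairs P c → AllPairs P (swC i< c)
    pairs [] _ _ = []
    pairs (x ∷ c) (e ∷ es) (p ∷ ps) = row x c e es p ∷ pairs c es ps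

  -- With `i+1` to the left of `i`, `ordered` would give `β_{i+1} < β_i`.
  markedC-Labelled : ∀ {c} → Labelled β c → markedC i< c ≡ (atD β i , false) ∷ (atD β (suc i) , true) ∷ []
  markedC-Labelled {c} lab = go (markedC i< c) (distinct c unique) (order' c ordered)
    (member c false (full (subst (i <_) (sym |β|) (ℕP.<-trans (ℕP.n<1+n i) i<))))
    (member c true (full (subst (suc i <_) (sym |β|) i<)))
    where
    open Labelled lab
    member : ∀ c x {h} → (h , labelOf i x) ∈ c → (h , x) ∈ markedC i< c
    member ((h , t) ∷ c) x (here refl) rewrite view-labelOf i x = here refl
    member ((h , t) ∷ c) x (there p) with view i t
    ... | lo _ = member c x p
    ... | hi _ = member c x p
    ... | sp _ = there (member c x p)
    distinct : ∀ c → Unique (map proj₂ c) → distinctBits (markedC i< c) ≡ true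
    distinct [] _ = refl
    distinct ((h , t) ∷ c) (p ∷ u) with view i t in v
    ... | lo _ = distinct c u
    ... | hi _ = distinct c u
    ... | sp x = ∧-intro (row c p) (distinct c u)
      where
      row : ∀ c → Allˡ (t ≢_) (map proj₂ c) → allᵇ (λ y → x xor proj₂ y) (markedC i< c) ≡ true
      row [] _ = refl
      row ((g , s) ∷ c) (q ∷ qs) with view i s in w
      ... | lo _ = row c qs
      ... | hi _ = row c qs
      ... | sp y = ∧-intro (differ x y (λ { refl → q (trans (view-sp i t v) (sym (view-sp i s w))) })) (row c qs)
        where
        differ : ∀ x y → x ≢ y → (x xor y) ≡ true
        differ true true ne = ⊥-elim (ne refl)
        differ true false _ = refl
        differ false true _ = refl
        differ false false ne = ⊥-elim (ne refl)
    Q : ℕ × Bool → ℕ × Bool → Set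
    Q x y = proj₂ x ≡ true → proj₂ y ≡ false → proj₁ x < proj₁ y
    order' : ∀ c → AllPairs (λ x y → proj₂ y < proj₂ x → proj₁ x < proj₁ y) c → AllPairs Q (markedC i< c)
    order' [] _ = []
    order' ((h , t) ∷ c) (p ∷ ps) with view i t in v
    ... | lo _ = order' c ps
    ... | hi _ = order' c ps
    ... | sp x = row c p ∷ order' c ps
      where
      row : ∀ c → Allˡ (λ y → proj₂ y < t → h < proj₁ y) c → Allˡ (Q (h , x)) (markedC i< c)
      row [] _ = []
      row ((g , s) ∷ c) (q ∷ qs) with view i s in w
      ... | lo _ = row c qs
      ... | hi _ = row c qs
      ... | sp y = (λ { refl refl → q (subst₂ _<_ (sym (view-sp i s w)) (sym (view-sp i t v)) (ℕP.n<1+n i)) }) ∷ row c qs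
    go : ∀ m → distinctBits m ≡ true → AllPairs Q m → (atD β i , false) ∈ m → (atD β (suc i) , true) ∈ m →
      m ≡ (atD β i , false) ∷ (atD β (suc i) , true) ∷ []
    go (x ∷ []) d o (here refl) (here ())
    go (x ∷ y ∷ []) d o (here refl) (there (here refl)) = refl
    go (x ∷ y ∷ []) d ((p ∷ []) ∷ _) (there (here refl)) (here refl) = ⊥-elim (ℕP.<-asym asc (p refl refl))
    go (x ∷ y ∷ []) d o (here refl) (here ())
    go (x ∷ y ∷ []) d o (there (here refl)) (there (here ()))
    go (x ∷ y ∷ z ∷ m) d o _ _ with () ← trans (sym (distinctBits-long x y z m)) d

-- Both `g` and the generating function over `c` solve the equation of `ξ_i f`, with `f` known by
-- induction over the exchanged labels. The configuration must be general, since the exchange leads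
-- away from increasing basements.
key : ∀ {β K} → IsKey β K → ∀ k c → Bounded k c → Labelled β c →
  K ≈[ length β ] fillings (length β) k c
key (dom α lk) k c bd lab = key-dominant lk k c bd lab
key (step {α} {f} g i i< desc isKey eq) k c bd lab =
  subst (λ n → g ≈[ n ] fillings n k c) (sym (swapAt-length i α))
    (Xi-unique i< {f} {g} {fillings (length α) k c} (λ a _ → eq a)
      (Xi-cong i< {g = fillings (length α) k c} (λ a |a| → sym (key isKey k (swC i< c) (Bounded-swC i< bd) (Labelled-swC i< desc lab) a |a|))
        (λ _ _ → refl)
        (subst (λ b → Rel i< b (fillings (length α) k c) (fillings (length α) k (swC i< c))) asc
          (exchange i< k c bd (markedC-Labelled i< desc lab)))))
  where
  asc : (atD (swapAt i α) i ≤ᵇ atD (swapAt i α) (suc i)) ≡ true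
  asc = ≤ᵇ-true (ℕP.<⇒≤ (subst₂ _<_
    (trans (sym (atD-swap i (suc i) α i<)) (cong (atD (swapAt i α)) (sw-self⁺ i)))
    (trans (sym (atD-swap i i α i<)) (cong (atD (swapAt i α)) (sw-self i))) desc))
    where
    ≤ᵇ-true : ∀ {m n} → m ≤ n → (m ≤ᵇ n) ≡ true
    ≤ᵇ-true z≤n = refl
    ≤ᵇ-true (s≤s p) = <ᵇ-true (s≤s p)

-- Enumeration of fillings by columns

-- A column: its basement label and its labels from the first row upwards.
Column : Set
Column = ℕ × List ℕ

form : Column → ℕ × ℕ
form (t , c) = length c , t

firstCell : Column → Cell ℕ
firstCell (t , []) = dead t
firstCell (t , u ∷ c) = live (length c) t u

peel : Column → Maybe Column
peel (t , []) = nothing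
peel (t , u ∷ c) = just (u , c)

descendsFrom : ℕ → List ℕ → Bool
descendsFrom t [] = true
descendsFrom t (u ∷ c) = not (t <ᵇ u) ∧ descendsFrom u c

okColumn : Column → Bool
okColumn (t , c) = descendsFrom t c

-- Remaining heights are compared instead of full ones: both columns have lost the same number of
-- boxes. After the right column has ended, its last label still meets one box of the left column,
-- as a dead cell.
compatibleFrom : ℕ → List ℕ → ℕ → List ℕ → Bool
compatibleFrom t [] _ _ = true
compatibleFrom t (u ∷ c) t' [] = RowNat.compatible (live (length c) t u) (dead t')
compatibleFrom t (u ∷ c) t' (u' ∷ c') =
  RowNat.compatible (live (length c) t u) (live (length c') t' u') ∧ compatibleFrom u c u' c'

okPair : Column → Column → Bool
okPair (t , c) (t' , c') = compatibleFrom t c t' c'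

ok : List Column → Bool
ok T = allᵇ okColumn T ∧ pairsᵇ okPair T

glue : List (Cell ℕ) → List Column → List Column
glue [] T = []
glue (dead t ∷ r) T = (t , []) ∷ glue r T
-- A default value: when the columns of `T` have the forms in `next r`, there is one for every live
-- cell.
glue (live h t u ∷ r) [] = (t , u ∷ []) ∷ glue r []
glue (live h t u ∷ r) ((_ , c) ∷ T) = (t , u ∷ c) ∷ glue r T

tableaux : ℕ → ℕ → Config → List (List Column)
tableaux n zero c = map (λ x → proj₂ x , []) c ∷ []
tableaux n (suc k) c = concatMap (λ r → map (glue r) (tableaux n k (next r))) (filter (holds? RowNat.valid) (rows n c))

entries : List Column → List ℕ
entries T = concat (map proj₂ T)

glue-form : ∀ r T → map form T ≡ next r → map form (glue r T) ≡ map bottom r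
glue-form [] [] _ = refl
glue-form (dead t ∷ r) T e = cong (_ ∷_) (glue-form r T e)
glue-form (live h t u ∷ r) ((_ , c) ∷ T) e with e₁ , e₂ ← ∷-injective e =
  cong₂ _∷_ (cong (λ h → suc h , t) (cong proj₁ e₁)) (glue-form r T e₂)

glue-firstCell : ∀ r T → map form T ≡ next r → map firstCell (glue r T) ≡ r
glue-firstCell [] [] _ = refl
glue-firstCell (dead t ∷ r) T e = cong (_ ∷_) (glue-firstCell r T e)
glue-firstCell (live h t u ∷ r) ((_ , c) ∷ T) e with e₁ , e₂ ← ∷-injective e =
  cong₂ _∷_ (cong (λ h → live h t u) (cong proj₁ e₁)) (glue-firstCell r T e₂)

glue-peel : ∀ r T → map form T ≡ next r → mapMaybe peel (glue r T) ≡ T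
glue-peel [] [] _ = refl
glue-peel (dead t ∷ r) T e = glue-peel r T e
glue-peel (live h t u ∷ r) ((_ , c) ∷ T) e with e₁ , e₂ ← ∷-injective e =
  cong₂ _∷_ (cong (_, c) (sym (cong proj₂ e₁))) (glue-peel r T e₂)

unglue : ∀ T → glue (map firstCell T) (mapMaybe peel T) ≡ T
unglue [] = refl
unglue ((t , []) ∷ T) = cong (_ ∷_) (unglue T)
unglue ((t , u ∷ c) ∷ T) = cong (_ ∷_) (unglue T)

next-form : ∀ T → map form (mapMaybe peel T) ≡ next (map firstCell T)
next-form [] = refl
next-form ((t , []) ∷ T) = next-form T
next-form ((t , u ∷ c) ∷ T) = cong (_ ∷_) (next-form T)

bottom-firstCell : ∀ T → map bottom (map firstCell T) ≡ map form T
bottom-firstCell [] = refl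
bottom-firstCell ((t , []) ∷ T) = cong (_ ∷_) (bottom-firstCell T)
bottom-firstCell ((t , u ∷ c) ∷ T) = cong (_ ∷_) (bottom-firstCell T)

-- Every condition concerns two consecutive rows, so those on the basement and the first row split
-- off.
ok-peel : ∀ T → ok T ≡ RowNat.valid (map firstCell T) ∧ ok (mapMaybe peel T)
ok-peel T = trans (cong₂ _∧_ (columns T) (pairs T)) (∧-interchange (allᵇ RowNat.descends (map firstCell T)) _ _ _)
  where
  columns : ∀ T → allᵇ okColumn T ≡ allᵇ RowNat.descends (map firstCell T) ∧ allᵇ okColumn (mapMaybe peel T)
  columns [] = refl
  columns ((t , []) ∷ T) = columns T
  columns ((t , u ∷ c) ∷ T) = trans (cong ((not (t <ᵇ u) ∧ okColumn (u , c)) ∧_) (columns T)) (∧-interchange (not (t <ᵇ u)) _ _ _)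
  row : ∀ t u c T → allᵇ (okPair (t , u ∷ c)) T ≡
    allᵇ (RowNat.compatible (live (length c) t u)) (map firstCell T) ∧ allᵇ (okPair (u , c)) (mapMaybe peel T)
  row t u c [] = refl
  row t u c ((t' , []) ∷ T) rewrite row t u c T with RowNat.compatible (live (length c) t u) (dead t')
  ... | true = refl
  ... | false = refl
  row t u c ((t' , u' ∷ c') ∷ T) =
    trans (cong (okPair (t , u ∷ c) (t' , u' ∷ c') ∧_) (row t u c T))
      (∧-interchange (RowNat.compatible (live (length c) t u) (live (length c') t' u')) _ _ _)
  free : ∀ t T → allᵇ (okPair (t , [])) T ≡ true
  free t [] = refl
  free t (x ∷ T) = free t T
  pairs : ∀ T → pairsᵇ okPair T ≡ pairsᵇ RowNat.compatible (map firstCell T) ∧ pairsᵇ okPair (mapMaybe peel T)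
  pairs [] = refl
  pairs ((t , []) ∷ T) rewrite free t T | dead-compatible t (map firstCell T) = pairs T
  pairs ((t , u ∷ c) ∷ T) = trans (cong₂ _∧_ (row t u c T) (pairs T))
    (∧-interchange (allᵇ (RowNat.compatible (live (length c) t u)) (map firstCell T)) _ _ _)

Entries< : ℕ → List Column → Set
Entries< n = Allˡ (λ x → Allˡ (_< n) (proj₂ x))

IsTableau : ℕ → Config → List Column → Set
IsTableau n c T = map form T ≡ c × Entries< n T × ok T ≡ true

rows-top : ∀ n c {r} → r ∈ rows n c → Allˡ (λ x → proj₂ x < n) (next r)
rows-top n [] (here refl) = []
rows-top n ((zero , t) ∷ c) r∈ with _ , p , refl ← ∈P.∈-map⁻ _ r∈ = rows-top n c p
rows-top n ((suc h , t) ∷ c) r∈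
  with _ , p , q ← ∈P.∈-concat⁻′ (map (λ u → map (live h t u ∷_) (rows n c)) (upTo n)) r∈
  with u , u< , refl ← ∈P.∈-map⁻ (λ u → map (live h t u ∷_) (rows n c)) q
  with _ , p' , refl ← ∈P.∈-map⁻ _ p = ∈P.∈-upTo⁻ u< ∷ rows-top n c p'

rows-∈ : ∀ n T → Entries< n T → map firstCell T ∈ rows n (map form T)
rows-∈ n [] [] = here refl
rows-∈ n ((t , []) ∷ T) (_ ∷ ps) = ∈P.∈-map⁺ _ (rows-∈ n T ps)
rows-∈ n ((t , u ∷ c) ∷ T) ((p ∷ _) ∷ ps) =
  ∈P.∈-concat⁺′ (∈P.∈-map⁺ _ (rows-∈ n T ps))
    (∈P.∈-map⁺ (λ u → map (live (length c) t u ∷_) (rows n (map form T))) (∈P.∈-upTo⁺ p))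

tableaux-sound : ∀ n k c → Bounded k c → ∀ {T} → T ∈ tableaux n k c → IsTableau n c T
tableaux-sound n zero c bd (here refl) = forms c bd , small c , trivially c
  where
  forms : ∀ c → Bounded 0 c → map form (map (λ x → proj₂ x , []) c) ≡ c
  forms [] [] = refl
  forms ((_ , t) ∷ c) (z≤n ∷ ps) = cong (_ ∷_) (forms c ps)
  small : ∀ c → Entries< n (map (λ x → proj₂ x , []) c)
  small [] = []
  small (x ∷ c) = [] ∷ small c
  trivially : ∀ c → ok (map (λ x → proj₂ x , []) c) ≡ true
  trivially c = ∧-intro (cols c) (prs c)
    where
    cols : ∀ c → allᵇ okColumn (map (λ x → proj₂ x , []) c) ≡ true
    cols [] = refl
    cols (x ∷ c) = cols c
    row : ∀ t (T : List Column) → allᵇ (okPair (t , [])) T ≡ true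
    row t [] = refl
    row t (x ∷ T) = row t T
    prs : ∀ c → pairsᵇ okPair (map (λ x → proj₂ x , []) c) ≡ true
    prs [] = refl
    prs (x ∷ c) = ∧-intro (row (proj₂ x) (map (λ x → proj₂ x , []) c)) (prs c)
tableaux-sound n (suc k) c bd T∈
  with _ , p , q ← ∈P.∈-concat⁻′ (map (λ r → map (glue r) (tableaux n k (next r))) (filter (holds? RowNat.valid) (rows n c))) T∈
  with r , r∈ , refl ← ∈P.∈-map⁻ (λ r → map (glue r) (tableaux n k (next r))) q
  with T' , T'∈ , refl ← ∈P.∈-map⁻ (glue r) p
  with r∈ , v ← ∈P.∈-filter⁻ (holds? RowNat.valid) {xs = rows n c} r∈
  with refl ← All.lookup (rows-bottom n c) r∈
  with f , l , o ← tableaux-sound n k (next r) (Bounded-next r bd) T'∈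
  = glue-form r T' f , small r T' f l (rows-top n (map bottom r) r∈)
  , trans (ok-peel (glue r T')) (∧-intro (trans (cong RowNat.valid (glue-firstCell r T' f)) v) (trans (cong ok (glue-peel r T' f)) o))
  where
  small : ∀ r T → map form T ≡ next r → Entries< n T → Allˡ (λ x → proj₂ x < n) (next r) → Entries< n (glue r T)
  small [] [] _ _ _ = []
  small (dead t ∷ r) T e ps qs = [] ∷ small r T e ps qs
  small (live h t u ∷ r) ((_ , c) ∷ T) e (p ∷ ps) (q ∷ qs) = (q ∷ p) ∷ small r T (proj₂ (∷-injective e)) ps qs

tableaux-complete : ∀ n k c → Bounded k c → ∀ {T} → IsTableau n c T → T ∈ tableaux n k c
tableaux-complete n zero c bd {T} (refl , _ , _) = here (empty T bd)
  where
  empty : ∀ T → Bounded 0 (map form T) → T ≡ map (λ x → proj₂ x , []) (map form T)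
  empty [] [] = refl
  empty ((t , []) ∷ T) (_ ∷ ps) = cong (_ ∷_) (empty T ps)
tableaux-complete n (suc k) c bd {T} (refl , l , o) with v , o' ← ∧-true (trans (sym (ok-peel T)) o) =
  ∈P.∈-concat⁺′
    (subst (_∈ map (glue r) (tableaux n k (next r))) (unglue T) (∈P.∈-map⁺ (glue r)
      (tableaux-complete n k (next r) (Bounded-next r (subst (Bounded (suc k)) (sym (bottom-firstCell T)) bd))
        (next-form T , smaller T l , o'))))
    (∈P.∈-map⁺ (λ r → map (glue r) (tableaux n k (next r))) (∈P.∈-filter⁺ (holds? RowNat.valid) (rows-∈ n T l) v))
  where
  r = map firstCell T
  smaller : ∀ T → Entries< n T → Entries< n (mapMaybe peel T)
  smaller [] [] = []
  smaller ((t , []) ∷ T) (_ ∷ ps) = smaller T ps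
  smaller ((t , u ∷ c) ∷ T) ((_ ∷ p) ∷ ps) = p ∷ smaller T ps

-- A tableau determines its first row through `firstCell` and the rest through `peel`: gluing is
-- injective, and different first rows give disjoint lists.
tableaux-unique : ∀ n k c → Bounded k c → Unique (tableaux n k c)
tableaux-unique n zero c bd = [] ∷ []
tableaux-unique n (suc k) c bd = Unique.concat⁺ (AllP.map⁺ (All.tabulate glued)) (disjoint (filter (holds? RowNat.valid) (rows n c)) glueable (Unique.filter⁺ (holds? RowNat.valid) (rows-unique n c)))
  where
  open import Data.List.Relation.Binary.Disjoint.Propositional using (Disjoint)
  Glueable : List (Cell ℕ) → Set
  Glueable r = ∀ {T} → T ∈ tableaux n k (next r) → map form T ≡ next r
  bounded : ∀ {r} → r ∈ filter (holds? RowNat.valid) (rows n c) → Bounded k (next r)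
  bounded {r} r∈ with r∈ , _ ← ∈P.∈-filter⁻ (holds? RowNat.valid) {xs = rows n c} r∈ with refl ← All.lookup (rows-bottom n c) r∈ = Bounded-next r bd
  glueable : ∀ {r} → r ∈ filter (holds? RowNat.valid) (rows n c) → Glueable r
  glueable {r} r∈ T∈ = proj₁ (tableaux-sound n k (next r) (bounded r∈) T∈)
  glued : ∀ {r} → r ∈ filter (holds? RowNat.valid) (rows n c) → Unique (map (glue r) (tableaux n k (next r)))
  glued {r} r∈ = Unique.map⁻ {f = mapMaybe peel} (subst Unique (sym (back _ (glueable r∈))) (tableaux-unique n k (next r) (bounded r∈)))
    where
    back : ∀ Ts → (∀ {T} → T ∈ Ts → map form T ≡ next r) → map (mapMaybe peel) (map (glue r) Ts) ≡ Ts
    back [] _ = refl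
    back (T ∷ Ts) g = cong₂ _∷_ (glue-peel r T (g (here refl))) (back Ts (g ∘ there))
  apart : ∀ {r s} → Glueable r → Glueable s → r ≢ s →
    Disjoint (map (glue r) (tableaux n k (next r))) (map (glue s) (tableaux n k (next s)))
  apart {r} {s} gr gs r≢s (p , q) with T , T∈ , refl ← ∈P.∈-map⁻ (glue r) p with T' , T'∈ , e ← ∈P.∈-map⁻ (glue s) q =
    r≢s (trans (sym (glue-firstCell r T (gr T∈))) (trans (cong (map firstCell) e) (glue-firstCell s T' (gs T'∈))))
  disjoint : ∀ rs → (∀ {r} → r ∈ rs → Glueable r) → Unique rs → AllPairs Disjoint (map (λ r → map (glue r) (tableaux n k (next r))) rs)
  disjoint [] g [] = []
  disjoint (r ∷ rs) g (p ∷ u) =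
    AllP.map⁺ (All.tabulate (λ s∈ → apart (g (here refl)) (g (there s∈)) (All.lookup p s∈))) ∷ disjoint rs (g ∘ there) u

∑-filter : ∀ {A : Set} (p : A → Bool) (φ : A → ℤ) xs → ∑ (filter (holds? p) xs) φ ≡ ∑ xs (λ x → if p x then φ x else + 0)
∑-filter p φ [] = refl
∑-filter p φ (x ∷ xs) with p x
... | true = cong (λ z → φ x + z) (∑-filter p φ xs)
... | false = trans (∑-filter p φ xs) (sym (ℤP.+-identityˡ _))

mulVars-∑ : ∀ {A : Set} ls (φ : A → Poly) xs a → mulVars ls (λ b → ∑ xs (λ x → φ x b)) a ≡ ∑ xs (λ x → mulVars ls (φ x) a)
mulVars-∑ [] φ xs a = refl
mulVars-∑ (l ∷ ls) φ xs a = trans (mulVar-cong l (λ b _ → mulVars-∑ ls φ xs b) a refl) one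
  where
  one : mulVar l (λ b → ∑ xs (λ x → mulVars ls (φ x) b)) a ≡ ∑ xs (λ x → mulVar l (mulVars ls (φ x)) a)
  one with decAt a l
  ... | just _ = refl
  ... | nothing = zeros xs
    where
    zeros : ∀ {A : Set} (xs : List A) → + 0 ≡ ∑ xs (λ _ → + 0)
    zeros [] = refl
    zeros (x ∷ xs) = trans (zeros xs) (sym (ℤP.+-identityˡ _))

cnt-glue : ∀ k r T → map form T ≡ next r → cnt k (entries (glue r T)) ≡ cnt k (map proj₂ (next r) ++ entries T)
cnt-glue k [] [] _ = refl
cnt-glue k (dead t ∷ r) T e = cnt-glue k r T e
cnt-glue k (live h t u ∷ r) ((_ , c) ∷ T) e = cong (_ ℕ.+_) (begin
  cnt k (c ++ entries (glue r T)) ≡⟨ cnt-++ k c _ ⟩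
  cnt k c ℕ.+ cnt k (entries (glue r T)) ≡⟨ cong (cnt k c ℕ.+_) (cnt-glue k r T (proj₂ (∷-injective e))) ⟩
  cnt k c ℕ.+ cnt k (ls ++ entries T) ≡⟨ cong (cnt k c ℕ.+_) (cnt-++ k ls (entries T)) ⟩
  cnt k c ℕ.+ (cnt k ls ℕ.+ cnt k (entries T)) ≡⟨ ℕP.+-assoc (cnt k c) _ _ ⟨
  cnt k c ℕ.+ cnt k ls ℕ.+ cnt k (entries T) ≡⟨ cong (ℕ._+ cnt k (entries T)) (ℕP.+-comm (cnt k c) (cnt k ls)) ⟩
  cnt k ls ℕ.+ cnt k c ℕ.+ cnt k (entries T) ≡⟨ ℕP.+-assoc (cnt k ls) _ _ ⟩
  cnt k ls ℕ.+ (cnt k c ℕ.+ cnt k (entries T)) ≡⟨ cong (cnt k ls ℕ.+_) (cnt-++ k c (entries T)) ⟨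
  cnt k ls ℕ.+ cnt k (c ++ entries T) ≡⟨ cnt-++ k ls _ ⟨
  cnt k (ls ++ (c ++ entries T)) ∎)
  where
  open ≡-Reasoning
  ls : List ℕ
  ls = map proj₂ (next r)

fillings-tableaux : ∀ n k c → Bounded k c → ∀ a → fillings n k c a ≡ ∑ (tableaux n k c) (λ T → mulVars (entries T) 𝟙 a)
fillings-tableaux n zero c bd a = sym (trans (ℤP.+-identityʳ _) (cong (λ ls → mulVars ls 𝟙 a) (none c)))
  where
  none : ∀ c → entries (map (λ x → proj₂ x , []) c) ≡ []
  none [] = refl
  none (x ∷ c) = none c
fillings-tableaux n (suc k) c bd a = sym (begin
  ∑ (concatMap g (filter (holds? RowNat.valid) (rows n c))) φ
    ≡⟨ ∑-concatMap φ g (filter (holds? RowNat.valid) (rows n c)) ⟩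
  ∑ (filter (holds? RowNat.valid) (rows n c)) (λ r → ∑ (g r) φ)
    ≡⟨ ∑-filter RowNat.valid _ (rows n c) ⟩
  ∑ (rows n c) (λ r → if RowNat.valid r then ∑ (g r) φ else + 0)
    ≡⟨ ∑-cong (All.map (λ {r} b → cong (λ z → if RowNat.valid r then z else + 0) (one r b)) (rows-bottom n c)) ⟩
  ∑ (rows n c) (λ r → if RowNat.valid r then crown n k (next r) a else + 0) ∎)
  where
  open ≡-Reasoning
  g : List (Cell ℕ) → List (List Column)
  g r = map (glue r) (tableaux n k (next r))
  φ : List Column → ℤ
  φ T = mulVars (entries T) 𝟙 a
  one : ∀ r → map bottom r ≡ c → ∑ (g r) φ ≡ crown n k (next r) a
  one r refl = begin
    ∑ (g r) φ
      ≡⟨ ∑-map φ (glue r) (tableaux n k (next r)) ⟩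
    ∑ (tableaux n k (next r)) (λ T → mulVars (entries (glue r T)) 𝟙 a)
      ≡⟨ ∑-cong (All.tabulate (λ {T} T∈ → trans
           (mulVars-content (entries (glue r T)) (map proj₂ (next r) ++ entries T) (λ l → cnt-glue l r T (proj₁ (tableaux-sound n k (next r) (Bounded-next r bd) T∈))) a)
           (mulVars-++ (map proj₂ (next r)) (entries T) 𝟙 a))) ⟩
    ∑ (tableaux n k (next r)) (λ T → mulVars (map proj₂ (next r)) (mulVars (entries T) 𝟙) a)
      ≡⟨ mulVars-∑ (map proj₂ (next r)) (λ T → mulVars (entries T) 𝟙) (tableaux n k (next r)) a ⟨
    mulVars (map proj₂ (next r)) (λ b → ∑ (tableaux n k (next r)) (λ T → mulVars (entries T) 𝟙 b)) a
      ≡⟨ mulVars-cong (map proj₂ (next r)) (λ b _ → fillings-tableaux n k (next r) (Bounded-next r bd) b) a refl ⟨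
    crown n k (next r) a ∎

∑-indicator : ∀ {A : Set} (p : A → Bool) xs → ∑ xs (λ x → if p x then + 1 else + 0) ≡ + length (filter (holds? p) xs)
∑-indicator p [] = refl
∑-indicator p (x ∷ xs) with p x
... | true = cong (λ z → + 1 + z) (∑-indicator p xs)
... | false = trans (ℤP.+-identityˡ _) (∑-indicator p xs)

fillings-count : ∀ n k c → Bounded k c → ∀ a →
  fillings n k c a ≡ + length (filter (holds? (λ T → hasContent (entries T) a)) (tableaux n k c))
fillings-count n k c bd a = trans (fillings-tableaux n k c bd a)
  (trans (∑-ext (λ T → mulVars-𝟙 (entries T) a) (tableaux n k c)) (∑-indicator (λ T → hasContent (entries T) a) (tableaux n k c)))

-- Columns without boxes

hasBox : ℕ × ℕ → Bool
hasBox (h , _) = 0 <ᵇ h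

isLive : Cell ℕ → Bool
isLive (dead _) = false
isLive (live _ _ _) = true

Increasing : Config → Set
Increasing = AllPairs (λ x y → proj₂ x < proj₂ y)

-- An empty column imposes nothing on the columns to its right; for a column to its left its
-- basement label `t'` is larger than `t`, so the pattern `u ≤ t' ≤ t` cannot occur.
valid-live : ∀ r → Increasing (map bottom r) → RowNat.valid (filter (holds? isLive) r) ≡ RowNat.valid r
valid-live r inc = cong₂ _∧_ (ds r) (ps r inc)
  where
  ds : ∀ r → allᵇ RowNat.descends (filter (holds? isLive) r) ≡ allᵇ RowNat.descends r
  ds [] = refl
  ds (dead t ∷ r) = ds r
  ds (live h t u ∷ r) = cong (_ ∧_) (ds r)
  row : ∀ h t u r → Allˡ (λ y → t < proj₂ y) (map bottom r) →
    allᵇ (RowNat.compatible (live h t u)) (filter (holds? isLive) r) ≡ allᵇ (RowNat.compatible (live h t u)) r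
  row h t u [] _ = refl
  row h t u (live h' t' u' ∷ r) (_ ∷ qs) = cong (_ ∧_) (row h t u r qs)
  row h t u (dead t' ∷ r) (q ∷ qs) rewrite <ᵇ-true q with t' <ᵇ u
  ... | true = row h t u r qs
  ... | false = row h t u r qs
  ps : ∀ r → Increasing (map bottom r) → pairsᵇ RowNat.compatible (filter (holds? isLive) r) ≡ pairsᵇ RowNat.compatible r
  ps [] _ = refl
  ps (dead t ∷ r) (_ ∷ qs) = trans (ps r qs) (cong (_∧ pairsᵇ RowNat.compatible r) (sym (dead-compatible t r)))
  ps (live h t u ∷ r) (q ∷ qs) = cong₂ _∧_ (row h t u r q) (ps r qs)

next-live : ∀ r → next (filter (holds? isLive) r) ≡ next r
next-live [] = refl
next-live (dead t ∷ r) = next-live r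
next-live (live h t u ∷ r) = cong (_ ∷_) (next-live r)

∑-rows-live : ∀ n φ c → ∑ (rows n c) (φ ∘ filter (holds? isLive)) ≡ ∑ (rows n (filter (holds? hasBox) c)) φ
∑-rows-live n φ [] = refl
∑-rows-live n φ ((zero , t) ∷ c) = trans (∑-map (φ ∘ filter (holds? isLive)) (dead t ∷_) (rows n c)) (∑-rows-live n φ c)
∑-rows-live n φ ((suc h , t) ∷ c) =
  trans (∑-concatMap (φ ∘ filter (holds? isLive)) (λ u → map (live h t u ∷_) (rows n c)) (upTo n))
  (trans (∑-ext (λ u → trans (∑-map (φ ∘ filter (holds? isLive)) (live h t u ∷_) (rows n c))
      (trans (∑-rows-live n (φ ∘ (live h t u ∷_)) c) (sym (∑-map φ (live h t u ∷_) (rows n (filter (holds? hasBox) c)))))) (upTo n))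
  (sym (∑-concatMap φ (λ u → map (live h t u ∷_) (rows n (filter (holds? hasBox) c))) (upTo n))))

-- Increase is required of the basement only: the columns empty at the start have no cell in the
-- next row, whose labels may come in any order.
fillings-hasBox : ∀ n k c → Increasing c → ∀ a → fillings n k c a ≡ fillings n k (filter (holds? hasBox) c) a
fillings-hasBox n zero c inc a = refl
fillings-hasBox n (suc k) c inc a = trans
  (∑-cong (All.map (λ {r} b → cong₂ (λ v x → weigh v (crown n k x) a)
    (sym (valid-live r (subst Increasing (sym b) inc))) (sym (next-live r))) (rows-bottom n c)))
  (∑-rows-live n (λ r → weigh (RowNat.valid r) (crown n k (next r)) a) c)

-- The configuration of a composition: labels increasing from left to right

indexFrom : ℕ → List ℕ → Config
indexFrom s [] = []
indexFrom s (h ∷ β) = (h , s) ∷ indexFrom (suc s) β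

indexFrom-≥ : ∀ s β → Allˡ (λ x → s ≤ proj₂ x) (indexFrom s β)
indexFrom-≥ s [] = []
indexFrom-≥ s (h ∷ β) = ℕP.≤-refl ∷ All.map (ℕP.≤-trans (ℕP.n≤1+n s)) (indexFrom-≥ (suc s) β)

indexFrom-increasing : ∀ s β → Increasing (indexFrom s β)
indexFrom-increasing s [] = []
indexFrom-increasing s (h ∷ β) = indexFrom-≥ (suc s) β ∷ indexFrom-increasing (suc s) β

indexFrom-++ : ∀ s xs ys → indexFrom s (xs ++ ys) ≡ indexFrom s xs ++ indexFrom (s ℕ.+ length xs) ys
indexFrom-++ s [] ys = cong (λ s → indexFrom s ys) (sym (ℕP.+-identityʳ s))
indexFrom-++ s (x ∷ xs) ys = cong (_ ∷_) (trans (indexFrom-++ (suc s) xs ys)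
  (cong (λ s' → indexFrom (suc s) xs ++ indexFrom s' ys) (sym (ℕP.+-suc s (length xs)))))

Labelled-indexFrom : ∀ β → Labelled β (indexFrom 0 β)
Labelled-indexFrom β = record
  { heights = All.map (λ { (l , _ , e) → e }) (spec 0 β)
  ; below = All.map (λ { (l , l< , _) → l< }) (spec 0 β)
  ; unique = AllPairsP.map⁺ (AllPairs.map (λ p e → ℕP.<-irrefl e p) (indexFrom-increasing 0 β))
  ; full = full 0 β
  ; ordered = AllPairs.map (λ p q → ⊥-elim (ℕP.<-asym p q)) (indexFrom-increasing 0 β)
  }
  where
  spec : ∀ s β → Allˡ (λ x → s ≤ proj₂ x × proj₂ x < s ℕ.+ length β × proj₁ x ≡ atD β (proj₂ x ℕ.∸ s)) (indexFrom s β)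
  spec s [] = []
  spec s (h ∷ β) =
    (ℕP.≤-refl , ℕP.m<m+n s (s≤s z≤n) , cong (atD (h ∷ β)) (sym (ℕP.n∸n≡0 s)))
    ∷ All.map (λ { {x} (p , q , e) → ℕP.<⇒≤ p , subst (proj₂ x <_) (sym (ℕP.+-suc s (length β))) q
        , trans e (cong (atD (h ∷ β)) (lower s (proj₂ x) p)) }) (spec (suc s) β)
    where
    lower : ∀ s t → s < t → suc (t ℕ.∸ suc s) ≡ t ℕ.∸ s
    lower zero (suc t) _ = refl
    lower (suc s) (suc t) (s≤s p) = lower s t p
  full : ∀ s β {t} → t < length β → (atD β t , s ℕ.+ t) ∈ indexFrom s β
  full s (h ∷ β) {zero} _ = here (cong (h ,_) (ℕP.+-identityʳ s))
  full s (h ∷ β) {suc t} (s≤s p) = there (subst (λ l → (atD β t , l) ∈ indexFrom (suc s) β) (sym (ℕP.+-suc s t)) (full (suc s) β p))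

-- Blocks of variables

total : ∀ {r} → Vec ℕ r → ℕ
total [] = 0
total (n ∷ ns) = n ℕ.+ total ns

offset : ∀ {r} → Vec ℕ r → Fin r → ℕ
offset (n ∷ ns) Fin.zero = 0
offset (n ∷ ns) (Fin.suc j) = n ℕ.+ offset ns j

-- ω_j + k is read as the basement label of its column in the diagram of keyComp.
basement : ∀ {r} → Vec (List ℕ) r → Vec ℕ r → Fin r × ℕ → ℕ
basement lams ns (j , k) = offset ns j ℕ.+ (lookup ns j ℕ.∸ length (lookup lams j) ℕ.+ k)

topConfig : ∀ {r} → Vec (List ℕ) r → Vec ℕ r → Config
topConfig lams ns = zipWith (λ h b → h , basement lams ns b) (shape lams) (blockInfo lams)

Fits : ∀ {r} → Vec (List ℕ) r → Vec ℕ r → Set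
Fits ms ns = ∀ j → length (lookup ms j) ≤ lookup ns j

expo-length : ∀ {r} (m : Vec (List ℕ) r) ns → Fits m ns → length (expo m ns) ≡ total ns
expo-length [] [] fits = refl
expo-length (e ∷ m) (n ∷ ns) fits = trans (LP.length-++ (e ++ replicate (n ℕ.∸ length e) 0))
  (cong₂ ℕ._+_ (trans (LP.length-++ e) (trans (cong (length e ℕ.+_) (LP.length-replicate (n ℕ.∸ length e))) (ℕP.m+[n∸m]≡n (fits Fin.zero))))
    (expo-length m ns (fits ∘ Fin.suc)))

keyComp-length : ∀ {r} (lams : Vec (List ℕ) r) ns → Fits lams ns → length (keyComp lams ns) ≡ total ns
keyComp-length [] [] fits = refl
keyComp-length (l ∷ lams) (n ∷ ns) fits = trans (LP.length-++ (replicate (n ℕ.∸ length l) 0 ++ reverse l))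
  (cong₂ ℕ._+_ (trans (LP.length-++ (replicate (n ℕ.∸ length l) 0))
      (trans (cong₂ ℕ._+_ (LP.length-replicate (n ℕ.∸ length l)) (LP.length-reverse l)) (ℕP.m∸n+n≡m (fits Fin.zero))))
    (keyComp-length lams ns (fits ∘ Fin.suc)))

zipWith-++ : ∀ {A B C : Set} (f : A → B → C) xs xs' {ys ys'} → length xs ≡ length ys →
  zipWith f (xs ++ xs') (ys ++ ys') ≡ zipWith f xs ys ++ zipWith f xs' ys'
zipWith-++ f [] xs' {[]} e = refl
zipWith-++ f (x ∷ xs) xs' {y ∷ ys} e = cong (f x y ∷_) (zipWith-++ f xs xs' (ℕP.suc-injective e))

zipWith-mapʳ : ∀ {A B B' C : Set} (f : A → B' → C) (g : B → B') xs ys → zipWith f xs (map g ys) ≡ zipWith (λ x → f x ∘ g) xs ys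
zipWith-mapʳ f g [] ys = refl
zipWith-mapʳ f g (x ∷ xs) [] = refl
zipWith-mapʳ f g (x ∷ xs) (y ∷ ys) = cong (_ ∷_) (zipWith-mapʳ f g xs ys)

zipWith-ext : ∀ {A B C : Set} {f g : A → B → C} → (∀ x y → f x y ≡ g x y) → ∀ xs ys → zipWith f xs ys ≡ zipWith g xs ys
zipWith-ext e [] ys = refl
zipWith-ext e (x ∷ xs) [] = refl
zipWith-ext e (x ∷ xs) (y ∷ ys) = cong₂ _∷_ (e x y) (zipWith-ext e xs ys)

hasBox-zeros : ∀ s z β → filter (holds? hasBox) (indexFrom s (replicate z 0 ++ β)) ≡ filter (holds? hasBox) (indexFrom (s ℕ.+ z) β)
hasBox-zeros s zero β = cong (λ s → filter (holds? hasBox) (indexFrom s β)) (sym (ℕP.+-identityʳ s))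
hasBox-zeros s (suc z) β = trans (hasBox-zeros (suc s) z β) (cong (λ s → filter (holds? hasBox) (indexFrom s β)) (sym (ℕP.+-suc s z)))

hasBox-positive : ∀ s {β} → Allˡ (0 <_) β → filter (holds? hasBox) (indexFrom s β) ≡ indexFrom s β
hasBox-positive s [] = refl
hasBox-positive s (s≤s z≤n ∷ ps) = cong (_ ∷_) (hasBox-positive (suc s) ps)

indexFrom-zipWith : ∀ (g : ℕ → ℕ) β s → (∀ k → g k ≡ s ℕ.+ k) → zipWith (λ h k → h , g k) β (upTo (length β)) ≡ indexFrom s β
indexFrom-zipWith g [] s e = refl
indexFrom-zipWith g (h ∷ β) s e = cong₂ _∷_ (cong (h ,_) (trans (e 0) (ℕP.+-identityʳ s)))
  (trans (cong (zipWith (λ h k → h , g k) β) (sym (LP.map-upTo suc (length β))))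
    (trans (zipWith-mapʳ (λ h k → h , g k) suc β (upTo (length β)))
      (indexFrom-zipWith (g ∘ suc) β (suc s) (λ k → trans (e (suc k)) (ℕP.+-suc s k)))))

-- The shift `s` carries the induction across the blocks. As parts are positive, exactly the padding
-- disappears, and each remaining column keeps the label of its position behind the padding.
hasBox-keyComp : ∀ {r} (lams : Vec (List ℕ) r) ns s → All (Allˡ (0 <_)) lams → Fits lams ns →
  filter (holds? hasBox) (indexFrom s (keyComp lams ns)) ≡
  zipWith (λ h b → h , s ℕ.+ basement lams ns b) (shape lams) (blockInfo lams)
hasBox-keyComp [] [] s pos fits = refl
hasBox-keyComp (l ∷ lams) (n ∷ ns) s (p VAll.∷ pos) fits = begin
  filter (holds? hasBox) (indexFrom s ((replicate z 0 ++ reverse l) ++ keyComp lams ns))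
    ≡⟨ cong (filter (holds? hasBox) ∘ indexFrom s) (LP.++-assoc (replicate z 0) (reverse l) (keyComp lams ns)) ⟩
  filter (holds? hasBox) (indexFrom s (replicate z 0 ++ reverse l ++ keyComp lams ns))
    ≡⟨ hasBox-zeros s z _ ⟩
  filter (holds? hasBox) (indexFrom (s ℕ.+ z) (reverse l ++ keyComp lams ns))
    ≡⟨ cong (filter (holds? hasBox)) (indexFrom-++ (s ℕ.+ z) (reverse l) (keyComp lams ns)) ⟩
  filter (holds? hasBox) (indexFrom (s ℕ.+ z) (reverse l) ++ indexFrom (s ℕ.+ z ℕ.+ length (reverse l)) (keyComp lams ns))
    ≡⟨ LP.filter-++ (holds? hasBox) (indexFrom (s ℕ.+ z) (reverse l)) _ ⟩
  filter (holds? hasBox) (indexFrom (s ℕ.+ z) (reverse l)) ++ filter (holds? hasBox) (indexFrom (s ℕ.+ z ℕ.+ length (reverse l)) (keyComp lams ns))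
    ≡⟨ cong₂ _++_ (hasBox-positive (s ℕ.+ z) (All.tabulate (λ i → All.lookup p (AnyP.reverse⁻ i))))
         (trans (cong (λ t → filter (holds? hasBox) (indexFrom t (keyComp lams ns))) width) (hasBox-keyComp lams ns (s ℕ.+ n) pos (fits ∘ Fin.suc))) ⟩
  indexFrom (s ℕ.+ z) (reverse l) ++ zipWith (λ h b → h , s ℕ.+ n ℕ.+ basement lams ns b) (shape lams) (blockInfo lams)
    ≡⟨ cong₂ _++_ first second ⟨
  zipWith g (reverse l) (map (λ k → (Fin.zero , k)) (upTo (length l))) ++ zipWith g (shape lams) (map (map₁ Fin.suc) (blockInfo lams))
    ≡⟨ zipWith-++ g (reverse l) (shape lams)
         (trans (LP.length-reverse l) (sym (trans (LP.length-map _ (upTo (length l))) (LP.length-upTo (length l))))) ⟨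
  zipWith g (reverse l ++ shape lams) (map (λ k → (Fin.zero , k)) (upTo (length l)) ++ map (map₁ Fin.suc) (blockInfo lams)) ∎
  where
  open ≡-Reasoning
  z : ℕ
  z = n ℕ.∸ length l
  g : ℕ → Fin _ × ℕ → ℕ × ℕ
  g h b = h , s ℕ.+ basement (l ∷ lams) (n ∷ ns) b
  width : s ℕ.+ z ℕ.+ length (reverse l) ≡ s ℕ.+ n
  width = trans (ℕP.+-assoc s z _) (cong (s ℕ.+_) (trans (cong (z ℕ.+_) (LP.length-reverse l)) (ℕP.m∸n+n≡m (fits Fin.zero))))
  first : zipWith g (reverse l) (map (λ k → (Fin.zero , k)) (upTo (length l))) ≡ indexFrom (s ℕ.+ z) (reverse l)
  first = trans (zipWith-mapʳ g (λ k → Fin.zero , k) (reverse l) (upTo (length l)))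
    (trans (cong (λ m → zipWith (λ h k → h , s ℕ.+ (z ℕ.+ k)) (reverse l) (upTo m)) (sym (LP.length-reverse l)))
      (indexFrom-zipWith (λ k → s ℕ.+ (z ℕ.+ k)) (reverse l) (s ℕ.+ z) (λ k → sym (ℕP.+-assoc s z k))))
  second : zipWith g (shape lams) (map (map₁ Fin.suc) (blockInfo lams)) ≡
    zipWith (λ h b → h , s ℕ.+ n ℕ.+ basement lams ns b) (shape lams) (blockInfo lams)
  second = trans (zipWith-mapʳ g (map₁ Fin.suc) (shape lams) (blockInfo lams))
    (zipWith-ext (λ { h (j , k) → cong (h ,_) (trans (cong (s ℕ.+_) (ℕP.+-assoc n (offset ns j) _)) (sym (ℕP.+-assoc s n _))) }) (shape lams) (blockInfo lams))

Bounded-indexFrom : ∀ {k} s {β} → Allˡ (_≤ k) β → Bounded k (indexFrom s β)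
Bounded-indexFrom s [] = []
Bounded-indexFrom s (p ∷ ps) = p ∷ Bounded-indexFrom (suc s) ps

≤-sum : ∀ β → Allˡ (_≤ sum β) β
≤-sum [] = []
≤-sum (h ∷ β) = ℕP.m≤m+n h _ ∷ All.map (λ p → ℕP.≤-trans p (ℕP.m≤n+m _ h)) (≤-sum β)

module _ {r} (lams : Vec (List ℕ) r) (ns : Vec ℕ r) (part : All (Allˡ (0 <_)) lams) (fits : Fits lams ns) where

  private
    k : ℕ
    -- A number of rows sufficient for all columns: the sum bounds every height.
    k = sum (keyComp lams ns)

    boxes : filter (holds? hasBox) (indexFrom 0 (keyComp lams ns)) ≡ topConfig lams ns
    boxes = hasBox-keyComp lams ns 0 part fits

    bounded₀ : Bounded k (indexFrom 0 (keyComp lams ns))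
    bounded₀ = Bounded-indexFrom 0 (≤-sum (keyComp lams ns))

    bounded : Bounded k (topConfig lams ns)
    bounded = subst (Bounded k) boxes (AllP.filter⁺ (holds? hasBox) bounded₀)

  keyTableaux : List ℕ → List (List Column)
  keyTableaux a = filter (holds? (λ T → hasContent (entries T) a)) (tableaux (total ns) k (topConfig lams ns))

  keyTableaux-unique : ∀ a → Unique (keyTableaux a)
  keyTableaux-unique a = Unique.filter⁺ (holds? (λ T → hasContent (entries T) a)) (tableaux-unique (total ns) k (topConfig lams ns) bounded)

  keyTableaux-sound : ∀ a {T} → T ∈ keyTableaux a → IsTableau (total ns) (topConfig lams ns) T × hasContent (entries T) a ≡ true
  keyTableaux-sound a T∈ with p , q ← ∈P.∈-filter⁻ (holds? (λ T → hasContent (entries T) a)) {xs = tableaux (total ns) k (topConfig lams ns)} T∈ =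
    tableaux-sound (total ns) k (topConfig lams ns) bounded p , q

  keyTableaux-complete : ∀ a {T} → IsTableau (total ns) (topConfig lams ns) T → hasContent (entries T) a ≡ true → T ∈ keyTableaux a
  keyTableaux-complete a t e = ∈P.∈-filter⁺ (holds? (λ T → hasContent (entries T) a))
    (tableaux-complete (total ns) k (topConfig lams ns) bounded t) e

  key-coefficient : ∀ {K} → IsKey (keyComp lams ns) K → ∀ a → length a ≡ total ns → K a ≡ + length (keyTableaux a)
  key-coefficient {K} isKey a |a| = begin
    K a
      ≡⟨ key isKey k (indexFrom 0 (keyComp lams ns)) bounded₀ (Labelled-indexFrom (keyComp lams ns)) a (trans |a| (sym |β|)) ⟩
    fillings (length (keyComp lams ns)) k (indexFrom 0 (keyComp lams ns)) a
      ≡⟨ cong (λ n → fillings n k (indexFrom 0 (keyComp lams ns)) a) |β| ⟩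
    fillings (total ns) k (indexFrom 0 (keyComp lams ns)) a
      ≡⟨ fillings-hasBox (total ns) k _ (indexFrom-increasing 0 (keyComp lams ns)) a ⟩
    fillings (total ns) k (filter (holds? hasBox) (indexFrom 0 (keyComp lams ns))) a
      ≡⟨ cong (λ c → fillings (total ns) k c a) boxes ⟩
    fillings (total ns) k (topConfig lams ns) a
      ≡⟨ fillings-count (total ns) k (topConfig lams ns) bounded a ⟩
    + length (keyTableaux a) ∎
    where
    open ≡-Reasoning
    |β| : length (keyComp lams ns) ≡ total ns
    |β| = keyComp-length lams ns fits

-- The conditions on a filling, column by column

le-true : ∀ {x y} → x ≤ y → not (y <ᵇ x) ≡ true
le-true {x} {y} p with y <ᵇ x in e
... | false = refl
... | true = ⊥-elim (ℕP.<⇒≱ (<ᵇ-sound e) p)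

le-sound : ∀ {x y} → not (y <ᵇ x) ≡ true → x ≤ y
le-sound {x} {y} e = ℕP.≮⇒≥ (λ p → absurd (trans (sym (cong not (<ᵇ-true p))) e))
  where
  absurd : false ≡ true → ⊥
  absurd ()

nand-intro : ∀ {a b} → (a ≡ true → b ≡ true → ⊥) → not (a ∧ b) ≡ true
nand-intro {true} {true} f = ⊥-elim (f refl refl)
nand-intro {true} {false} f = refl
nand-intro {false} f = refl

nand-elim : ∀ {a b} → not (a ∧ b) ≡ true → a ≡ true → b ≡ true → ⊥
nand-elim () refl refl

compatible-dead-intro : ∀ h {t u t'} → (u ≤ t' → t' ≤ t → ⊥) → RowNat.compatible (live h t u) (dead t') ≡ true
compatible-dead-intro h {t} {u} {t'} f = nand-intro {not (t' <ᵇ u)} (λ p q → f (le-sound {u} p) (le-sound {t'} q))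

compatible-dead-elim : ∀ h {t u t'} → RowNat.compatible (live h t u) (dead t') ≡ true → u ≤ t' → t' ≤ t → ⊥
compatible-dead-elim h e p q = nand-elim e (le-true p) (le-true q)

neq-true : ∀ {x y} → x ≢ y → RowNat.neq x y ≡ true
neq-true {x} {y} ne with <ᵇ-connex {x} {y} ne
... | inj₁ (p , _) rewrite p = refl
... | inj₂ (p , q) rewrite p | q = refl

compatible-live-intro : ∀ h h' {t u t' u'} → u ≢ u' → (h ≤ h' → u' < u → u ≤ t' → ⊥) → (h' < h → u ≤ t' → t' ≤ t → ⊥) →
  RowNat.compatible (live h t u) (live h' t' u') ≡ true
compatible-live-intro h h' {t} {u} {t'} {u'} ne f g with h ≤ᵇ h' in e
... | true = ∧-intro (neq-true ne) (nand-intro {u' <ᵇ u} (λ p q → f (ℕP.≤ᵇ⇒≤ h h' (subst T (sym e) _)) (<ᵇ-sound p) (le-sound {u} q)))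
... | false = ∧-intro (neq-true ne) (nand-intro {not (t' <ᵇ u)} (λ p q →
    g (ℕP.≰⇒> (λ h≤h' → subst T e (ℕP.≤⇒≤ᵇ h≤h'))) (le-sound {u} p) (le-sound {t'} q)))

CompatibleLive : (h h' t u t' u' : ℕ) → Set
CompatibleLive h h' t u t' u' = RowNat.compatible (live h t u) (live h' t' u') ≡ true

compatible⇒≢ : ∀ h h' {t u t' u'} → CompatibleLive h h' t u t' u' → u ≢ u'
compatible⇒≢ h h' {u = u} e refl rewrite <ᵇ-irrefl u with () ← e

compatible-≤ : ∀ h h' {t u t' u'} → CompatibleLive h h' t u t' u' → h ≤ h' → u' < u → u ≤ t' → ⊥
compatible-≤ h h' {u = u} {u' = u'} e h≤h' p q with h ≤ᵇ h' in eh | proj₂ (∧-true {RowNat.neq u u'} e)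
... | true | e' = nand-elim e' (<ᵇ-true p) (le-true q)
... | false | _ = subst T eh (ℕP.≤⇒≤ᵇ h≤h')

compatible-> : ∀ h h' {t u t' u'} → CompatibleLive h h' t u t' u' → h' < h → u ≤ t' → t' ≤ t → ⊥
compatible-> h h' {u = u} {u' = u'} e h'<h p q with h ≤ᵇ h' in eh | proj₂ (∧-true {RowNat.neq u u'} e)
... | false | e' = nand-elim e' (le-true p) (le-true q)
... | true | _ = ℕP.<⇒≱ h'<h (ℕP.≤ᵇ⇒≤ h h' (subst T (sym eh) _))

-- A column with its basement label, read from the basement upwards, is at (t ∷ c).
module _ {r : ℕ} where

  ColumnCond : Label r → List (Label r) → Set
  ColumnCond t c = ∀ row a b → at (t ∷ c) (suc row) ≡ just a → at (t ∷ c) row ≡ just b → a ≤L b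

  -- The first column is the left one. The boxes `u` and `w` of a triple lie in it for `type1` and
  -- in the right column for `type2`.
  record PairCond (t : Label r) (c : List (Label r)) (t' : Label r) (c' : List (Label r)) : Set where
    field
      same-row : ∀ row a b → at (t ∷ c) row ≡ just a → at (t' ∷ c') row ≡ just b → a ≢ b
      diagonal : ∀ row a b → at (t ∷ c) (suc row) ≡ just a → at (t' ∷ c') row ≡ just b → a ≢ b
      type1 : length c' < length c → ∀ row a b d → at (t ∷ c) (suc row) ≡ just a → at (t' ∷ c') row ≡ just b →
                 at (t ∷ c) row ≡ just d → ¬ CoinvLabels a b d
      type2 : length c ≤ length c' → ∀ row a b d → at (t' ∷ c') (suc row) ≡ just a → at (t ∷ c) (suc row) ≡ just b →
                 at (t' ∷ c') row ≡ just d → ¬ CoinvLabels a b d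

  open PairCond

  PairCond-tail : ∀ {t u c t' u' c'} → PairCond t (u ∷ c) t' (u' ∷ c') → PairCond u c u' c'
  PairCond-tail p = record
    { same-row = λ row → same-row p (suc row)
    ; diagonal = λ row → diagonal p (suc row)
    ; type1 = λ q row → type1 p (s≤s q) (suc row)
    ; type2 = λ q row → type2 p (s≤s q) (suc row)
    }

  -- The map `f` reads labels, including those of the basement, as variables. With finite alphabets
  -- this respects the order only on a range of labels, hence the predicate `R`.
  module Embedding (f : Label r → ℕ) (R : Label r → Set)
    (mono : ∀ {x y} → R x → R y → x <L y → f x < f y)
    (reflect : ∀ {x y} → R x → R y → f x < f y → x <L y)
    (inj : ∀ {x y} → R x → R y → f x ≡ f y → x ≡ y) where

    reflect-≤ : ∀ {x y} → R x → R y → f x ≤ f y → x ≤L y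
    reflect-≤ rx ry p with ℕP.m≤n⇒m<n∨m≡n p
    ... | inj₁ q = inj₂ (reflect rx ry q)
    ... | inj₂ q = inj₁ (inj rx ry q)

    mono-≤ : ∀ {x y} → R x → R y → x ≤L y → f x ≤ f y
    mono-≤ rx ry (inj₁ refl) = ℕP.≤-refl
    mono-≤ rx ry (inj₂ p) = ℕP.<⇒≤ (mono rx ry p)

    descends-intro : ∀ {t c} → Allˡ R (t ∷ c) → ColumnCond t c → descendsFrom (f t) (map f c) ≡ true
    descends-intro {c = []} _ _ = refl
    descends-intro {c = u ∷ c} (rt ∷ ru ∷ rs) cc =
      ∧-intro (le-true (mono-≤ ru rt (cc 0 _ _ refl refl))) (descends-intro (ru ∷ rs) (λ row → cc (suc row)))

    descends-head : ∀ {t u c} → descendsFrom (f t) (map f (u ∷ c)) ≡ true → f u ≤ f t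
    descends-head {t} {u} e = le-sound (proj₁ (∧-true {not (f t <ᵇ f u)} e))

    descends-tail : ∀ {t u c} → descendsFrom (f t) (map f (u ∷ c)) ≡ true → descendsFrom (f u) (map f c) ≡ true
    descends-tail {t} {u} e = proj₂ (∧-true {not (f t <ᵇ f u)} e)

    descends-elim : ∀ {t c} → Allˡ R (t ∷ c) → descendsFrom (f t) (map f c) ≡ true → ColumnCond t c
    descends-elim {c = u ∷ c} (rt ∷ ru ∷ _) e zero _ _ refl refl = reflect-≤ ru rt (descends-head {c = c} e)
    descends-elim {t} {u ∷ c} (rt ∷ ru ∷ rs) e (suc row) a b p q = descends-elim (ru ∷ rs) (descends-tail {t} {u} {c} e) row a b p q
    descends-elim {c = []} _ e zero _ _ ()

    -- The weak inequalities of a forbidden pattern are split: if all are strict there is a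
    -- co-inversion triple, and an equality is an attack, diagonal or within the lower row.
    pair-intro : ∀ {t c t' c'} → Allˡ R (t ∷ c) → Allˡ R (t' ∷ c') → PairCond t c t' c' →
      compatibleFrom (f t) (map f c) (f t') (map f c') ≡ true
    pair-intro {c = []} _ _ _ = refl
    pair-intro {t} {u ∷ c} {t'} {[]} (rt ∷ ru ∷ _) (rt' ∷ _) P =
      compatible-dead-intro (length (map f c)) (λ p q → crossed p q)
      where
      crossed : f u ≤ f t' → f t' ≤ f t → ⊥
      crossed p q with ℕP.m≤n⇒m<n∨m≡n p | ℕP.m≤n⇒m<n∨m≡n q
      ... | inj₂ e | _ = diagonal P 0 u t' refl refl (inj ru rt' e)
      ... | inj₁ _ | inj₂ e = same-row P 0 t t' refl refl (inj rt rt' (sym e))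
      ... | inj₁ p' | inj₁ q' = type1 P (s≤s z≤n) 0 u t' t refl refl refl (inj₁ (reflect ru rt' p' , reflect rt' rt q'))
    pair-intro {t} {u ∷ c} {t'} {u' ∷ c'} (rt ∷ ru ∷ rs) (rt' ∷ ru' ∷ rs') P =
      ∧-intro (compatible-live-intro (length (map f c)) (length (map f c'))
          (λ e → same-row P 1 u u' refl refl (inj ru ru' e))
          (λ h≤h' p q → case₂ (s≤s (subst₂ _≤_ (LP.length-map f c) (LP.length-map f c') h≤h')) p (ℕP.m≤n⇒m<n∨m≡n q))
          (λ h'<h p q → case₁ (s≤s (subst₂ _<_ (LP.length-map f c') (LP.length-map f c) h'<h)) (ℕP.m≤n⇒m<n∨m≡n p) (ℕP.m≤n⇒m<n∨m≡n q)))
        (pair-intro (ru ∷ rs) (ru' ∷ rs') (PairCond-tail P))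
      where
      case₂ : length (u ∷ c) ≤ length (u' ∷ c') → f u' < f u → f u < f t' ⊎ f u ≡ f t' → ⊥
      case₂ h p (inj₁ q) = type2 P h 0 u' u t' refl refl refl (inj₁ (reflect ru' ru p , reflect ru rt' q))
      case₂ h p (inj₂ e) = diagonal P 0 u t' refl refl (inj ru rt' e)
      case₁ : length (u' ∷ c') < length (u ∷ c) → f u < f t' ⊎ f u ≡ f t' → f t' < f t ⊎ f t' ≡ f t → ⊥
      case₁ h (inj₂ e) _ = diagonal P 0 u t' refl refl (inj ru rt' e)
      case₁ h (inj₁ p) (inj₂ e) = same-row P 0 t t' refl refl (inj rt rt' (sym e))
      case₁ h (inj₁ p) (inj₁ q) = type1 P h 0 u t' t refl refl refl (inj₁ (reflect ru rt' p , reflect rt' rt q))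

    -- Two of the three cyclic patterns contain `d <L a`, against the descent of the column.
    no-coinversion : ∀ {a b d} → R a → R b → R d → f a ≤ f d → (f a < f b → f b < f d → ⊥) → ¬ CoinvLabels a b d
    no-coinversion ra rb rd a≤d ¬ascending (inj₁ (p , q)) = ¬ascending (mono ra rb p) (mono rb rd q)
    no-coinversion ra rb rd a≤d ¬ascending (inj₂ (inj₁ (_ , q))) = ℕP.<⇒≱ (mono rd ra q) a≤d
    no-coinversion ra rb rd a≤d ¬ascending (inj₂ (inj₂ (p , _))) = ℕP.<⇒≱ (mono rd ra p) a≤d

    Compatible : Label r → List (Label r) → Label r → List (Label r) → Set
    Compatible t c t' c' = compatibleFrom (f t) (map f c) (f t') (map f c') ≡ true

    Descends : Label r → List (Label r) → Set
    Descends t c = descendsFrom (f t) (map f c) ≡ true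

    split : ∀ {t u c t' u' c'} → Compatible t (u ∷ c) t' (u' ∷ c') →
      RowNat.compatible (live (length c) (f t) (f u)) (live (length c') (f t') (f u')) ≡ true × Compatible u c u' c'
    split {t} {u} {c} {t'} {u'} {c'} e with p , q ← ∧-true {RowNat.compatible (live (length (map f c)) (f t) (f u)) (live (length (map f c')) (f t') (f u'))} e
      = subst₂ (λ h h' → RowNat.compatible (live h (f t) (f u)) (live h' (f t') (f u')) ≡ true) (LP.length-map f c) (LP.length-map f c') p , q

    same-row-elim : ∀ {t c t' c'} → t ≢ t' → Compatible t c t' c' →
      ∀ row a b → at (t ∷ c) row ≡ just a → at (t' ∷ c') row ≡ just b → a ≢ b
    same-row-elim t≢t' e zero _ _ refl refl = t≢t'
    same-row-elim {t} {u ∷ c} {t'} {u' ∷ c'} t≢t' e (suc row) with p , q ← split {t} {u} {c} {t'} {u'} {c'} e =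
      same-row-elim (λ u≡u' → compatible⇒≢ (length c) (length c') p (cong f u≡u')) q row
    same-row-elim {c = []} _ _ (suc row) _ _ ()
    same-row-elim {c = u ∷ c} {c' = []} _ _ (suc row) _ _ _ ()

    -- Diagonal attacks have no test of their own: if `u = t'`, descent and `u ≠ u'` produce
    -- `u' < u ≤ t'` as well as `u ≤ t' ≤ t`, and one of the two is forbidden, whichever column is
    -- taller.
    diagonal-elim : ∀ {t c t' c'} → Descends t c → Descends t' c' → Compatible t c t' c' →
      ∀ row a b → at (t ∷ c) (suc row) ≡ just a → at (t' ∷ c') row ≡ just b → a ≢ b
    diagonal-elim {t} {u ∷ c} {t'} {[]} d d' e zero _ _ refl refl refl =
      compatible-dead-elim (length (map f c)) e ℕP.≤-refl (descends-head {t} {u} {c} d)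
    diagonal-elim {t} {u ∷ c} {t'} {u' ∷ c'} d d' e zero _ _ refl refl refl with p , _ ← split {t} {u} {c} {t'} {u'} {c'} e
      with length c ℕ.≤? length c'
    ... | yes h = compatible-≤ (length c) (length c') p h
            (ℕP.≤∧≢⇒< (descends-head {t'} {u'} {c'} d') (λ eq → compatible⇒≢ (length c) (length c') p (sym eq))) ℕP.≤-refl
    ... | no h = compatible-> (length c) (length c') p (ℕP.≰⇒> h) ℕP.≤-refl (descends-head {t} {u} {c} d)
    diagonal-elim {t} {u ∷ c} {t'} {u' ∷ c'} d d' e (suc row) a b =
      diagonal-elim {u} {c} {u'} {c'} (descends-tail {t} {u} {c} d) (descends-tail {t'} {u'} {c'} d') (proj₂ (split {t} {u} {c} {t'} {u'} {c'} e)) row a b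
    diagonal-elim {c = []} _ _ _ _ _ _ ()
    diagonal-elim {c = u ∷ c} {c' = []} _ _ _ (suc row) _ _ _ ()

    type1-elim : ∀ {t c t' c'} → Allˡ R (t ∷ c) → Allˡ R (t' ∷ c') → Descends t c → Compatible t c t' c' → length c' < length c →
      ∀ row a b d → at (t ∷ c) (suc row) ≡ just a → at (t' ∷ c') row ≡ just b → at (t ∷ c) row ≡ just d → ¬ CoinvLabels a b d
    type1-elim {t} {u ∷ c} {t'} {[]} (rt ∷ ru ∷ _) (rt' ∷ _) de e h zero _ _ _ refl refl refl =
      no-coinversion ru rt' rt (descends-head {t} {u} {c} de)
        (λ p q → compatible-dead-elim (length (map f c)) e (ℕP.<⇒≤ p) (ℕP.<⇒≤ q))
    type1-elim {t} {u ∷ c} {t'} {u' ∷ c'} (rt ∷ ru ∷ _) (rt' ∷ _) de e (s≤s h) zero _ _ _ refl refl refl =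
      no-coinversion ru rt' rt (descends-head {t} {u} {c} de)
        (λ p q → compatible-> (length c) (length c') (proj₁ (split {t} {u} {c} {t'} {u'} {c'} e)) h (ℕP.<⇒≤ p) (ℕP.<⇒≤ q))
    type1-elim {t} {u ∷ c} {t'} {u' ∷ c'} (_ ∷ rs) (_ ∷ rs') de e (s≤s h) (suc row) a b d =
      type1-elim rs rs' (descends-tail {t} {u} {c} de) (proj₂ (split {t} {u} {c} {t'} {u'} {c'} e)) h row a b d
    type1-elim {c = u ∷ c} {c' = []} _ _ _ _ _ (suc row) _ _ _ _ ()

    type2-elim : ∀ {t c t' c'} → Allˡ R (t ∷ c) → Allˡ R (t' ∷ c') → Descends t' c' → Compatible t c t' c' → length c ≤ length c' →
      ∀ row a b d → at (t' ∷ c') (suc row) ≡ just a → at (t ∷ c) (suc row) ≡ just b → at (t' ∷ c') row ≡ just d → ¬ CoinvLabels a b d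
    type2-elim {t} {u ∷ c} {t'} {u' ∷ c'} (_ ∷ ru ∷ _) (rt' ∷ ru' ∷ _) de e (s≤s h) zero _ _ _ refl refl refl =
      no-coinversion ru' ru rt' (descends-head {t'} {u'} {c'} de)
        (λ p q → compatible-≤ (length c) (length c') (proj₁ (split {t} {u} {c} {t'} {u'} {c'} e)) h p (ℕP.<⇒≤ q))
    type2-elim {t} {u ∷ c} {t'} {u' ∷ c'} (_ ∷ rs) (_ ∷ rs') de e (s≤s h) (suc row) a b d =
      type2-elim rs rs' (descends-tail {t'} {u'} {c'} de) (proj₂ (split {t} {u} {c} {t'} {u'} {c'} e)) h row a b d
    type2-elim {c = []} _ _ _ _ _ zero _ _ _ _ ()
    type2-elim {c = []} _ _ _ _ _ (suc _) _ _ _ _ ()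

    pair-elim : ∀ {t c t' c'} → Allˡ R (t ∷ c) → Allˡ R (t' ∷ c') → t ≢ t' → Descends t c → Descends t' c' → Compatible t c t' c' →
      PairCond t c t' c'
    pair-elim {t} {c} {t'} {c'} rs rs' ne de de' e = record
      { same-row = same-row-elim ne e
      ; diagonal = diagonal-elim {t} {c} {t'} {c'} de de' e
      ; type1 = type1-elim rs rs' de e
      ; type2 = type2-elim rs rs' de' e
      }

-- Fillings as lists of columns

columnOf : ∀ {r} → Fin r × ℕ → List (ℕ × Fin r) → Label r × List (Label r)
columnOf (j , k) col = omega j k , map (λ x → nat (proj₁ x) (proj₂ x)) col

columns : ∀ {r} → Vec (List ℕ) r → Filling r → List (Label r × List (Label r))
columns lams σ = zipWith columnOf (blockInfo lams) σ

_!_ : ∀ {r} → Label r × List (Label r) → ℕ → Maybe (Label r)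
X ! row = at (proj₁ X ∷ proj₂ X) row

at-map : ∀ {A B : Set} (g : A → B) xs i → at (map g xs) i ≡ Maybe.map g (at xs i)
at-map g [] i = refl
at-map g (x ∷ xs) zero = refl
at-map g (x ∷ xs) (suc i) = at-map g xs i

star-columns : ∀ {r} (lams : Vec (List ℕ) r) σ → length (blockInfo lams) ≡ length σ → ∀ c row →
  star lams σ c row ≡ (at (columns lams σ) c >>= _! row)
star-columns lams σ e c zero = go (blockInfo lams) σ e c
  where
  go : ∀ bs σ → length bs ≡ length σ → ∀ c →
    Maybe.map (λ b → omega (proj₁ b) (proj₂ b)) (at bs c) ≡ (at (zipWith columnOf bs σ) c >>= _! 0)
  go [] [] _ c = refl
  go (b ∷ bs) (x ∷ σ) e zero = refl
  go (b ∷ bs) (x ∷ σ) e (suc c) = go bs σ (ℕP.suc-injective e) c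
star-columns lams σ e c (suc row) = go (blockInfo lams) σ e c
  where
  go : ∀ bs σ → length bs ≡ length σ → ∀ c →
    (at σ c >>= λ col → Maybe.map (λ x → nat (proj₁ x) (proj₂ x)) (at col row)) ≡ (at (zipWith columnOf bs σ) c >>= _! suc row)
  go [] [] _ c = refl
  go (b ∷ bs) (x ∷ σ) e zero = sym (at-map _ x row)
  go (b ∷ bs) (x ∷ σ) e (suc c) = go bs σ (ℕP.suc-injective e) c

bind-just : ∀ {A B : Set} (m : Maybe A) {g : A → Maybe B} {b} → (m >>= g) ≡ just b → ∃[ x ] m ≡ just x × g x ≡ just b
bind-just (just x) e = x , refl , e

at-All : ∀ {A : Set} {P : A → Set} {xs} → Allˡ P xs → ∀ c {x} → at xs c ≡ just x → P x
at-All (p ∷ ps) zero refl = p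
at-All (p ∷ ps) (suc c) e = at-All ps c e

All-at : ∀ {A : Set} {P : A → Set} xs → (∀ c {x} → at xs c ≡ just x → P x) → Allˡ P xs
All-at [] f = []
All-at (x ∷ xs) f = f 0 refl ∷ All-at xs (λ c → f (suc c))

at-AllPairs : ∀ {A : Set} {P : A → A → Set} {xs} → AllPairs P xs →
  ∀ c c' {x y} → c < c' → at xs c ≡ just x → at xs c' ≡ just y → P x y
at-AllPairs (p ∷ ps) zero (suc c') _ refl e' = at-All p c' e'
at-AllPairs (p ∷ ps) (suc c) (suc c') (s≤s q) e e' = at-AllPairs ps c c' q e e'

AllPairs-at : ∀ {A : Set} {P : A → A → Set} xs →
  (∀ c c' {x y} → c < c' → at xs c ≡ just x → at xs c' ≡ just y → P x y) → AllPairs P xs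
AllPairs-at [] f = []
AllPairs-at (x ∷ xs) f = All-at xs (λ c → f 0 (suc c) (s≤s z≤n) refl) ∷ AllPairs-at xs (λ c c' p → f (suc c) (suc c') (s≤s p))

pairsᵇ-intro : ∀ {A : Set} (p : A → A → Bool) {xs} → AllPairs (λ x y → p x y ≡ true) xs → pairsᵇ p xs ≡ true
pairsᵇ-intro p [] = refl
pairsᵇ-intro p (q ∷ qs) = ∧-intro (allᵇ-intro (p _) q) (pairsᵇ-intro p qs)

pairsᵇ-elim : ∀ {A : Set} (p : A → A → Bool) xs → pairsᵇ p xs ≡ true → AllPairs (λ x y → p x y ≡ true) xs
pairsᵇ-elim p [] _ = []
pairsᵇ-elim p (x ∷ xs) e = allᵇ-elim (p x) xs (proj₁ (∧-true e)) ∷ pairsᵇ-elim p xs (proj₂ (∧-true {allᵇ (p x) xs} e))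

height-at : ∀ {r} bs {σ : Filling r} {μ} → Pointwise (λ col h → length col ≡ h) σ μ → ∀ c {X} →
  at (zipWith columnOf bs σ) c ≡ just X → atD μ c ≡ length (proj₂ X)
height-at (b ∷ bs) {col ∷ σ} (e ∷ es) zero refl = trans (sym e) (sym (LP.length-map (λ x → nat (proj₁ x) (proj₂ x)) col))
height-at (b ∷ bs) (e ∷ es) (suc c) eq = height-at bs es c eq
height-at [] (e ∷ es) c ()
height-at (b ∷ bs) [] c ()

blockInfo-length : ∀ {r} (lams : Vec (List ℕ) r) → length (blockInfo lams) ≡ length (shape lams)
blockInfo-length [] = refl
blockInfo-length {suc r} (l ∷ lams) = trans (LP.length-++ (map first (upTo (length l))) {map (map₁ Fin.suc) (blockInfo lams)})
  (trans (cong₂ ℕ._+_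
      (trans (LP.length-map first (upTo (length l))) (trans (LP.length-upTo (length l)) (sym (LP.length-reverse l))))
      (trans (LP.length-map (map₁ Fin.suc) (blockInfo lams)) (blockInfo-length lams)))
    (sym (LP.length-++ (reverse l))))
  where
  first : ℕ → Fin (suc r) × ℕ
  first k = Fin.zero , k

blockInfo-unique : ∀ {r} (lams : Vec (List ℕ) r) → Unique (blockInfo lams)
blockInfo-unique [] = []
blockInfo-unique (l ∷ lams) = Unique.++⁺
  (Unique.map⁺ (λ { refl → refl }) (Unique.upTo⁺ (length l)))
  (Unique.map⁺ (λ { {_ , _} {_ , _} refl → refl }) (blockInfo-unique lams))
  apart
  where
  apart : ∀ {b} → (b ∈ map (λ k → (Fin.zero , k)) (upTo (length l))) × (b ∈ map (map₁ Fin.suc) (blockInfo lams)) → ⊥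
  apart (p , q) with _ , _ , refl ← ∈P.∈-map⁻ _ p with _ , _ , () ← ∈P.∈-map⁻ _ q

blockInfo-bound : ∀ {r} (lams : Vec (List ℕ) r) → Allˡ (λ b → proj₂ b < length (lookup lams (proj₁ b))) (blockInfo lams)
blockInfo-bound [] = []
blockInfo-bound (l ∷ lams) = AllP.++⁺ (AllP.map⁺ (All.tabulate ∈P.∈-upTo⁻)) (AllP.map⁺ (blockInfo-bound lams))

-- The labels in the alphabets of sizes ns as indices of variables

index : ∀ {r} → Vec (List ℕ) r → Vec ℕ r → Label r → ℕ
index lams ns (nat k j) = offset ns j ℕ.+ k
index lams ns (omega j k) = basement lams ns (j , k)

offset-< : ∀ {r} (ns : Vec ℕ r) j j' {v} → toℕ j < toℕ j' → v < lookup ns j → offset ns j ℕ.+ v < offset ns j'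
offset-< (n ∷ ns) Fin.zero (Fin.suc j') _ p = ℕP.<-≤-trans p (ℕP.m≤m+n n _)
offset-< (n ∷ ns) (Fin.suc j) (Fin.suc j') {v} (s≤s q) p =
  subst (_< n ℕ.+ offset ns j') (sym (ℕP.+-assoc n (offset ns j) v)) (ℕP.+-monoʳ-< n (offset-< ns j j' q p))

offset-<-total : ∀ {r} (ns : Vec ℕ r) j {v} → v < lookup ns j → offset ns j ℕ.+ v < total ns
offset-<-total (n ∷ ns) Fin.zero p = ℕP.<-≤-trans p (ℕP.m≤m+n n _)
offset-<-total (n ∷ ns) (Fin.suc j) {v} p =
  subst (_< n ℕ.+ total ns) (sym (ℕP.+-assoc n (offset ns j) v)) (ℕP.+-monoʳ-< n (offset-<-total ns j p))

module _ {r} (lams : Vec (List ℕ) r) (ns : Vec ℕ r) (fits : Fits lams ns) where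

  private
    z : Fin r → ℕ
    z j = lookup ns j ℕ.∸ length (lookup lams j)

  -- The last variables of block `j`, as many as the length of its partition, stand for the basement
  -- labels. An ordinary label with index `z j` or more would collide with them or pass them,
  -- although it is smaller than `ω_j`.
  InRange : Label r → Set
  InRange (nat k j) = k < z j
  InRange (omega j k) = k < length (lookup lams j)

  private
    f : Label r → ℕ
    f = index lams ns

    block : Label r → Fin r
    block (nat k j) = j
    block (omega j k) = j

    pos : Label r → ℕ
    pos (nat k j) = k
    pos (omega j k) = z j ℕ.+ k

    f-pos : ∀ x → f x ≡ offset ns (block x) ℕ.+ pos x
    f-pos (nat k j) = refl
    f-pos (omega j k) = refl

    pos-< : ∀ x → InRange x → pos x < lookup ns (block x)
    pos-< (nat k j) p = ℕP.<-≤-trans p (ℕP.m∸n≤m (lookup ns j) (length (lookup lams j)))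
    pos-< (omega j k) p = subst (z j ℕ.+ k <_) (ℕP.m∸n+n≡m (fits j)) (ℕP.+-monoʳ-< (z j) p)

    block-mono : ∀ x y → InRange x → toℕ (block x) < toℕ (block y) → f x < f y
    block-mono x y rx q rewrite f-pos x | f-pos y = ℕP.<-≤-trans (offset-< ns (block x) (block y) q (pos-< x rx)) (ℕP.m≤m+n _ (pos y))

    pos-mono : ∀ x y → block x ≡ block y → pos x < pos y → f x < f y
    pos-mono x y e q rewrite f-pos x | f-pos y | e = ℕP.+-monoʳ-< (offset ns (block y)) q

    f-mono : ∀ {x y} → InRange x → InRange y → x <L y → f x < f y
    f-mono {nat a j} {nat b j'} rx ry (inj₁ q) = block-mono (nat a j) (nat b j') rx q
    f-mono {nat a j} {nat b j'} rx ry (inj₂ (refl , q)) = pos-mono (nat a j) (nat b j) refl q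
    f-mono {nat a j} {omega j' k} rx ry q with ℕP.m≤n⇒m<n∨m≡n q
    ... | inj₁ q' = block-mono (nat a j) (omega j' k) rx q'
    ... | inj₂ e with refl ← FinP.toℕ-injective e = pos-mono (nat a j) (omega j k) refl (ℕP.<-≤-trans rx (ℕP.m≤m+n _ k))
    f-mono {omega j k} {nat a j'} rx ry q = block-mono (omega j k) (nat a j') rx q
    f-mono {omega j k} {omega j' k'} rx ry (inj₁ q) = block-mono (omega j k) (omega j' k') rx q
    f-mono {omega j k} {omega j' k'} rx ry (inj₂ (refl , q)) = pos-mono (omega j k) (omega j k') refl (ℕP.+-monoʳ-< (z j) q)

    connex : ∀ x y → InRange x → InRange y → x <L y ⊎ x ≡ y ⊎ y <L x
    connex x y rx ry with ℕP.<-cmp (toℕ (block x)) (toℕ (block y))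
    connex (nat a j) (nat b j') rx ry | tri< p _ _ = inj₁ (inj₁ p)
    connex (nat a j) (omega j' k) rx ry | tri< p _ _ = inj₁ (ℕP.<⇒≤ p)
    connex (omega j k) (nat b j') rx ry | tri< p _ _ = inj₁ p
    connex (omega j k) (omega j' k') rx ry | tri< p _ _ = inj₁ (inj₁ p)
    connex (nat a j) (nat b j') rx ry | tri> _ _ p = inj₂ (inj₂ (inj₁ p))
    connex (nat a j) (omega j' k) rx ry | tri> _ _ p = inj₂ (inj₂ p)
    connex (omega j k) (nat b j') rx ry | tri> _ _ p = inj₂ (inj₂ (ℕP.<⇒≤ p))
    connex (omega j k) (omega j' k') rx ry | tri> _ _ p = inj₂ (inj₂ (inj₁ p))
    connex (nat a j) (nat b j') rx ry | tri≈ _ e _ with refl ← FinP.toℕ-injective e with ℕP.<-cmp a b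
    ... | tri< p _ _ = inj₁ (inj₂ (refl , p))
    ... | tri≈ _ refl _ = inj₂ (inj₁ refl)
    ... | tri> _ _ p = inj₂ (inj₂ (inj₂ (refl , p)))
    connex (nat a j) (omega j' k) rx ry | tri≈ _ e _ = inj₁ (ℕP.≤-reflexive e)
    connex (omega j k) (nat b j') rx ry | tri≈ _ e _ = inj₂ (inj₂ (ℕP.≤-reflexive (sym e)))
    connex (omega j k) (omega j' k') rx ry | tri≈ _ e _ with refl ← FinP.toℕ-injective e with ℕP.<-cmp k k'
    ... | tri< p _ _ = inj₁ (inj₂ (refl , p))
    ... | tri≈ _ refl _ = inj₂ (inj₁ refl)
    ... | tri> _ _ p = inj₂ (inj₂ (inj₂ (refl , p)))

    f-reflect : ∀ {x y} → InRange x → InRange y → f x < f y → x <L y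
    f-reflect {x} {y} rx ry p with connex x y rx ry
    ... | inj₁ q = q
    ... | inj₂ (inj₁ refl) = ⊥-elim (ℕP.<-irrefl refl p)
    ... | inj₂ (inj₂ q) = ⊥-elim (ℕP.<-asym p (f-mono ry rx q))

  index-injective : ∀ {x y} → InRange x → InRange y → f x ≡ f y → x ≡ y
  index-injective {x} {y} rx ry e with connex x y rx ry
  ... | inj₁ q = ⊥-elim (ℕP.<-irrefl e (f-mono rx ry q))
  ... | inj₂ (inj₁ q) = q
  ... | inj₂ (inj₂ q) = ⊥-elim (ℕP.<-irrefl (sym e) (f-mono ry rx q))

  open Embedding f InRange f-mono f-reflect index-injective

  indexColumn : Label r × List (Label r) → Column
  indexColumn (t , c) = f t , map f c

  indexed : Filling r → List Column
  indexed σ = map indexColumn (columns lams σ)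

  module _ (σ : Filling r) (shp : HasShape lams σ) (range : Allˡ (Allˡ (λ x → proj₁ x < z (proj₂ x))) σ) where

    private
      lengths : length (blockInfo lams) ≡ length σ
      lengths = trans (blockInfo-length lams) (sym (Pointwise-length shp))

      InRangeColumn : Label r × List (Label r) → Set
      InRangeColumn X = Allˡ InRange (proj₁ X ∷ proj₂ X)

      ranges : Allˡ InRangeColumn (columns lams σ)
      ranges = go (blockInfo-bound lams) range
        where
        go : ∀ {bs σ} → Allˡ (λ b → proj₂ b < length (lookup lams (proj₁ b))) bs → Allˡ (Allˡ (λ x → proj₁ x < z (proj₂ x))) σ →
          Allˡ InRangeColumn (zipWith columnOf bs σ)
        go [] _ = []
        go (p ∷ ps) [] = []
        go (p ∷ ps) (q ∷ qs) = (p ∷ AllP.map⁺ q) ∷ go ps qs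

      basements : AllPairs (λ X Y → proj₁ X ≢ proj₁ Y) (columns lams σ)
      basements = go (blockInfo-unique lams)
        where
        row : ∀ {b bs} {σ : Filling r} → Allˡ (b ≢_) bs → Allˡ (λ Y → omega (proj₁ b) (proj₂ b) ≢ proj₁ Y) (zipWith columnOf bs σ)
        row {σ = []} [] = []
        row {σ = []} (p ∷ ps) = []
        row {σ = x ∷ σ} [] = []
        row {σ = x ∷ σ} (p ∷ ps) = (λ { refl → p refl }) ∷ row ps
        go : ∀ {bs} {σ : Filling r} → Unique bs → AllPairs (λ X Y → proj₁ X ≢ proj₁ Y) (zipWith columnOf bs σ)
        go {σ = []} [] = []
        go {σ = []} (p ∷ u) = []
        go {σ = x ∷ σ} [] = []
        go {σ = x ∷ σ} (p ∷ u) = row p ∷ go u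

      found : ∀ {c row a} → star lams σ c row ≡ just a → ∃[ X ] at (columns lams σ) c ≡ just X × X ! row ≡ just a
      found {c} {row} e = bind-just (at (columns lams σ) c) (trans (sym (star-columns lams σ lengths c row)) e)

      placed : ∀ {c row a X} → at (columns lams σ) c ≡ just X → X ! row ≡ just a → star lams σ c row ≡ just a
      placed {c} {row} {X = X} e e' = trans (star-columns lams σ lengths c row) (trans (cong (_>>= _! row) e) e')

      height : ∀ {c X} → at (columns lams σ) c ≡ just X → atD (shape lams) c ≡ length (proj₂ X)
      height {c} e = height-at (blockInfo lams) shp c e

      same : ∀ {A : Set} {m : Maybe A} {x y} → m ≡ just x → m ≡ just y → x ≡ y
      same refl refl = refl

    InL⇒ok : InL lams σ → ok (indexed σ) ≡ true
    InL⇒ok (_ , (na₁ , na₂) , dec , (co₁ , co₂)) = ∧-intro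
      (allᵇ-intro okColumn (AllP.map⁺ (All-at (columns lams σ) (λ c e → descends-intro (at-All ranges c e)
        (λ row a b p q → dec c row a b (placed {c} {suc row} e p) (placed {c} {row} e q))))))
      (pairsᵇ-intro okPair (AllPairsP.map⁺ (AllPairs-at (columns lams σ) pair)))
      where
      pair : ∀ c c' {X Y} → c < c' → at (columns lams σ) c ≡ just X → at (columns lams σ) c' ≡ just Y →
        okPair (indexColumn X) (indexColumn Y) ≡ true
      pair c c' c<c' e e' = pair-intro (at-All ranges c e) (at-All ranges c' e') record
        { same-row = λ row a b p q → na₁ c c' row a b (ℕP.<⇒≢ c<c') (placed {c} {row} e p) (placed {c'} {row} e' q)
        ; diagonal = λ row a b p q → na₂ c c' row a b c<c' (placed {c} {suc row} e p) (placed {c'} {row} e' q)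
        ; type1 = λ h row a b d p q s → co₁ c c' row a b d c<c' (subst₂ _<_ (sym (height e')) (sym (height e)) h)
            (placed {c} {suc row} e p) (placed {c'} {row} e' q) (placed {c} {row} e s)
        ; type2 = λ h row a b d p q s → co₂ c' c row a b d c<c' (subst₂ _≤_ (sym (height e)) (sym (height e')) h)
            (placed {c'} {suc row} e' p) (placed {c} {suc row} e q) (placed {c'} {row} e' s)
        }

    ok⇒InL : ok (indexed σ) ≡ true → InL lams σ
    ok⇒InL o = shp , (na₁ , na₂) , dec , (co₁ , co₂)
      where
      cols : Allˡ (λ X → okColumn (indexColumn X) ≡ true) (columns lams σ)
      cols = AllP.map⁻ (allᵇ-elim okColumn (indexed σ) (proj₁ (∧-true {allᵇ okColumn (indexed σ)} o)))
      prs : AllPairs (λ X Y → okPair (indexColumn X) (indexColumn Y) ≡ true) (columns lams σ)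
      prs = AllPairsP.map⁻ (pairsᵇ-elim okPair (indexed σ) (proj₂ (∧-true {allᵇ okColumn (indexed σ)} o)))
      pair : ∀ {c c' X Y} → c < c' → at (columns lams σ) c ≡ just X → at (columns lams σ) c' ≡ just Y →
        PairCond (proj₁ X) (proj₂ X) (proj₁ Y) (proj₂ Y)
      pair {c} {c'} c<c' e e' = pair-elim (at-All ranges c e) (at-All ranges c' e') (at-AllPairs basements c c' c<c' e e')
        (at-All cols c e) (at-All cols c' e') (at-AllPairs prs c c' c<c' e e')
      na₁ : ∀ c c' row a b → c ≢ c' → star lams σ c row ≡ just a → star lams σ c' row ≡ just b → a ≢ b
      na₁ c c' row a b ne p q a≡b with X , e , p' ← found {c} {row} p with Y , e' , q' ← found {c'} {row} q with ℕP.<-cmp c c'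
      ... | tri< c<c' _ _ = PairCond.same-row (pair c<c' e e') row a b p' q' a≡b
      ... | tri≈ _ c≡c' _ = ne c≡c'
      ... | tri> _ _ c'<c = PairCond.same-row (pair c'<c e' e) row b a q' p' (sym a≡b)
      na₂ : ∀ c c' row a b → c < c' → star lams σ c (suc row) ≡ just a → star lams σ c' row ≡ just b → a ≢ b
      na₂ c c' row a b c<c' p q with X , e , p' ← found {c} {suc row} p with Y , e' , q' ← found {c'} {row} q =
        PairCond.diagonal (pair c<c' e e') row a b p' q'
      dec : ∀ c row a b → star lams σ c (suc row) ≡ just a → star lams σ c row ≡ just b → a ≤L b
      dec c row a b p q with X , e , p' ← found {c} {suc row} p with Y , e' , q' ← found {c} {row} q with refl ← same e e' =
        descends-elim (at-All ranges c e) (at-All cols c e) row a b p' q'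
      co₁ : ∀ c c' row a b d → c < c' → atD (shape lams) c' < atD (shape lams) c →
        star lams σ c (suc row) ≡ just a → star lams σ c' row ≡ just b → star lams σ c row ≡ just d → ¬ CoinvLabels a b d
      co₁ c c' row a b d c<c' h p q s
        with X , e , p' ← found {c} {suc row} p with Y , e' , q' ← found {c'} {row} q
        with X' , e″ , s' ← found {c} {row} s with refl ← same e e″ =
        PairCond.type1 (pair c<c' e e') (subst₂ _<_ (height e') (height e) h) row a b d p' q' s'
      co₂ : ∀ c c' row a b d → c' < c → atD (shape lams) c' ≤ atD (shape lams) c →
        star lams σ c (suc row) ≡ just a → star lams σ c' (suc row) ≡ just b → star lams σ c row ≡ just d → ¬ CoinvLabels a b d
      co₂ c c' row a b d c'<c h p q s
        with X , e , p' ← found {c} {suc row} p with Y , e' , q' ← found {c'} {suc row} q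
        with X' , e″ , s' ← found {c} {row} s with refl ← same e e″ =
        PairCond.type2 (pair c'<c e' e) (subst₂ _≤_ (height e') (height e) h) row a b d p' q' s'

-- Weights

offset-injective : ∀ {r} (ns : Vec ℕ r) {j j' v v'} → v < lookup ns j → v' < lookup ns j' →
  offset ns j ℕ.+ v ≡ offset ns j' ℕ.+ v' → (v , j) ≡ (v' , j')
offset-injective ns {j} {j'} {v} {v'} p p' e with ℕP.<-cmp (toℕ j) (toℕ j')
... | tri< q _ _ = ⊥-elim (ℕP.<-irrefl e (ℕP.<-≤-trans (offset-< ns j j' q p) (ℕP.m≤m+n _ v')))
... | tri> _ _ q = ⊥-elim (ℕP.<-irrefl (sym e) (ℕP.<-≤-trans (offset-< ns j' j q p') (ℕP.m≤m+n _ v)))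
... | tri≈ _ q _ with refl ← FinP.toℕ-injective q = cong (_, j) (ℕP.+-cancelˡ-≡ (offset ns j) v v' e)

decompose : ∀ {r} (ns : Vec ℕ r) p → p < total ns → ∃[ j ] ∃[ v ] v < lookup ns j × p ≡ offset ns j ℕ.+ v
decompose (n ∷ ns) p p< with p ℕ.<? n
... | yes p<n = Fin.zero , p , p<n , refl
... | no p≮n
  with j , v , v< , e ← decompose ns (p ℕ.∸ n) (ℕP.+-cancelˡ-< n _ _ (subst (_< n ℕ.+ total ns) (sym (ℕP.m+[n∸m]≡n (ℕP.≮⇒≥ p≮n))) p<))
  = Fin.suc j , v , v< , trans (sym (ℕP.m+[n∸m]≡n (ℕP.≮⇒≥ p≮n))) (trans (cong (n ℕ.+_) e) (sym (ℕP.+-assoc n (offset ns j) v)))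

atD-++ˡ : ∀ xs ys {k} → k < length xs → atD (xs ++ ys) k ≡ atD xs k
atD-++ˡ (x ∷ xs) ys {zero} _ = refl
atD-++ˡ (x ∷ xs) ys {suc k} (s≤s p) = atD-++ˡ xs ys p

atD-++ʳ : ∀ xs ys k → atD (xs ++ ys) (length xs ℕ.+ k) ≡ atD ys k
atD-++ʳ [] ys k = refl
atD-++ʳ (x ∷ xs) ys k = atD-++ʳ xs ys k

atD-pad : ∀ xs z k → atD (xs ++ replicate z 0) k ≡ atD xs k
atD-pad [] zero k = refl
atD-pad [] (suc z) zero = refl
atD-pad [] (suc z) (suc k) = atD-pad [] z k
atD-pad (x ∷ xs) z zero = refl
atD-pad (x ∷ xs) z (suc k) = atD-pad xs z k

atD-positive : ∀ xs {k} → 0 < atD xs k → k < length xs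
atD-positive (x ∷ xs) {zero} _ = s≤s z≤n
atD-positive (x ∷ xs) {suc k} p = s≤s (atD-positive xs p)

expo-at : ∀ {r} (m : Vec (List ℕ) r) ns → Fits m ns → ∀ j {k} → k < lookup ns j →
  atD (expo m ns) (offset ns j ℕ.+ k) ≡ atD (lookup m j) k
expo-at (e ∷ m) (n ∷ ns) fits j {k} k< = go j k<
  where
  pad : List ℕ
  pad = e ++ replicate (n ℕ.∸ length e) 0
  |pad| : length pad ≡ n
  |pad| = trans (LP.length-++ e) (trans (cong (length e ℕ.+_) (LP.length-replicate (n ℕ.∸ length e))) (ℕP.m+[n∸m]≡n (fits Fin.zero)))
  go : ∀ j → k < lookup (n ∷ ns) j → atD (pad ++ expo m ns) (offset (n ∷ ns) j ℕ.+ k) ≡ atD (lookup (e ∷ m) j) k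
  go Fin.zero k< = trans (atD-++ˡ pad (expo m ns) (subst (k <_) (sym |pad|) k<)) (atD-pad e (n ℕ.∸ length e) k)
  go (Fin.suc j) k< = trans (cong (atD (pad ++ expo m ns)) (trans (ℕP.+-assoc n (offset ns j) k) (cong (ℕ._+ (offset ns j ℕ.+ k)) (sym |pad|))))
    (trans (atD-++ʳ pad (expo m ns) (offset ns j ℕ.+ k)) (expo-at m ns (fits ∘ Fin.suc) j k<))

variable-index : ∀ {r} → Vec ℕ r → ℕ × Fin r → ℕ
variable-index ns (k , j) = offset ns j ℕ.+ k

InBlock : ∀ {r} → Vec ℕ r → ℕ × Fin r → Set
InBlock ns (k , j) = k < lookup ns j

cnt-count : ∀ {r} (ns : Vec ℕ r) x xs → InBlock ns x → Allˡ (InBlock ns) xs →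
  cnt (variable-index ns x) (map (variable-index ns) xs) ≡ count x xs
cnt-count ns x [] p _ = refl
cnt-count ns x (y ∷ xs) p (q ∷ qs) with PP.≡-dec ℕ._≟_ FinP._≟_ x y
... | yes refl rewrite ≡ᵇ-refl (variable-index ns x) = cong suc (cnt-count ns x xs p qs)
... | no x≢y
  rewrite ≢⇒≡ᵇ {variable-index ns x} {variable-index ns y} (λ e → x≢y (offset-injective ns p q e)) = cnt-count ns x xs p qs

cnt-∉ : ∀ {p} xs → Allˡ (p ≢_) xs → cnt p xs ≡ 0
cnt-∉ [] [] = refl
cnt-∉ (x ∷ xs) (q ∷ qs) rewrite ≢⇒≡ᵇ q = cnt-∉ xs qs

cnt-∈ : ∀ {p xs} → p ∈ xs → 0 < cnt p xs
cnt-∈ {p} (here refl) rewrite ≡ᵇ-refl p = s≤s z≤n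
cnt-∈ (there q) = ℕP.<-≤-trans (cnt-∈ q) (ℕP.m≤n+m _ _)

count-∈ : ∀ {r} {x : ℕ × Fin r} {xs} → x ∈ xs → 0 < count x xs
count-∈ {x = x} {y ∷ xs} q with PP.≡-dec ℕ._≟_ FinP._≟_ x y
... | yes _ = s≤s z≤n
count-∈ (here refl) | no x≢x = ⊥-elim (x≢x refl)
count-∈ (there q) | no _ = count-∈ q

count-∉ : ∀ {r} (x : ℕ × Fin r) xs → (∀ {y} → y ∈ xs → x ≢ y) → count x xs ≡ 0
count-∉ x [] f = refl
count-∉ x (y ∷ xs) f with PP.≡-dec ℕ._≟_ FinP._≟_ x y
... | yes e = ⊥-elim (f (here refl) e)
... | no _ = count-∉ x xs (f ∘ there)

-- The fillings of given weight, from the tableaux for the alphabets of sizes ns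

lift-list : ∀ {A B : Set} {P : A → Set} (g : A → B) {ys} → Allˡ (λ y → ∃[ x ] g x ≡ y × P x) ys →
  ∃[ xs ] map g xs ≡ ys × Allˡ P xs
lift-list g [] = [] , refl , []
lift-list g ((x , e , p) ∷ ps) with xs , es , qs ← lift-list g ps = x ∷ xs , cong₂ _∷_ e es , p ∷ qs

module _ {r} (lams m : Vec (List ℕ) r) (ns : Vec ℕ r)
  (large : ∀ j → length (lookup m j) ℕ.+ length (lookup lams j) ≤ lookup ns j) where

  private
    a : List ℕ
    a = expo m ns

    var : ℕ × Fin r → ℕ
    var = variable-index ns

    fitsˡ : Fits lams ns
    fitsˡ j = ℕP.≤-trans (ℕP.m≤n+m _ (length (lookup m j))) (large j)

    fitsᵐ : Fits m ns
    fitsᵐ j = ℕP.≤-trans (ℕP.m≤m+n (length (lookup m j)) _) (large j)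

    small : ∀ j → length (lookup m j) ≤ lookup ns j ℕ.∸ length (lookup lams j)
    small j = ℕP.m+n≤o⇒m≤o∸n (length (lookup m j)) (large j)

    BelowBasement : ℕ × Fin r → Set
    BelowBasement x = proj₁ x < lookup ns (proj₂ x) ℕ.∸ length (lookup lams (proj₂ x))

    below⇒block : ∀ {x} → BelowBasement x → InBlock ns x
    below⇒block {x} p = ℕP.<-≤-trans p (ℕP.m∸n≤m (lookup ns (proj₂ x)) (length (lookup lams (proj₂ x))))

    Good : Filling r → Set
    Good σ = InL lams σ × HasWeight σ m

    index' : Filling r → List Column
    index' = indexed lams ns fitsˡ

    unconcat : ∀ {P : ℕ × Fin r → Set} σ → (∀ {x} → x ∈ concat σ → P x) → Allˡ (Allˡ P) σ
    unconcat [] f = []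
    unconcat (c ∷ σ) f = All.tabulate (λ p → f (∈P.∈-++⁺ˡ p)) ∷ unconcat σ (λ p → f (∈P.∈-++⁺ʳ c p))

    reconcat : ∀ {P : ℕ × Fin r → Set} {σ} → Allˡ (Allˡ P) σ → Allˡ P (concat σ)
    reconcat [] = []
    reconcat (p ∷ ps) = AllP.++⁺ p (reconcat ps)

    -- A label that occurs has a positive exponent in `m`, hence an index below the length of its
    -- list, and `large` leaves that many variables below those of the basement.
    weight-range : ∀ {σ} → HasWeight σ m → Allˡ (Allˡ BelowBasement) σ
    weight-range {σ} w = unconcat σ (λ {x} p → ℕP.<-≤-trans
      (atD-positive (lookup m (proj₂ x)) (subst (0 <_) (w (proj₂ x) (proj₁ x)) (count-∈ p))) (small (proj₂ x)))

    entries-indexed : ∀ bs σ → length bs ≡ length σ →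
      entries (map (indexColumn lams ns fitsˡ) (zipWith columnOf bs σ)) ≡ map var (concat σ)
    entries-indexed [] [] _ = refl
    entries-indexed (b ∷ bs) (c ∷ σ) e = trans (cong₂ _++_ (sym (LP.map-∘ c)) (entries-indexed bs σ (ℕP.suc-injective e)))
      (sym (LP.map-++ var c (concat σ)))

    shape-length : ∀ {σ} → HasShape lams σ → length (blockInfo lams) ≡ length σ
    shape-length shp = trans (blockInfo-length lams) (sym (Pointwise-length shp))

    weight⇒content : ∀ {σ} → HasShape lams σ → HasWeight σ m → hasContent (entries (index' σ)) a ≡ true
    weight⇒content {σ} shp w = hasContent-complete (entries (index' σ)) a (λ p →
      trans (cong (cnt p) (entries-indexed (blockInfo lams) σ (shape-length shp))) (counts p))
      where
      range : Allˡ BelowBasement (concat σ)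
      range = reconcat {σ = σ} (weight-range w)
      counts : ∀ p → cnt p (map var (concat σ)) ≡ atD a p
      counts p with p ℕ.<? total ns
      ... | yes p< with j , k , k< , refl ← decompose ns p p< =
        trans (cnt-count ns (k , j) (concat σ) k< (All.map below⇒block range)) (trans (w j k) (sym (expo-at m ns fitsᵐ j k<)))
      ... | no p≮ = trans
        (cnt-∉ (map var (concat σ)) (AllP.map⁺ (All.map (λ {x} q e → p≮ (subst (_< total ns) (sym e) (offset-<-total ns (proj₂ x) (below⇒block q)))) range)))
        (sym (atD-≥ a (subst (_≤ p) (sym (expo-length m ns fitsᵐ)) (ℕP.≮⇒≥ p≮))))

    content⇒weight : ∀ {σ} → HasShape lams σ → Allˡ (Allˡ BelowBasement) σ → hasContent (entries (index' σ)) a ≡ true → HasWeight σ m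
    content⇒weight {σ} shp range e j k with k ℕ.<? lookup ns j
    ... | yes k< = trans (sym (cnt-count ns (k , j) (concat σ) k< (All.map below⇒block (reconcat {σ = σ} range))))
      (trans (cong (cnt (var (k , j))) (sym (entries-indexed (blockInfo lams) σ (shape-length shp))))
        (trans (hasContent-sound (entries (index' σ)) a e (var (k , j))) (expo-at m ns fitsᵐ j k<)))
    ... | no k≮ = trans
      (count-∉ (k , j) (concat σ) (λ { p refl → k≮ (below⇒block (All.lookup (reconcat {σ = σ} range) p)) }))
      (sym (atD-≥ (lookup m j) (ℕP.≤-trans (fitsᵐ j) (ℕP.≮⇒≥ k≮))))

    form-indexed : ∀ bs {σ μ} → Pointwise (λ col h → length col ≡ h) σ μ → length bs ≡ length σ →
      map form (map (indexColumn lams ns fitsˡ) (zipWith columnOf bs σ)) ≡ zipWith (λ h b → h , basement lams ns b) μ bs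
    form-indexed [] [] _ = refl
    form-indexed (b ∷ bs) {c ∷ σ} (e ∷ es) l = cong₂ _∷_
      (cong (_, basement lams ns b) (trans (LP.length-map _ (map (λ x → nat (proj₁ x) (proj₂ x)) c)) (trans (LP.length-map _ c) e)))
      (form-indexed bs es (ℕP.suc-injective l))

    good⇒tableau : ∀ {σ} → Good σ → IsTableau (total ns) (topConfig lams ns) (index' σ)
    good⇒tableau {σ} (inL@(shp , _) , w) = form-indexed (blockInfo lams) shp (shape-length shp)
      , bounded (blockInfo lams) (weight-range w)
      , InL⇒ok lams ns fitsˡ σ shp (weight-range w) inL
      where
      bounded : ∀ bs {σ} → Allˡ (Allˡ BelowBasement) σ → Entries< (total ns) (map (indexColumn lams ns fitsˡ) (zipWith columnOf bs σ))
      bounded [] _ = []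
      bounded (b ∷ bs) [] = []
      bounded (b ∷ bs) (p ∷ ps) = AllP.map⁺ (AllP.map⁺ (All.map (λ {x} q → offset-<-total ns (proj₂ x) (below⇒block q)) p)) ∷ bounded bs ps

    injective-rows : ∀ {σ σ'} → Allˡ (Allˡ BelowBasement) σ → Allˡ (Allˡ BelowBasement) σ' → ∀ bs → length bs ≡ length σ → length bs ≡ length σ' →
      map (indexColumn lams ns fitsˡ) (zipWith columnOf bs σ) ≡ map (indexColumn lams ns fitsˡ) (zipWith columnOf bs σ') → σ ≡ σ'
    injective-rows [] [] [] _ _ _ = refl
    injective-rows (p ∷ ps) (q ∷ qs) (b ∷ bs) l l' e with e₁ , e₂ ← ∷-injective e =
      cong₂ _∷_ (column p q (trans (LP.map-∘ _) (trans (cong proj₂ e₁) (sym (LP.map-∘ _)))))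
        (injective-rows ps qs bs (ℕP.suc-injective l) (ℕP.suc-injective l') e₂)
      where
      column : ∀ {c c'} → Allˡ BelowBasement c → Allˡ BelowBasement c' → map var c ≡ map var c' → c ≡ c'
      column [] [] _ = refl
      column (p ∷ ps) (q ∷ qs) e with e₁ , e₂ ← ∷-injective e =
        cong₂ _∷_ (offset-injective ns (below⇒block p) (below⇒block q) e₁) (column ps qs e₂)

    good-injective : ∀ {σ σ'} → Good σ → Good σ' → index' σ ≡ index' σ' → σ ≡ σ'
    good-injective ((shp , _) , w) ((shp' , _) , w') e =
      injective-rows (weight-range w) (weight-range w') (blockInfo lams) (shape-length shp) (shape-length shp') e

    -- A tableau might use the variables that stand for the basement labels. The exponents of
    -- `expo m ns` vanish there, so the prescribed content makes every entry an ordinary label in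
    -- range.
    tableau⇒good : ∀ {T} → IsTableau (total ns) (topConfig lams ns) T → hasContent (entries T) a ≡ true →
      ∃[ σ ] index' σ ≡ T × Good σ
    tableau⇒good {T} (fm , lt , o) hc =
      let σ , e , range = lift-list (map var) (All.map (lift-list var) (preimages T lt id))
          shp , eq = rebuild T (shape lams) (blockInfo lams) (sym (blockInfo-length lams)) fm e
      in σ , eq , ok⇒InL lams ns fitsˡ σ shp range (trans (cong ok eq) o)
           , content⇒weight shp range (trans (cong (λ T → hasContent (entries T) a) eq) hc)
      where
      preimage : ∀ {p} → p < total ns → p ∈ entries T → ∃[ x ] var x ≡ p × BelowBasement x
      preimage {p} p< p∈ with j , k , k< , refl ← decompose ns p p< =
        (k , j) , refl , ℕP.<-≤-trans (atD-positive (lookup m j) (subst (0 <_)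
          (trans (hasContent-sound (entries T) a hc p) (expo-at m ns fitsᵐ j k<)) (cnt-∈ p∈))) (small j)
      preimages : ∀ U → Entries< (total ns) U → (∀ {p} → p ∈ entries U → p ∈ entries T) →
        Allˡ (Allˡ (λ p → ∃[ x ] var x ≡ p × BelowBasement x)) (map proj₂ U)
      preimages [] [] f = []
      preimages ((t , c) ∷ U) (q ∷ qs) f =
        All.tabulate (λ p∈ → preimage (All.lookup q p∈) (f (∈P.∈-++⁺ˡ p∈))) ∷ preimages U qs (λ p∈ → f (∈P.∈-++⁺ʳ c p∈))
      rebuild : ∀ T μ bs → length μ ≡ length bs → map form T ≡ zipWith (λ h b → h , basement lams ns b) μ bs →
        ∀ {σ} → map (map var) σ ≡ map proj₂ T →
        Pointwise (λ col h → length col ≡ h) σ μ × map (indexColumn lams ns fitsˡ) (zipWith columnOf bs σ) ≡ T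
      rebuild [] [] [] _ _ {[]} _ = [] , refl
      rebuild [] [] (_ ∷ _) ()
      rebuild [] (_ ∷ _) (_ ∷ _) _ ()
      rebuild ((t , c) ∷ T) (h ∷ μ) (b ∷ bs) l e {x ∷ σ} e'
        with e₁ , e₂ ← ∷-injective e with refl , e₂' ← ∷-injective e'
        with ps , eq ← rebuild T μ bs (ℕP.suc-injective l) e₂ e₂' =
        trans (sym (LP.length-map var x)) (cong proj₁ e₁) ∷ ps
        , cong₂ _∷_ (cong₂ _,_ (sym (cong proj₂ e₁)) (sym (LP.map-∘ x))) eq

  module _ (part : All (Allˡ (0 <_)) lams) where

    private
      Ts : List (List Column)
      Ts = keyTableaux lams ns part fitsˡ a

      among : ∀ {ls σ} → Allˡ Good ls → Good σ → index' σ ∈ map index' ls → σ ∈ ls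
      among (g' ∷ gs) g (here e) = here (good-injective g g' e)
      among (g' ∷ gs) g (there p) = there (among gs g p)

      enumeration : ∃[ ls ] map index' ls ≡ Ts × Allˡ Good ls
      enumeration = lift-list index' (All.tabulate good)
        where
        good : ∀ {T} → T ∈ Ts → ∃[ σ ] index' σ ≡ T × Good σ
        good T∈ = tableau⇒good (proj₁ (keyTableaux-sound lams ns part fitsˡ a T∈)) (proj₂ (keyTableaux-sound lams ns part fitsˡ a T∈))

    abstract

      goodFillings : List (Filling r)
      goodFillings = proj₁ enumeration

      goodFillings-unique : Unique goodFillings
      goodFillings-unique = Unique.map⁻ {f = index'} (subst Unique (sym (proj₁ (proj₂ enumeration))) (keyTableaux-unique lams ns part fitsˡ a))

      ∈-goodFillings : ∀ σ → (σ ∈ goodFillings) ⇔ (InL lams σ × HasWeight σ m)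
      ∈-goodFillings σ = mk⇔ (All.lookup (proj₂ (proj₂ enumeration))) (λ g → among (proj₂ (proj₂ enumeration)) g
        (subst (index' σ ∈_) (sym (proj₁ (proj₂ enumeration)))
          (keyTableaux-complete lams ns part fitsˡ a (good⇒tableau g) (weight⇒content (proj₁ (proj₁ g)) (proj₂ g)))))

      key-counts : ∀ {K} → IsKey (keyComp lams ns) K → K (expo m ns) ≡ + length goodFillings
      key-counts isKey = trans (key-coefficient lams ns part fitsˡ isKey a (expo-length m ns fitsᵐ))
        (cong +_ (trans (cong length (sym (proj₁ (proj₂ enumeration)))) (LP.length-map index' goodFillings)))

-- Stability of the coefficients

size : ∀ {r} → Vec (List ℕ) r → Vec (List ℕ) r → ℕ
size [] [] = 0
size (e ∷ m) (l ∷ lams) = length e ℕ.+ length l ℕ.+ size m lams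

size-≥ : ∀ {r} (m lams : Vec (List ℕ) r) j → length (lookup m j) ℕ.+ length (lookup lams j) ≤ size m lams
size-≥ (e ∷ m) (l ∷ lams) Fin.zero = ℕP.m≤m+n _ _
size-≥ (e ∷ m) (l ∷ lams) (Fin.suc j) = ℕP.≤-trans (size-≥ m lams j) (ℕP.m≤n+m _ _)

mainTheorem4 : (r : ℕ) (lams : Vec (List ℕ) r) → All IsPartition lams →
    (m : Vec (List ℕ) r) →
    ∃[ ls ] (Unique ls × (∀ (σ : Filling r) → (σ ∈ ls) ⇔ (InL lams σ × HasWeight σ m))
    × ∃[ N ] (∀ (ns : Vec ℕ r) → (∀ j → N ≤ lookup ns j) →
    ∀ (K : Poly) → IsKey (keyComp lams ns) K →
    K (expo m ns) ≡ + (length ls)))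
mainTheorem4 r lams parts m = goodFillings lams m ns₀ large₀ part , unique₀ , spec₀ , size m lams , λ ns N≤ K isKey →
  let large j = ℕP.≤-trans (size-≥ m lams j) (N≤ j) in
  -- The fillings of weight `m` are described without reference to the alphabets. So the lists for
  -- `ns` and for `ns₀` enumerate the same set without repetition and have equal lengths.
  trans (key-counts lams m ns large part isKey) (cong +_ (↭-length (∼bag⇒↭ (unique∧set⇒bag
    (goodFillings-unique lams m ns large part) unique₀ (λ {σ} →
      let open Equivalence; spec = ∈-goodFillings lams m ns large part σ in
      mk⇔ (from (spec₀ σ) ∘ to spec) (from spec ∘ to (spec₀ σ)))))))
  where
  part : All (Allˡ (0 <_)) lams
  part = VAll.map proj₂ parts
  ns₀ : Vec ℕ r
  ns₀ = Vec.replicate r (size m lams)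
  large₀ : ∀ j → length (lookup m j) ℕ.+ length (lookup lams j) ≤ lookup ns₀ j
  large₀ j = subst (length (lookup m j) ℕ.+ length (lookup lams j) ≤_) (sym (VecP.lookup-replicate j (size m lams))) (size-≥ m lams j)
  unique₀ = goodFillings-unique lams m ns₀ large₀ part
  spec₀ = ∈-goodFillings lams m ns₀ large₀ part
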